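{- Let $c\in\mathbb{R}_{\ge1}$ and $r\in\{2,3\}$. Let $G=\bigoplus_{i=1}^n\bigoplus_{j=1}^{n_i}C_{p_i^{e_{ij}}}$ be a finite abelian group, where $p_i>r$ ($1\le i\le n$) are distinct primes, with $p_1<\cdots<p_n<cp_1$ if $n>1$. Suppose that $K_1(G)=K_1^*(G)$ and $k(C_r\oplus G)=k^*(C_r\oplus G)$. Suppose that $p_1$ is large enough so that $$\frac{1}{r}+\frac{1}{p_1}K_1^*\left(\bigoplus_{j=1}^{n_1}C_{p_1^{e_{1j}}}\right)+\sum_{i=2}^n\sum_{j=1}^{n_i}\frac{(cp_1)^{e_{ij}}-1}{(cp_1)^{e_{ij}+1}-(cp_1)^{e_{ij}}}\ \ge\ \frac{\log_2\left(r\,c^{\sum_{i=2}^n\sum_{j=1}^{n_i}e_{ij}}\,p_1^{\sum_{i=1}^n\sum_{j=1}^{n_i}e_{ij}}\right)}{p_1}.\qquad(*)$$ Then $K_1(C_r\oplus G)=K_1^*(C_r\oplus G)$. Furthermore, if equality does not hold in $(*)$, then any UFIM $S$ over $(C_r\oplus G)\setminus\{0\}$ with $k(S)=K_1(C_r\oplus G)$ has a decomposition $S=S_r\sqcup S_G$ such that $S_r$ is a UFIM over $C_r\setminus\{0\}$ and $S_G$ is a UFIM over $G\setminus\{0\}$ (with $C_r$ and $G$ regarded as subgroups of $C_r\oplus G$).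
   Context: Groups are finite abelian, written additively; $C_n$ is the cyclic group of order $n$. An indexed multiset $S=\{g_1,\ldots,g_\ell\}$ over a set $X\subseteq G$ is a finite (possibly empty) indexed family of elements of $X$; for $I\subseteq[\ell]$ put $S(I)=\{g_i : i\in I\}$; submultisets of $S$ are the $S(I)$, and disjoint unions $\sqcup$ are taken with respect to indices. Put $\sigma(S)=\sum_{g\in S}g$ (with multiplicity), $\sigma(\emptyset)=0$. $S$ is zero-sum if $\sigma(S)=0$; minimal zero-sum if $\sigma(S)=0$ and $\sigma(S')\ne0$ for every $\emptyset\subsetneq S'\subsetneq S$; zero-sum free if $\sigma(S')\neq0$ for every $\emptyset\subsetneq S'\subseteq S$. An irreducible factorization of $S$ over $G\setminus\{0\}$ is a partition $[\ell]=\bigsqcup_{i=1}^m I_i$ into nonempty sets with each $S(I_i)$ minimal zero-sum; two factorizations are equivalent iff they are the same set of blocks $\{I_1,\ldots,I_m\}$. A unique factorization indexed multiset (UFIM) over $G\setminus\{0\}$ is a zero-sum indexed multiset over $G\setminus\{0\}$ with exactly one irreducible factorization up to equivalence. The cross number of $S$ is $k(S)=\sum_{g\in S}\frac1{\mathrm{ord}(g)}$ (with multiplicity; $k(\emptyset)=0$). Put $K_1(G)=\max\{k(S): S\text{ is a UFIM over }G\setminus\{0\}\}$ and $k(G)=\max\{k(S): S\text{ is a zero-sum free indexed multiset over }G\setminus\{0\}\}$. For $G=\bigoplus_{i=1}^n\bigoplus_{j=1}^{n_i}C_{p_i^{e_{ij}}}$ with distinct primes $p_i$ and $e_{ij}\ge1$,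 put $K_1^*(G)=\sum_{i=1}^n\sum_{j=1}^{n_i}\frac{p_i^{e_{ij}}-1}{p_i^{e_{ij}}-p_i^{e_{ij}-1}}$ and $k^*(G)=\sum_{i=1}^n\sum_{j=1}^{n_i}\frac{p_i^{e_{ij}}-1}{p_i^{e_{ij}}}$. -}

module Defs where

open import Algebra.Bundles using (AbelianGroup)
import Algebra.Construct.DirectProduct as DirectProduct
import Algebra.Construct.Terminal as Terminal
import Algebra.Definitions.RawMonoid as RawMonoidDefs
open import Data.Bool.Base using (if_then_else_)
open import Data.Fin.Base using (Fin; zero; suc)
open import Data.Fin.Subset using (Subset; _∈_; _⊂_; Nonempty; ⊤)
open import Data.Integer.Base as ℤ using (ℤ; +_; -[1+_])
import Data.Integer.Properties as ℤₚ
open import Data.Integer.Divisibility.Signed using (_∣_; divides; ∣m∣n⇒∣m+n; ∣m⇒∣-m)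
open import Data.Integer.Tactic.RingSolver using (solve-∀)
open import Data.List.Base as List using (List)
open import Data.Nat.Base as ℕ using (ℕ; zero; suc)
open import Data.Product using (Σ; ∃; ∃!; _×_; _,_; ∃-syntax)
open import Data.Rational.Base as ℚ using (ℚ; 0ℚ; 1ℚ; _/_; ↥_; ↧ₙ_)
open import Data.Sum.Base using (_⊎_; inj₁; inj₂)
import Data.Vec.Base as Vec
open import Data.Vec.Functional as Vector using (Vector; tail)
open import Function.Bundles using (_⇔_; _↔_; Inverse)
open import Level using (Level; 0ℓ)
open import Relation.Binary.PropositionalEquality using (_≡_; refl; sym; subst)
open import Relation.Nullary using (¬_)

private
  variable
    a : Level
    A : Set a

AbGroup : Set₁
AbGroup = AbelianGroup 0ℓ 0ℓ

-- A doubly indexed family e_{ij} (1 ≤ i ≤ n, 1 ≤ j ≤ n_i) of naturals is a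
-- vector of lists, n_i being the length of the i-th list.

Exponents : ℕ → Set
Exponents = Vector (List ℕ)

fold₂ : (A → A → A) → A → ∀ {n} → (Fin n → ℕ → A) → Exponents n → A
fold₂ _∙_ ε f e = Vector.foldr _∙_ ε (λ i → List.foldr _∙_ ε (List.map (f i) (e i)))

-- ℤ with congruence modulo n as its equality.

C : ℕ → AbGroup
C n = record
  { Carrier = ℤ
  ; _≈_ = _~_
  ; _∙_ = ℤ._+_
  ; ε = ℤ.0ℤ
  ; _⁻¹ = ℤ.-_
  ; isAbelianGroup = record
    { isGroup = record
      { isMonoid = record
        { isSemigroup = record
          { isMagma = record
            { isEquivalence = record
              { refl = λ {x} → reflexive {x} refl
              ; sym = λ {x} {y} d → subst (+ n ∣_) (neg-sub x y) (∣m⇒∣-m d)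
              ; trans = λ {x} {y} {z} d d′ →
                  subst (+ n ∣_) (telescope x y z) (∣m∣n⇒∣m+n d d′)
              }
            ; ∙-cong = λ {x} {y} {u} {v} d d′ →
                subst (+ n ∣_) (add-sub x y u v) (∣m∣n⇒∣m+n d d′)
            }
          ; assoc = λ x y z → reflexive (ℤₚ.+-assoc x y z)
          }
        ; identity = (λ x → reflexive (ℤₚ.+-identityˡ x))
                   , (λ x → reflexive (ℤₚ.+-identityʳ x))
        }
      ; inverse = (λ x → reflexive (ℤₚ.+-inverseˡ x))
                , (λ x → reflexive (ℤₚ.+-inverseʳ x))
      ; ⁻¹-cong = λ {x} {y} d → subst (+ n ∣_) (neg-sub′ x y) (∣m⇒∣-m d)
      }
    ; comm = λ x y → reflexive (ℤₚ.+-comm x y)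
    }
  }
  where
  _~_ : ℤ → ℤ → Set
  x ~ y = + n ∣ x ℤ.- y

  reflexive : ∀ {x y} → x ≡ y → x ~ y
  reflexive {x} refl = subst (+ n ∣_) (sym (ℤₚ.+-inverseʳ x)) (divides ℤ.0ℤ refl)

  neg-sub : ∀ x y → ℤ.- (x ℤ.- y) ≡ y ℤ.- x
  neg-sub = solve-∀

  neg-sub′ : ∀ x y → ℤ.- (x ℤ.- y) ≡ (ℤ.- x) ℤ.- (ℤ.- y)
  neg-sub′ = solve-∀

  telescope : ∀ x y z → (x ℤ.- y) ℤ.+ (y ℤ.- z) ≡ x ℤ.- z
  telescope = solve-∀

  add-sub : ∀ x y u v → (x ℤ.- y) ℤ.+ (u ℤ.- v) ≡ (x ℤ.+ u) ℤ.- (y ℤ.+ v)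
  add-sub = solve-∀

infixr 6 _⊕_

_⊕_ : AbGroup → AbGroup → AbGroup
_⊕_ = DirectProduct.abelianGroup

⨁C : ∀ {n} → Vector ℕ n → Exponents n → AbGroup
⨁C p = fold₂ _⊕_ Terminal.abelianGroup (λ i k → C (p i ℕ.^ k))

-- Division by zero is given the value 0; it does not occur below when
-- the pᵢ are primes and the exponents are positive.

infixl 7 _⁄_

_⁄_ : ℕ → ℕ → ℚ
m ⁄ zero  = 0ℚ
m ⁄ suc n = + m / suc n

K₁* : ∀ {n} → Vector ℕ n → Exponents n → ℚ
K₁* p = fold₂ ℚ._+_ 0ℚ
  (λ i k → (p i ℕ.^ k ℕ.∸ 1) ⁄ (p i ℕ.^ k ℕ.∸ p i ℕ.^ (k ℕ.∸ 1)))

k* : ∀ {n} → Vector ℕ n → Exponents n → ℚ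
k* p = fold₂ ℚ._+_ 0ℚ (λ i k → (p i ℕ.^ k ℕ.∸ 1) ⁄ (p i ℕ.^ k))

IsMax : (ℚ → Set) → ℚ → Set
IsMax P v = P v × (∀ {w} → P w → w ℚ.≤ v)

module Multiset (G : AbGroup) where
  open AbelianGroup G renaming (ε to 0#)
  open RawMonoidDefs rawMonoid using (sum) renaming (_×_ to _·_)

  IMultiset : ℕ → Set
  IMultiset = Vector Carrier

  OverNonzero : ∀ {ℓ} → IMultiset ℓ → Set
  OverNonzero S = ∀ i → ¬ (S i ≈ 0#)

  -- σ S I is the sum of the submultiset S(I).

  σ : ∀ {ℓ} → IMultiset ℓ → Subset ℓ → Carrier
  σ S I = sum (λ i → if Vec.lookup I i then S i else 0#)

  ZeroSum : ∀ {ℓ} → IMultiset ℓ → Subset ℓ → Set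
  ZeroSum S I = σ S I ≈ 0#

  MinimalZeroSum : ∀ {ℓ} → IMultiset ℓ → Subset ℓ → Set
  MinimalZeroSum S I =
    ZeroSum S I × (∀ J → Nonempty J → J ⊂ I → ¬ ZeroSum S J)

  ZeroSumFree : ∀ {ℓ} → IMultiset ℓ → Set
  ZeroSumFree S = ∀ J → Nonempty J → ¬ ZeroSum S J

  record Factorization {ℓ} (S : IMultiset ℓ) : Set where
    field
      size      : ℕ
      block     : Vector (Subset ℓ) size
      nonempty  : ∀ i → Nonempty (block i)
      partition : ∀ x → ∃! _≡_ (λ i → x ∈ block i)
      minimal   : ∀ i → MinimalZeroSum S (block i)

    IsBlock : Subset ℓ → Set
    IsBlock I = ∃ λ i → block i ≡ I

  open Factorization

  Equivalent : ∀ {ℓ} {S : IMultiset ℓ} → Factorization S → Factorization S → Set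
  Equivalent F F′ = ∀ I → IsBlock F I ⇔ IsBlock F′ I

  record UFIM {ℓ} (S : IMultiset ℓ) : Set where
    field
      overNonzero   : OverNonzero S
      zeroSum       : ZeroSum S ⊤
      factorization : Factorization S
      unique        : ∀ F → Equivalent F factorization

  IsOrder : Carrier → ℕ → Set
  IsOrder g n = 0 ℕ.< n × n · g ≈ 0# × (∀ m → 0 ℕ.< m → m · g ≈ 0# → n ℕ.≤ m)

  -- CrossNumber S q means k(S) = q.

  CrossNumber : ∀ {ℓ} → IMultiset ℓ → ℚ → Set
  CrossNumber {ℓ} S q = Σ (Vector ℕ ℓ) λ o →
    (∀ i → IsOrder (S i) (o i)) × q ≡ Vector.foldr ℚ._+_ 0ℚ (λ i → 1 ⁄ o i)

  -- K₁≡ v means K₁(G) = v, and k≡ v means k(G) = v.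

  K₁≡ : ℚ → Set
  K₁≡ = IsMax λ q → ∃ λ ℓ → Σ (IMultiset ℓ) λ S → UFIM S × CrossNumber S q

  k≡ : ℚ → Set
  k≡ = IsMax λ q → ∃ λ ℓ → Σ (IMultiset ℓ) λ S →
    OverNonzero S × ZeroSumFree S × CrossNumber S q

open Multiset public

-- S = S_H ⊔ S_G with S_H and S_G UFIMs over the nonzero elements of the
-- summands H and G; the bijection matches the indices.

module _ (H G : AbGroup) where
  private
    module H = AbelianGroup H
    module G = AbelianGroup G
    module HG = AbelianGroup (H ⊕ G)

  record Decomposition {ℓ} (S : IMultiset (H ⊕ G) ℓ) : Set where
    field
      {ℓ₁ ℓ₂} : ℕ
      S₁      : IMultiset H ℓ₁
      S₂      : IMultiset G ℓ₂
      ufim₁   : UFIM H S₁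
      ufim₂   : UFIM G S₂
      index   : (Fin ℓ₁ ⊎ Fin ℓ₂) ↔ Fin ℓ
      eq₁     : ∀ i → S (Inverse.to index (inj₁ i)) HG.≈ (S₁ i , G.ε)
      eq₂     : ∀ j → S (Inverse.to index (inj₂ j)) HG.≈ (H.ε , S₂ j)

-- A pair of a lower and an upper set of rationals.  The operations are
-- the usual ones on Dedekind reals, given on all cuts to keep them total;
-- their values on arguments that are not Dedekind reals are irrelevant.

record Cut : Set₁ where
  field
    L U : ℚ → Set

open Cut public

record IsReal (x : Cut) : Set where
  field
    inhabitedᴸ : ∃ λ q → L x q
    inhabitedᵁ : ∃ λ q → U x q
    roundedᴸ   : ∀ q → L x q ⇔ (∃ λ s → q ℚ.< s × L x s)
    roundedᵁ   : ∀ s → U x s ⇔ (∃ λ q → q ℚ.< s × U x q)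
    disjoint   : ∀ q → ¬ (L x q × U x q)
    located    : ∀ {q s} → q ℚ.< s → L x q ⊎ U x s

infix 4 _≤ᴿ_ _<ᴿ_ _≃ᴿ_
infixl 6 _+ᴿ_ _-ᴿ_
infixl 7 _*ᴿ_ _/ᴿ_
infixr 8 _^ᴿ_

_≤ᴿ_ : Cut → Cut → Set
x ≤ᴿ y = ∀ {q} → L x q → L y q

_<ᴿ_ : Cut → Cut → Set
x <ᴿ y = ∃ λ q → U x q × L y q

_≃ᴿ_ : Cut → Cut → Set
x ≃ᴿ y = x ≤ᴿ y × y ≤ᴿ x

fromℚ : ℚ → Cut
fromℚ p = record { L = ℚ._< p ; U = p ℚ.<_ }

fromℕ : ℕ → Cut
fromℕ n = fromℚ (+ n / 1)

_+ᴿ_ : Cut → Cut → Cut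
x +ᴿ y = record
  { L = λ q → ∃[ s ] ∃[ t ] (L x s × L y t × q ℚ.< s ℚ.+ t)
  ; U = λ q → ∃[ s ] ∃[ t ] (U x s × U y t × s ℚ.+ t ℚ.< q)
  }

-ᴿ_ : Cut → Cut
-ᴿ x = record { L = λ q → U x (ℚ.- q) ; U = λ q → L x (ℚ.- q) }

_-ᴿ_ : Cut → Cut → Cut
x -ᴿ y = x +ᴿ (-ᴿ y)

-- Interval multiplication: x lies in (s , t) and y in (u , v).

_*ᴿ_ : Cut → Cut → Cut
x *ᴿ y = record
  { L = λ q → ∃[ s ] ∃[ t ] ∃[ u ] ∃[ v ] (L x s × U x t × L y u × U y v ×
      q ℚ.< s ℚ.* u × q ℚ.< s ℚ.* v × q ℚ.< t ℚ.* u × q ℚ.< t ℚ.* v)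
  ; U = λ q → ∃[ s ] ∃[ t ] ∃[ u ] ∃[ v ] (L x s × U x t × L y u × U y v ×
      s ℚ.* u ℚ.< q × s ℚ.* v ℚ.< q × t ℚ.* u ℚ.< q × t ℚ.* v ℚ.< q)
  }

_^ᴿ_ : Cut → ℕ → Cut
x ^ᴿ zero  = fromℕ 1
x ^ᴿ suc n = x *ᴿ x ^ᴿ n

-- The reciprocal of x for x > 0.

recip : Cut → Cut
recip x = record
  { L = λ q → ∃[ s ] (U x s × q ℚ.* s ℚ.< 1ℚ)
  ; U = λ q → ∃[ s ] (0ℚ ℚ.< s × L x s × 1ℚ ℚ.< q ℚ.* s)
  }

_/ᴿ_ : Cut → Cut → Cut
x /ᴿ y = x *ᴿ recip y

2^_ : ℤ → ℚ
2^ (+ n)    = (2 ℕ.^ n) ⁄ 1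
2^ -[1+ n ] = 1 ⁄ (2 ℕ.^ suc n)

-- For x > 0 and b > 0:  a / b < log₂ x  iff  2 ^ a < x ^ b.

log₂ : Cut → Cut
log₂ x = record
  { L = λ q → L (x ^ᴿ ↧ₙ q) (2^ (↥ q))
  ; U = λ q → U (x ^ᴿ ↧ₙ q) (2^ (↥ q))
  }

module _ (c : Cut) (r : ℕ) {n} (p : Vector ℕ (suc n)) (e : Exponents (suc n)) where

  private
    p₁ = p zero
    cp₁ = c *ᴿ fromℕ p₁

    Σe : ∀ {m} → Exponents m → ℕ
    Σe = fold₂ ℕ._+_ 0 (λ _ k → k)

  lhs : Cut
  lhs = fromℚ (1 ⁄ r)
     +ᴿ fromℚ (1 ⁄ p₁ ℚ.* K₁* {1} (λ _ → p₁) (λ _ → e zero))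
     +ᴿ fold₂ _+ᴿ_ (fromℕ 0)
          (λ _ k → (cp₁ ^ᴿ k -ᴿ fromℕ 1) /ᴿ (cp₁ ^ᴿ (k ℕ.+ 1) -ᴿ cp₁ ^ᴿ k))
          (tail e)

  rhs : Cut
  rhs = log₂ (fromℕ r *ᴿ c ^ᴿ Σe (tail e) *ᴿ fromℕ p₁ ^ᴿ Σe e) /ᴿ fromℕ p₁

{-# OPTIONS --safe #-}

-- A multiset S is a UFIM iff its zero-sum submultisets are closed under
-- intersection.  Let S be a UFIM over C_r ⊕ G with m blocks.
--
-- Suppose that every block has an element outside C_r, hence of order at
-- least p₁.  Removing one such element from each block leaves a zero-sum
-- free multiset, so k(S) ≤ k*(C_r ⊕ G) + m / p₁.  The 2 ^ m sums of subsets
-- of a system of representatives of the blocks are distinct, so that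
-- m ≤ log₂ |C_r ⊕ G|, and (*) bounds m / p₁ by 1/r + ∑ (1/p + … + 1/p^e),
-- the sum being over the summands C_{p^e} of G.  This is the difference
-- K₁*(C_r ⊕ G) − k*(C_r ⊕ G).
--
-- Otherwise some block B lies in C_r.  Since r ≤ 3, the nonzero elements of
-- C_r agree up to sign, so the subset sums of B exhaust C_r; hence the image
-- of S ∖ B in G is still a UFIM.  As |B| ≤ r, this gives k(S) ≤ 1 + K₁(G),
-- and equality forces S ∖ B to have the same orders as its image, that is,
-- to lie in G.

module Submission where

open import Defs
open import Algebra.Bundles using (AbelianGroup)
open import Data.Fin.Base using (Fin; zero; suc)
import Data.Fin.Properties as Finₚ
open import Data.Nat.Base as ℕ using (ℕ; zero; suc; z≤n; s≤s)
import Data.Nat.Properties as ℕₚ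
open import Data.Product using (Σ; ∃; _×_; _,_; proj₁; proj₂)
open import Data.Sum.Base using (_⊎_; inj₁; inj₂; [_,_]′)
open import Data.Vec.Functional using (Vector)
open import Function.Base using (_∘_; id)
open import Relation.Binary.PropositionalEquality as ≡ using (_≡_; _≢_; refl; cong; cong₂)
open import Relation.Nullary using (¬_; yes; no; contradiction)

-- The image of a UFIM in a quotient need not be a UFIM: a submultiset can be zero-sum modulo C_r
-- without being zero-sum. A block that reaches all of C_r repairs this, since part of it cancels
-- any C_r-component. In C_5 the block {1, -1} reaches only 0, 1 and -1, so this argument stops at r
-- = 3.
--
-- The other obstacle is that c is real while cross numbers are rational. A rational c₀ < c with p_i
-- ≤ c₀ p₁ for i ≥ 2 is fixed, and this bound serves both sides of (*). It bounds |C_r ⊕ G| by the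
-- radicand, so that the right side is at least m / p₁. And since (x^e - 1) / (x^(e+1) - x^e) = 1/x
-- + ... + 1/x^e decreases in x, the left side is at most the same sum with p_i in place of c p₁.
-- Hence m / p₁ ≤ rhs ≤ lhs ≤ K₁* - k*. An extremal S of the first kind makes the ends of this chain
-- meet, which is equality in (*).
--
-- The value is attained by r copies of 1 in C_r, of cross number 1, next to an extremal UFIM over
-- G.

-- Zero-sum submultisets, unique factorization and the number of blocks

module ZeroSums where
  import Algebra.Properties.AbelianGroup as GroupProperties
  import Algebra.Properties.CommutativeMonoid.Sum as Sum
  open import Data.Bool.Base using (Bool; true; false; _∧_; not; if_then_else_)
  open import Data.Fin.Base using (_↑ˡ_; _↑ʳ_; splitAt; join; combine; finToFun; funToFin)
  open import Data.Fin.Subset using (Subset; _∈_; _∉_; _⊆_; Nonempty; ⊤; ⊥; _∩_; ∁; ⁅_⁆; ∣_∣)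
  open import Data.Fin.Subset.Properties
  open import Data.Nat.Induction using (<-wellFounded)
  open import Data.Vec.Base using (lookup; tabulate)
  open import Data.Vec.Properties using (lookup∘tabulate; tabulate∘lookup; tabulate-cong; lookup-zipWith; lookup-map; []=⇒lookup; lookup⇒[]=)
  open import Function.Bundles using (Equivalence; mk⇔)
  open import Induction.WellFounded using (Acc; acc)
  open import Relation.Binary.Definitions using (Decidable)
  open import Relation.Nullary using (does)
  open import Relation.Nullary.Decidable using (_×-dec_; ¬?; dec-true; dec-false)

  private
    variable
      ℓ : ℕ

  ∈-tabulate⁺ : (f : Fin ℓ → Bool) → ∀ {x} → f x ≡ true → x ∈ tabulate f
  ∈-tabulate⁺ f {x} eq = lookup⇒[]= x _ (≡.trans (lookup∘tabulate f x) eq)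

  ∈-tabulate⁻ : (f : Fin ℓ → Bool) → ∀ {x} → x ∈ tabulate f → f x ≡ true
  ∈-tabulate⁻ f {x} x∈ = ≡.trans (≡.sym (lookup∘tabulate f x)) ([]=⇒lookup x∈)

  ∉⇒lookup : ∀ (I : Subset ℓ) {x} → x ∉ I → lookup I x ≡ false
  ∉⇒lookup I {x} x∉ with lookup I x in eq
  ... | false = refl
  ... | true  = contradiction (lookup⇒[]= x I eq) x∉

  lookup-ext : {I J : Subset ℓ} → (∀ x → lookup I x ≡ lookup J x) → I ≡ J
  lookup-ext {I = I} {J} eq =
    ≡.trans (≡.sym (tabulate∘lookup I)) (≡.trans (tabulate-cong eq) (tabulate∘lookup J))

  ∣∩∁∣<∣∣ : ∀ (I J : Subset ℓ) {x} → x ∈ I → x ∈ J → ∣ I ∩ ∁ J ∣ ℕ.< ∣ I ∣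
  ∣∩∁∣<∣∣ I J x∈I x∈J = p⊂q⇒∣p∣<∣q∣
    (p∩q⊆p I (∁ J) , _ , x∈I , λ x∈ → x∈∁p⇒x∉p (proj₂ (x∈p∩q⁻ I (∁ J) x∈)) x∈J)

  x∈p∩∁q⁻ : ∀ (I J : Subset ℓ) {x} → x ∈ I ∩ ∁ J → x ∈ I × x ∉ J
  x∈p∩∁q⁻ I J x∈ = let x∈I , x∈∁J = x∈p∩q⁻ I (∁ J) x∈ in x∈I , x∈∁p⇒x∉p x∈∁J

  x∈p∩∁q⁺ : ∀ (I J : Subset ℓ) {x} → x ∈ I → x ∉ J → x ∈ I ∩ ∁ J
  x∈p∩∁q⁺ I J x∈I x∉J = x∈p∩q⁺ (x∈I , x∉p⇒x∈∁p x∉J)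

  module Combinatorics (G : AbGroup) where
    open AbelianGroup G renaming (ε to 0#; _∙_ to _+_; refl to ≈-refl; sym to ≈-sym; trans to ≈-trans)
    open GroupProperties G using (∙-cancelʳ)
    open Sum commutativeMonoid using (sum; sum-cong-≋; sum-cong-≗; sum-replicate-zero; ∑-distrib-+)
    open import Relation.Binary.Reasoning.Setoid setoid

    module _ (S : IMultiset G ℓ) where

      term : (Fin ℓ → Bool) → Fin ℓ → Carrier
      term f i = if f i then S i else 0#

      σ-tabulate : ∀ f → σ G S (tabulate f) ≈ sum (term f)
      σ-tabulate f = reflexive
        (sum-cong-≗ λ i → cong (λ b → if b then S i else 0#) (lookup∘tabulate f i))

      σ-Empty : ∀ I → ¬ Nonempty I → ZeroSum G S I
      σ-Empty I empty = ≈-trans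
        (sum-cong-≋ λ i → reflexive (cong (λ b → if b then S i else 0#) (∉⇒lookup I (empty ∘ (i ,_)))))
        (sum-replicate-zero ℓ)

      σ-split : ∀ I J → σ G S I ≈ σ G S (I ∩ J) + σ G S (I ∩ ∁ J)
      σ-split I J = ≈-trans (sum-cong-≋ split) (∑-distrib-+ (term (lookup (I ∩ J))) (term (lookup (I ∩ ∁ J))))
        where
        split : ∀ i → term (lookup I) i ≈ term (lookup (I ∩ J)) i + term (lookup (I ∩ ∁ J)) i
        split i rewrite lookup-zipWith _∧_ i I J | lookup-zipWith _∧_ i I (∁ J) | lookup-map i not J
          with lookup I i | lookup J i
        ... | false | _     = ≈-sym (identityˡ 0#)
        ... | true  | false = ≈-sym (identityˡ (S i))
        ... | true  | true  = ≈-sym (identityʳ (S i))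

      zeroSum-∩∁ : ∀ I J → ZeroSum G S I → ZeroSum G S (I ∩ J) → ZeroSum G S (I ∩ ∁ J)
      zeroSum-∩∁ I J zI zIJ = begin
        σ G S (I ∩ ∁ J)                  ≈⟨ identityˡ _ ⟨
        0# + σ G S (I ∩ ∁ J)             ≈⟨ ∙-congʳ zIJ ⟨
        σ G S (I ∩ J) + σ G S (I ∩ ∁ J)  ≈⟨ σ-split I J ⟨
        σ G S I                          ≈⟨ zI ⟩
        0#                               ∎

      zeroSum-⊆ : ∀ {I J} → J ⊆ I → ZeroSum G S I → ZeroSum G S J → ZeroSum G S (I ∩ ∁ J)
      zeroSum-⊆ {I} {J} J⊆I zI zJ = zeroSum-∩∁ I J zI
        (≡.subst (ZeroSum G S) (⊆-antisym (λ x∈ → x∈p∩q⁺ (J⊆I x∈ , x∈)) (p∩q⊆q I J)) zJ)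

      σ-singleton : ∀ x → σ G S ⁅ x ⁆ ≈ S x
      σ-singleton = go S
        where
        go : ∀ {ℓ} (S : IMultiset G ℓ) x → σ G S ⁅ x ⁆ ≈ S x
        go S zero    = ≈-trans (∙-congˡ (σ-⊥ (S ∘ suc))) (identityʳ _)
          where
          σ-⊥ : ∀ {ℓ} (S : IMultiset G ℓ) → σ G S ⊥ ≈ 0#
          σ-⊥ {zero}  S = ≈-refl
          σ-⊥ {suc _} S = ≈-trans (identityˡ _) (σ-⊥ (S ∘ suc))
        go S (suc x) = ≈-trans (identityˡ _) (go (S ∘ suc) x)

      -- Factorizations of submultisets, so that a recursion can treat a zero-sum part and its
      -- complement separately; `I = ⊤` gives back `Factorization`.
      record PartialFactorization (I : Subset ℓ) : Set where
        field
          size      : ℕ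
          block     : Vector (Subset ℓ) size
          nonempty  : ∀ i → Nonempty (block i)
          block⊆    : ∀ i → block i ⊆ I
          cover     : ∀ {x} → x ∈ I → ∃ λ i → x ∈ block i
          disjoint  : ∀ {x i j} → x ∈ block i → x ∈ block j → i ≡ j
          minimal   : ∀ i → MinimalZeroSum G S (block i)

      trivial : ∀ {I} → ¬ Nonempty I → PartialFactorization I
      trivial empty = record
        { size = 0 ; block = λ () ; nonempty = λ () ; block⊆ = λ ()
        ; cover = λ x∈ → contradiction (_ , x∈) empty ; disjoint = λ { {i = ()} } ; minimal = λ () }

      single : ∀ {I} → Nonempty I → MinimalZeroSum G S I → PartialFactorization I
      single {I} ne min = record
        { size = 1 ; block = λ _ → I ; nonempty = λ _ → ne ; block⊆ = λ _ → id
        ; cover = λ x∈ → zero , x∈ ; disjoint = λ { {i = zero} {zero} _ _ → refl } ; minimal = λ _ → min }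

      merge : ∀ {I J} → J ⊆ I → PartialFactorization J → PartialFactorization (I ∩ ∁ J) → PartialFactorization I
      merge {I} {J} J⊆I P Q = record
        { size = P.size ℕ.+ Q.size
        ; block = block ; nonempty = nonempty ; block⊆ = block⊆ ; cover = cover
        ; disjoint = disjoint ; minimal = minimal }
        where
        module P = PartialFactorization P
        module Q = PartialFactorization Q
        either : Fin P.size ⊎ Fin Q.size → Subset ℓ
        either = [ P.block , Q.block ]′
        block : Vector (Subset ℓ) (P.size ℕ.+ Q.size)
        block = either ∘ splitAt P.size
        nonempty : ∀ i → Nonempty (block i)
        nonempty i with splitAt P.size i
        ... | inj₁ j = P.nonempty j
        ... | inj₂ j = Q.nonempty j
        block⊆ : ∀ i → block i ⊆ I
        block⊆ i with splitAt P.size i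
        ... | inj₁ j = J⊆I ∘ P.block⊆ j
        ... | inj₂ j = p∩q⊆p I (∁ J) ∘ Q.block⊆ j
        cover : ∀ {x} → x ∈ I → ∃ λ i → x ∈ block i
        cover {x} x∈I with x ∈? J
        ... | yes x∈J = let i , x∈i = P.cover x∈J in
          i ↑ˡ Q.size , ≡.subst (λ s → x ∈ either s) (≡.sym (Finₚ.splitAt-↑ˡ P.size i Q.size)) x∈i
        ... | no  x∉J = let i , x∈i = Q.cover (x∈p∩∁q⁺ I J x∈I x∉J) in
          P.size ↑ʳ i , ≡.subst (λ s → x ∈ either s) (≡.sym (Finₚ.splitAt-↑ʳ P.size Q.size i)) x∈i
        disjoint⊎ : ∀ {x} s t → x ∈ either s → x ∈ either t → s ≡ t
        disjoint⊎ (inj₁ i) (inj₁ j) x∈i x∈j = cong inj₁ (P.disjoint x∈i x∈j)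
        disjoint⊎ (inj₂ i) (inj₂ j) x∈i x∈j = cong inj₂ (Q.disjoint x∈i x∈j)
        disjoint⊎ (inj₁ i) (inj₂ j) x∈i x∈j =
          contradiction (P.block⊆ i x∈i) (proj₂ (x∈p∩∁q⁻ I J (Q.block⊆ j x∈j)))
        disjoint⊎ (inj₂ i) (inj₁ j) x∈i x∈j =
          contradiction (P.block⊆ j x∈j) (proj₂ (x∈p∩∁q⁻ I J (Q.block⊆ i x∈i)))
        disjoint : ∀ {x i j} → x ∈ block i → x ∈ block j → i ≡ j
        disjoint {x} {i} {j} x∈i x∈j = ≡.trans (≡.sym (Finₚ.join-splitAt P.size Q.size i))
          (≡.trans (cong (join P.size Q.size) (disjoint⊎ (splitAt P.size i) (splitAt P.size j) x∈i x∈j))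
            (Finₚ.join-splitAt P.size Q.size j))
        minimal : ∀ i → MinimalZeroSum G S (block i)
        minimal i with splitAt P.size i
        ... | inj₁ j = P.minimal j
        ... | inj₂ j = Q.minimal j

      toFactorization : PartialFactorization ⊤ → Factorization G S
      toFactorization P = record
        { size = size ; block = block ; nonempty = nonempty ; minimal = minimal
        ; partition = λ x → let i , x∈i = cover {x} ∈⊤ in i , x∈i , disjoint x∈i }
        where open PartialFactorization P

      IntersectionClosed : Set
      IntersectionClosed = ∀ I J → ZeroSum G S I → ZeroSum G S J → ZeroSum G S (I ∩ J)

      module _ (F : Factorization G S) where
        open Factorization F

        blockOf : Fin ℓ → Fin size
        blockOf x = proj₁ (partition x)

        ∈-blockOf : ∀ x → x ∈ block (blockOf x)
        ∈-blockOf x = proj₁ (proj₂ (partition x))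

        ∈⇒blockOf : ∀ {x i} → x ∈ block i → blockOf x ≡ i
        ∈⇒blockOf {x} = proj₂ (proj₂ (partition x))

        -- The unions of blocks: a block that meets `I` lies in `I`.
        BlockClosed : Subset ℓ → Set
        BlockClosed I = ∀ {i x y} → x ∈ block i → y ∈ block i → x ∈ I → y ∈ I

        -- Blocks are peeled off one at a time; what remains is again a union of blocks.
        blockClosed⇒zeroSum : ∀ I → BlockClosed I → ZeroSum G S I
        blockClosed⇒zeroSum I = go I (<-wellFounded ∣ I ∣)
          where
          go : ∀ I → Acc ℕ._<_ ∣ I ∣ → BlockClosed I → ZeroSum G S I
          go I (acc rec) closed with nonempty? I
          ... | no empty = σ-Empty I empty
          ... | yes (x , x∈I) = begin
            σ G S I                            ≈⟨ σ-split I B ⟩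
            σ G S (I ∩ B) + σ G S (I ∩ ∁ B)
              ≈⟨ ∙-cong (reflexive (cong (σ G S) I∩B≡B)) (go (I ∩ ∁ B) (rec (∣∩∁∣<∣∣ I B x∈I (∈-blockOf x))) closed′) ⟩
            σ G S B + 0#                       ≈⟨ identityʳ _ ⟩
            σ G S B                            ≈⟨ proj₁ (minimal (blockOf x)) ⟩
            0#                                 ∎
            where
            B = block (blockOf x)
            I∩B≡B : I ∩ B ≡ B
            I∩B≡B = ⊆-antisym (p∩q⊆q I B) (λ y∈ → x∈p∩q⁺ (closed (∈-blockOf x) y∈ x∈I , y∈))
            closed′ : BlockClosed (I ∩ ∁ B)
            closed′ {i} {y} {z} y∈i z∈i y∈ =
              let y∈I , y∉B = x∈p∩∁q⁻ I B y∈ in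
              x∈p∩∁q⁺ I B (closed y∈i z∈i y∈I) λ z∈B →
                y∉B (≡.subst (λ j → y ∈ block j) (≡.trans (≡.sym (∈⇒blockOf z∈i)) (∈⇒blockOf z∈B)) y∈i)

        -- If `I` contained only a part of a block, its intersection with the block would be a
        -- proper nonempty zero-sum part, against minimality.
        zeroSum⇒blockClosed : IntersectionClosed → ∀ {I} → ZeroSum G S I → BlockClosed I
        zeroSum⇒blockClosed inter {I} zI {i} {x} {y} x∈i y∈i x∈I with y ∈? I
        ... | yes y∈I = y∈I
        ... | no  y∉I = contradiction (inter I (block i) zI (proj₁ (minimal i)))
          (proj₂ (minimal i) (I ∩ block i) (x , x∈p∩q⁺ (x∈I , x∈i))
            (p∩q⊆q I (block i) , y , y∈i , λ y∈ → y∉I (proj₁ (x∈p∩q⁻ I (block i) y∈))))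

        -- Being zero-sum, the block `J` of `F′` is a union of blocks of `F`, so it contains the one
        -- through `x`; minimality of `J` leaves no room for more.
        zeroSum-block : IntersectionClosed → ∀ (F′ : Factorization G S) j {x} →
          x ∈ Factorization.block F′ j → Factorization.block F′ j ≡ block (blockOf x)
        zeroSum-block inter F′ j {x} x∈j = ⊆-antisym J⊆B B⊆J
          where
          J = Factorization.block F′ j
          minJ = Factorization.minimal F′ j
          B = block (blockOf x)
          B⊆J : B ⊆ J
          B⊆J y∈B = zeroSum⇒blockClosed inter (proj₁ minJ) (∈-blockOf x) y∈B x∈j
          J⊆B : J ⊆ B
          J⊆B {y} y∈J with y ∈? B
          ... | yes y∈B = y∈B
          ... | no  y∉B = contradiction (proj₁ (minimal (blockOf x)))
            (proj₂ minJ B (x , ∈-blockOf x) (B⊆J , y , y∈J , y∉B))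

    module _ (_≈?_ : Decidable _≈_) where

      -- A zero-sum `I` that is not minimal has a proper nonempty zero-sum part, whose complement in
      -- `I` is zero-sum too; both are smaller than `I`.
      factorize : (S : IMultiset G ℓ) → ∀ I → ZeroSum G S I → PartialFactorization S I
      factorize S I = go I (<-wellFounded ∣ I ∣)
        where
        go : ∀ I → Acc ℕ._<_ ∣ I ∣ → ZeroSum G S I → PartialFactorization S I
        go I (acc rec) zI with nonempty? I
        ... | no empty = trivial S empty
        ... | yes ne with anySubset? (λ J → nonempty? J ×-dec (J ⊂? I ×-dec (σ G S J ≈? 0#)))
        ...   | no noJ = single S ne (zI , λ J neJ J⊂I zJ → noJ (J , neJ , J⊂I , zJ))
        ...   | yes (J , (x , x∈J) , J⊂I , zJ) = merge S (proj₁ J⊂I)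
          (go J (rec (p⊂q⇒∣p∣<∣q∣ J⊂I)) zJ)
          (go (I ∩ ∁ J) (rec (∣∩∁∣<∣∣ I J (proj₁ J⊂I x∈J) x∈J)) (zeroSum-⊆ S (proj₁ J⊂I) zI zJ))

      -- Factorizations of `I` and of its complement together form a factorization of `S`, hence the
      -- only one. So each block lies in `I` or misses it: the zero-sum submultisets are the unions
      -- of blocks, and these are closed under intersection.
      UFIM⇒intersectionClosed : {S : IMultiset G ℓ} → UFIM G S → IntersectionClosed S
      UFIM⇒intersectionClosed {S = S} U I J zI zJ =
        blockClosed⇒zeroSum S factorization (I ∩ J) λ x∈i y∈i x∈IJ →
          let x∈I , x∈J = x∈p∩q⁻ I J x∈IJ in
          x∈p∩q⁺ (closed I zI x∈i y∈i x∈I , closed J zJ x∈i y∈i x∈J)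
        where
        open UFIM U
        open Factorization factorization using (block)
        closed : ∀ I → ZeroSum G S I → BlockClosed S factorization I
        closed I zI {i} {x} {y} x∈i y∈i x∈I =
          step (proj₁ inF′) (≡.subst (x ∈_) (≡.sym (proj₂ inF′)) x∈i) (≡.subst (y ∈_) (≡.sym (proj₂ inF′)) y∈i)
          where
          P = factorize S I zI
          Q = factorize S (⊤ ∩ ∁ I) (zeroSum-⊆ S ⊆⊤ zeroSum zI)
          module P = PartialFactorization P
          module Q = PartialFactorization Q
          F′ = toFactorization S (merge S ⊆⊤ P Q)
          inF′ : ∃ λ j → Factorization.block F′ j ≡ block i
          inF′ = Equivalence.from (unique F′ (block i)) (i , refl)
          step : ∀ j → x ∈ Factorization.block F′ j → y ∈ Factorization.block F′ j → y ∈ I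
          step j x∈j y∈j with splitAt P.size j
          ... | inj₁ k = P.block⊆ k y∈j
          ... | inj₂ k = contradiction x∈I (proj₂ (x∈p∩∁q⁻ ⊤ I (Q.block⊆ k x∈j)))

      intersectionClosed⇒UFIM : {S : IMultiset G ℓ} →
        OverNonzero G S → ZeroSum G S ⊤ → IntersectionClosed S → UFIM G S
      intersectionClosed⇒UFIM {S = S} nz z inter = record
        { overNonzero = nz ; zeroSum = z ; factorization = F
        ; unique = λ F′ I → mk⇔ (incl F′ F) (incl F F′) }
        where
        F = toFactorization S (factorize S ⊤ z)
        incl : ∀ F F′ {I} → Factorization.IsBlock F I → Factorization.IsBlock F′ I
        incl F F′ {I} (i , refl) = let x , x∈ = Factorization.nonempty F i in
          _ , ≡.sym (zeroSum-block S F′ inter F i x∈)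

      IsCode : ∀ {N} → (Carrier → Fin N) → Set
      IsCode code = ∀ x y → code x ≡ code y → x ≈ y

      -- The sums of the 2 ^ size submultisets of a system of representatives
      -- of the blocks are distinct: if A and B had the same sum then A ∖ B
      -- and the complement of B ∖ A in its blocks would together be zero-sum.
      2^size≤ : {S : IMultiset G ℓ} (U : UFIM G S) →
        ∀ {N} (code : Carrier → Fin N) → IsCode code →
        2 ℕ.^ Factorization.size (UFIM.factorization U) ℕ.≤ N
      2^size≤ {ℓ = ℓ} {S} U {N} code isCode = Finₚ.injective⇒≤ {f = code ∘ sub} inj
        where
        open UFIM U
        open Factorization factorization
        inter = UFIM⇒intersectionClosed U
        blk = blockOf S factorization
        rep : Fin size → Fin ℓ
        rep i = proj₁ (nonempty i)
        isRep : Fin ℓ → Bool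
        isRep x = does (x Finₚ.≟ rep (blk x))
        isRep-rep : ∀ i → isRep (rep i) ≡ true
        isRep-rep i = dec-true (rep i Finₚ.≟ rep (blk (rep i)))
          (cong rep (≡.sym (∈⇒blockOf S factorization (proj₂ (nonempty i)))))
        -- Binary digits encode the sets of blocks; the digit `zero` stands for membership.
        bit : Fin (2 ℕ.^ size) → Fin size → Bool
        bit k i = does (finToFun k i Finₚ.≟ zero)
        reps : (Fin size → Bool) → Fin ℓ → Bool
        reps A x = A (blk x) ∧ isRep x
        sub : Fin (2 ℕ.^ size) → Carrier
        sub k = sum (term S (reps (bit k)))
        -- A block with a single element would consist of 0. The second element is the one that
        -- exposes a block of which only the representative was taken.
        second : ∀ i → ∃ λ y → y ∈ block i × y ≢ rep i
        second i with Finₚ.any? (λ y → (y ∈? block i) ×-dec ¬? (y Finₚ.≟ rep i))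
        ... | yes found = found
        ... | no  none  = contradiction (begin
          S (rep i)            ≈⟨ σ-singleton S (rep i) ⟨
          σ G S ⁅ rep i ⁆      ≡⟨ cong (σ G S) B≡ ⟨
          σ G S (block i)      ≈⟨ proj₁ (minimal i) ⟩
          0#                   ∎) (overNonzero (rep i))
          where
          B⊆ : block i ⊆ ⁅ rep i ⁆
          B⊆ {y} y∈ with y Finₚ.≟ rep i
          ... | yes refl = x∈⁅x⁆ y
          ... | no  y≢   = contradiction (y , y∈ , y≢) none
          B≡ : block i ≡ ⁅ rep i ⁆
          B≡ = ⊆-antisym B⊆ λ y∈ →
            ≡.subst (_∈ block i) (≡.sym (x∈⁅y⁆⇒x≡y (rep i) y∈)) (proj₂ (nonempty i))
        pick : Bool → Bool → Bool → Bool
        pick a b e = if a then (if b then false else e) else (if b then not e else false)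
        module _ (A B : Fin size → Bool) (eq : sum (term S (reps A)) ≈ sum (term S (reps B))) where
          union mixed : Fin ℓ → Bool
          union x = not (A (blk x)) ∧ B (blk x)
          mixed x = pick (A (blk x)) (B (blk x)) (isRep x)
          -- In a block of B ∖ A the other elements, taken by `mixed`, and the representative, taken
          -- by `reps B`, complete the whole block, which is counted by `union`.
          pointwise : ∀ x →
            term S mixed x + term S (reps B) x ≈ term S (reps A) x + term S union x
          pointwise x with A (blk x) | B (blk x) | isRep x
          ... | true  | true  | true  = comm _ _
          ... | true  | true  | false = ≈-refl
          ... | true  | false | _     = ≈-refl
          ... | false | true  | true  = ≈-refl
          ... | false | true  | false = comm _ _
          ... | false | false | _     = ≈-refl
          zeroSum-union : sum (term S union) ≈ 0#
          zeroSum-union = ≈-trans (≈-sym (σ-tabulate S union))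
            (blockClosed⇒zeroSum S factorization (tabulate union) λ {i} {x} {y} x∈i y∈i x∈ →
              ∈-tabulate⁺ union (≡.trans
                (cong (λ j → not (A j) ∧ B j) (≡.trans (∈⇒blockOf S factorization y∈i) (≡.sym (∈⇒blockOf S factorization x∈i))))
                (∈-tabulate⁻ union x∈)))
          zeroSum-mixed : ZeroSum G S (tabulate mixed)
          zeroSum-mixed = ≈-trans (σ-tabulate S mixed) (∙-cancelʳ (sum (term S (reps B))) _ _ (begin
            sum (term S mixed) + sum (term S (reps B))            ≈⟨ ∑-distrib-+ (term S mixed) (term S (reps B)) ⟨
            sum (λ x → term S mixed x + term S (reps B) x)        ≈⟨ sum-cong-≋ pointwise ⟩
            sum (λ x → term S (reps A) x + term S union x)        ≈⟨ ∑-distrib-+ (term S (reps A)) (term S union) ⟩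
            sum (term S (reps A)) + sum (term S union)            ≈⟨ ∙-cong eq zeroSum-union ⟩
            sum (term S (reps B)) + 0#                            ≈⟨ comm _ _ ⟩
            0# + sum (term S (reps B))                            ∎))
          -- On a block of A ∖ B, `mixed` contains the representative and not the second element,
          -- although a zero-sum set is a union of blocks. The opposite inclusion follows by
          -- exchanging A and B.
          separated : ∀ i → A i ≡ true → B i ≡ true
          separated i Ai with B i in Bi
          ... | true  = refl
          ... | false = let y , y∈ , y≢ = second i in
            contradiction (≡.trans (≡.sym (mixed-in y∈)) (∈-tabulate⁻ mixed
              (zeroSum⇒blockClosed S factorization inter zeroSum-mixed (proj₂ (nonempty i)) y∈
                (∈-tabulate⁺ mixed (≡.trans (mixed-in (proj₂ (nonempty i))) (isRep-rep i))))))
              (≡.subst (_≢ true) (≡.sym (isRep-other y∈ y≢)) λ ())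
            where
            mixed-in : ∀ {x} → x ∈ block i → mixed x ≡ isRep x
            mixed-in x∈ rewrite ∈⇒blockOf S factorization x∈ | Ai | Bi = refl
            isRep-other : ∀ {y} → y ∈ block i → y ≢ rep i → isRep y ≡ false
            isRep-other {y} y∈ y≢ = dec-false (y Finₚ.≟ rep (blk y))
              (≡.subst (λ j → y ≢ rep j) (≡.sym (∈⇒blockOf S factorization y∈)) y≢)
        bit-injective : ∀ {k l} → (∀ i → bit k i ≡ true → bit l i ≡ true) →
          (∀ i → bit l i ≡ true → bit k i ≡ true) → k ≡ l
        bit-injective {k} {l} to from = ≡.trans (≡.sym (Finₚ.funToFin-finToFin {size} {2} k))
          (≡.trans (funToFin-cong λ i → digit (finToFun k i) (finToFun l i) (to i) (from i))
            (Finₚ.funToFin-finToFin {size} {2} l))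
          where
          digit : ∀ (a b : Fin 2) → (does (a Finₚ.≟ zero) ≡ true → does (b Finₚ.≟ zero) ≡ true) →
            (does (b Finₚ.≟ zero) ≡ true → does (a Finₚ.≟ zero) ≡ true) → a ≡ b
          digit zero       zero       _ _ = refl
          digit (suc zero) (suc zero) _ _ = refl
          digit zero       (suc zero) f _ = contradiction (f refl) λ ()
          digit (suc zero) zero       _ g = contradiction (g refl) λ ()
          funToFin-cong : ∀ {m n} {f g : Fin m → Fin n} → (∀ i → f i ≡ g i) → funToFin f ≡ funToFin g
          funToFin-cong {zero}  eq = refl
          funToFin-cong {suc m} eq = ≡.cong₂ combine (eq zero) (funToFin-cong (eq ∘ suc))
        inj : ∀ {k l} → code (sub k) ≡ code (sub l) → k ≡ l
        inj {k} {l} eq = let sub≈ = isCode (sub k) (sub l) eq in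
          bit-injective (separated (bit k) (bit l) sub≈) (separated (bit l) (bit k) (≈-sym sub≈))

open ZeroSums

-- Splitting an indexed multiset into two parts

module Splittings where
  open import Algebra.Bundles using (CommutativeMonoid)
  import Algebra.Properties.CommutativeMonoid.Sum as Sum
  open import Data.Bool.Base using (true; false; _∧_; if_then_else_)
  open import Data.Fin.Base using (splitAt)
  open import Data.Fin.Subset using (Subset; _∈_; _∉_; ⊤; ⊥; _∩_; ⁅_⁆)
  open import Data.Fin.Subset.Properties
  import Data.Sum.Base as Sum⊎
  open import Data.Vec.Base using (lookup; tabulate; []; _∷_; here; there)
  open import Data.Vec.Properties using (lookup∘tabulate; lookup-zipWith; lookup-replicate)
  open import Function.Bundles using (_↔_; Inverse; mk↔ₛ′)
  import Function.Construct.Composition as Composition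
  open import Relation.Binary.Definitions using (Decidable)

  private
    variable
      ℓ a b : ℕ

  -- `UFIM` and `CrossNumber` speak of whole indexed multisets, so `B` and its complement are given
  -- index sets of their own.
  separate : (B : Subset ℓ) → ∃ λ a → ∃ λ b → Σ ((Fin a ⊎ Fin b) ↔ Fin ℓ) λ ι →
    (∀ i → Inverse.to ι (inj₁ i) ∈ B) × (∀ j → Inverse.to ι (inj₂ j) ∉ B)
  separate [] = 0 , 0 , mk↔ₛ′ (λ { (inj₁ ()) ; (inj₂ ()) }) (λ ()) (λ ()) (λ { (inj₁ ()) ; (inj₂ ()) }) , (λ ()) , λ ()
  separate (true ∷ B) =
    let a , b , ι , in₁ , in₂ = separate B
        open Inverse ι
        to′ = λ { (inj₁ zero) → zero ; (inj₁ (suc i)) → suc (to (inj₁ i)) ; (inj₂ j) → suc (to (inj₂ j)) }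
        from′ = λ { zero → inj₁ zero ; (suc x) → Sum⊎.map₁ suc (from x) }
        to-map : ∀ s → to′ (Sum⊎.map₁ suc s) ≡ suc (to s)
        to-map = λ { (inj₁ _) → refl ; (inj₂ _) → refl }
    in suc a , b , mk↔ₛ′ to′ from′
         (λ { zero → refl ; (suc x) → ≡.trans (to-map (from x)) (cong suc (strictlyInverseˡ x)) })
         (λ { (inj₁ zero) → refl
            ; (inj₁ (suc i)) → cong (Sum⊎.map₁ suc) (strictlyInverseʳ (inj₁ i))
            ; (inj₂ j) → cong (Sum⊎.map₁ suc) (strictlyInverseʳ (inj₂ j)) })
       , (λ { zero → here ; (suc i) → there (in₁ i) })
       , λ { j (there j∈) → in₂ j j∈ }
  separate (false ∷ B) =
    let a , b , ι , in₁ , in₂ = separate B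
        open Inverse ι
        to′ = λ { (inj₁ i) → suc (to (inj₁ i)) ; (inj₂ zero) → zero ; (inj₂ (suc j)) → suc (to (inj₂ j)) }
        from′ = λ { zero → inj₂ zero ; (suc x) → Sum⊎.map₂ suc (from x) }
        to-map : ∀ s → to′ (Sum⊎.map₂ suc s) ≡ suc (to s)
        to-map = λ { (inj₁ _) → refl ; (inj₂ _) → refl }
    in a , suc b , mk↔ₛ′ to′ from′
         (λ { zero → refl ; (suc x) → ≡.trans (to-map (from x)) (cong suc (strictlyInverseˡ x)) })
         (λ { (inj₁ i) → cong (Sum⊎.map₂ suc) (strictlyInverseʳ (inj₁ i))
            ; (inj₂ zero) → refl
            ; (inj₂ (suc j)) → cong (Sum⊎.map₂ suc) (strictlyInverseʳ (inj₂ j)) })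
       , (λ i → there (in₁ i))
       , λ { (suc j) (there j∈) → in₂ j j∈ }

  module _ {c e} (M : CommutativeMonoid c e) where
    open CommutativeMonoid M renaming (_∙_ to _+_; refl to ≈-refl; sym to ≈-sym; trans to ≈-trans)
    open Sum M using (sum; sum-cong-≗; sum-permute)

    sum-++ : ∀ a {b} (f : Fin a ⊎ Fin b → Carrier) →
      sum (f ∘ splitAt a) ≈ sum (f ∘ inj₁) + sum (f ∘ inj₂)
    sum-++ zero    f = ≈-sym (identityˡ _)
    sum-++ (suc a) f = ≈-trans
      (∙-congˡ (≈-trans (reflexive (sum-cong-≗ {_} λ i → f-map (splitAt a i))) (sum-++ a (f ∘ Sum⊎.map₁ suc))))
      (≈-sym (assoc _ _ _))
      where
      f-map : ∀ s → f (Sum⊎.map suc id s) ≡ f (Sum⊎.map₁ suc s)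
      f-map _ = refl

    -- Stated for commutative monoids because it splits both sums in the group and cross numbers in
    -- ℚ.
    sum-reindex : (ι : (Fin a ⊎ Fin b) ↔ Fin ℓ) (f : Vector Carrier ℓ) →
      sum f ≈ sum (f ∘ Inverse.to ι ∘ inj₁) + sum (f ∘ Inverse.to ι ∘ inj₂)
    sum-reindex {a = a} ι f = ≈-trans
      (sum-permute f (Composition.inverse (Finₚ.+↔⊎ {a}) ι)) (sum-++ a (f ∘ Inverse.to ι))

  module Reindex (ι : (Fin a ⊎ Fin b) ↔ Fin ℓ) where
    open Inverse ι public using (to; from)

    restrict₁ : Subset ℓ → Subset a
    restrict₁ I = tabulate (lookup I ∘ to ∘ inj₁)

    restrict₂ : Subset ℓ → Subset b
    restrict₂ I = tabulate (lookup I ∘ to ∘ inj₂)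

    glue : Subset a → Subset b → Subset ℓ
    glue I J = tabulate ([ lookup I , lookup J ]′ ∘ from)

    lookup-glue : ∀ I J s → lookup (glue I J) (to s) ≡ [ lookup I , lookup J ]′ s
    lookup-glue I J s = ≡.trans (lookup∘tabulate _ (to s))
      (cong [ lookup I , lookup J ]′ (Inverse.strictlyInverseʳ ι s))

    restrict₁-glue : ∀ I J → restrict₁ (glue I J) ≡ I
    restrict₁-glue I J = lookup-ext λ i →
      ≡.trans (lookup∘tabulate _ i) (lookup-glue I J (inj₁ i))

    restrict₂-glue : ∀ I J → restrict₂ (glue I J) ≡ J
    restrict₂-glue I J = lookup-ext λ j →
      ≡.trans (lookup∘tabulate _ j) (lookup-glue I J (inj₂ j))

    restrict₁-∩ : ∀ I J → restrict₁ (I ∩ J) ≡ restrict₁ I ∩ restrict₁ J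
    restrict₁-∩ I J = lookup-ext λ i → begin
      lookup (restrict₁ (I ∩ J)) i                         ≡⟨ lookup∘tabulate _ i ⟩
      lookup (I ∩ J) (to (inj₁ i))                         ≡⟨ lookup-zipWith _∧_ (to (inj₁ i)) I J ⟩
      lookup I (to (inj₁ i)) ∧ lookup J (to (inj₁ i))
        ≡⟨ cong₂ _∧_ (lookup∘tabulate (lookup I ∘ to ∘ inj₁) i) (lookup∘tabulate (lookup J ∘ to ∘ inj₁) i) ⟨
      lookup (restrict₁ I) i ∧ lookup (restrict₁ J) i      ≡⟨ lookup-zipWith _∧_ i (restrict₁ I) (restrict₁ J) ⟨
      lookup (restrict₁ I ∩ restrict₁ J) i                 ∎
      where open ≡.≡-Reasoning

    restrict₂-∩ : ∀ I J → restrict₂ (I ∩ J) ≡ restrict₂ I ∩ restrict₂ J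
    restrict₂-∩ I J = lookup-ext λ i → begin
      lookup (restrict₂ (I ∩ J)) i                         ≡⟨ lookup∘tabulate _ i ⟩
      lookup (I ∩ J) (to (inj₂ i))                         ≡⟨ lookup-zipWith _∧_ (to (inj₂ i)) I J ⟩
      lookup I (to (inj₂ i)) ∧ lookup J (to (inj₂ i))
        ≡⟨ cong₂ _∧_ (lookup∘tabulate (lookup I ∘ to ∘ inj₂) i) (lookup∘tabulate (lookup J ∘ to ∘ inj₂) i) ⟨
      lookup (restrict₂ I) i ∧ lookup (restrict₂ J) i      ≡⟨ lookup-zipWith _∧_ i (restrict₂ I) (restrict₂ J) ⟨
      lookup (restrict₂ I ∩ restrict₂ J) i                 ∎
      where open ≡.≡-Reasoning

    glue-∩ : ∀ I I′ J J′ → glue I J ∩ glue I′ J′ ≡ glue (I ∩ I′) (J ∩ J′)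
    glue-∩ I I′ J J′ = lookup-ext λ x → begin
      lookup (glue I J ∩ glue I′ J′) x                   ≡⟨ lookup-zipWith _∧_ x (glue I J) (glue I′ J′) ⟩
      lookup (glue I J) x ∧ lookup (glue I′ J′) x        ≡⟨ cong₂ _∧_ (lookup∘tabulate _ x) (lookup∘tabulate _ x) ⟩
      [ lookup I , lookup J ]′ (from x) ∧ [ lookup I′ , lookup J′ ]′ (from x) ≡⟨ meet (from x) ⟩
      [ lookup (I ∩ I′) , lookup (J ∩ J′) ]′ (from x)    ≡⟨ lookup∘tabulate _ x ⟨
      lookup (glue (I ∩ I′) (J ∩ J′)) x                  ∎
      where
      open ≡.≡-Reasoning
      meet : ∀ s → [ lookup I , lookup J ]′ s ∧ [ lookup I′ , lookup J′ ]′ s ≡ [ lookup (I ∩ I′) , lookup (J ∩ J′) ]′ s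
      meet (inj₁ i) = ≡.sym (lookup-zipWith _∧_ i I I′)
      meet (inj₂ j) = ≡.sym (lookup-zipWith _∧_ j J J′)

    module _ (G : AbGroup) (S : IMultiset G ℓ) where
      open AbelianGroup G renaming (ε to 0#; _∙_ to _+_; refl to ≈-refl; sym to ≈-sym; trans to ≈-trans)
      open Combinatorics G

      S₁ : IMultiset G a
      S₁ = S ∘ to ∘ inj₁

      S₂ : IMultiset G b
      S₂ = S ∘ to ∘ inj₂

      σ-restrict : ∀ I → σ G S I ≈ σ G S₁ (restrict₁ I) + σ G S₂ (restrict₂ I)
      σ-restrict I = ≈-trans (sum-reindex commutativeMonoid ι (term S (lookup I)))
        (≈-sym (∙-cong (σ-tabulate S₁ (lookup I ∘ to ∘ inj₁)) (σ-tabulate S₂ (lookup I ∘ to ∘ inj₂))))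

      σ-glue : ∀ I J → σ G S (glue I J) ≈ σ G S₁ I + σ G S₂ J
      σ-glue I J = ≈-trans (σ-restrict (glue I J)) (reflexive
        (cong₂ (λ I J → σ G S₁ I + σ G S₂ J) (restrict₁-glue I J) (restrict₂-glue I J)))

      σ-glue⊥ : ∀ I → σ G S (glue I ⊥) ≈ σ G S₁ I
      σ-glue⊥ I = ≈-trans (σ-glue I ⊥)
        (≈-trans (∙-congˡ (σ-Empty S₂ ⊥ λ (_ , x∈) → ∉⊥ x∈)) (identityʳ _))

      σ-⊥glue : ∀ J → σ G S (glue ⊥ J) ≈ σ G S₂ J
      σ-⊥glue J = ≈-trans (σ-glue ⊥ J)
        (≈-trans (∙-congʳ (σ-Empty S₁ ⊥ λ (_ , x∈) → ∉⊥ x∈)) (identityˡ _))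

      zeroSum-glue⊥⁺ : ∀ I → ZeroSum G S₁ I → ZeroSum G S (glue I ⊥)
      zeroSum-glue⊥⁺ I = ≈-trans (σ-glue⊥ I)

      zeroSum-glue⊥⁻ : ∀ I → ZeroSum G S (glue I ⊥) → ZeroSum G S₁ I
      zeroSum-glue⊥⁻ I = ≈-trans (≈-sym (σ-glue⊥ I))

      zeroSum-⊥glue⁺ : ∀ J → ZeroSum G S₂ J → ZeroSum G S (glue ⊥ J)
      zeroSum-⊥glue⁺ J = ≈-trans (σ-⊥glue J)

  module _ (G : AbGroup) where
    open AbelianGroup G renaming (ε to 0#; _∙_ to _+_; refl to ≈-refl; sym to ≈-sym; trans to ≈-trans)
    open Sum commutativeMonoid using (sum-cong-≋; sum-replicate-zero)

    σ-cong : {S T : IMultiset G ℓ} → (∀ i → S i ≈ T i) → ∀ I → σ G S I ≈ σ G T I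
    σ-cong {S = S} {T} eq I = sum-cong-≋ λ i → branch (lookup I i) (eq i)
      where
      branch : ∀ b {x y} → x ≈ y → (if b then x else 0#) ≈ (if b then y else 0#)
      branch true  x≈y = x≈y
      branch false _   = ≈-refl

    σ-zero : {S : IMultiset G ℓ} → (∀ i → S i ≈ 0#) → ∀ I → σ G S I ≈ 0#
    σ-zero {ℓ} {S} eq I = ≈-trans (sum-cong-≋ λ i → branch (lookup I i) (eq i)) (sum-replicate-zero ℓ)
      where
      branch : ∀ b {x} → x ≈ 0# → (if b then x else 0#) ≈ 0#
      branch true  x≈ = x≈
      branch false _  = ≈-refl

  -- UFIMs in a direct sum

  module DirectSum (H G : AbGroup) where
    private
      module H = AbelianGroup H
      module G = AbelianGroup G
      module HG = AbelianGroup (H ⊕ G)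

    σ-⊕ : (S : IMultiset (H ⊕ G) ℓ) → ∀ I →
      σ (H ⊕ G) S I ≡ (σ H (proj₁ ∘ S) I , σ G (proj₂ ∘ S) I)
    σ-⊕ S []          = refl
    σ-⊕ S (true ∷ I)  = cong (S zero HG.∙_) (σ-⊕ (S ∘ suc) I)
    σ-⊕ S (false ∷ I) = cong (HG.ε HG.∙_) (σ-⊕ (S ∘ suc) I)

    zeroSum-⊕⁺ : (S : IMultiset (H ⊕ G) ℓ) → ∀ I →
      ZeroSum H (proj₁ ∘ S) I → ZeroSum G (proj₂ ∘ S) I → ZeroSum (H ⊕ G) S I
    zeroSum-⊕⁺ S I z₁ z₂ = ≡.subst (HG._≈ HG.ε) (≡.sym (σ-⊕ S I)) (z₁ , z₂)

    zeroSum-⊕⁻ : (S : IMultiset (H ⊕ G) ℓ) → ∀ I →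
      ZeroSum (H ⊕ G) S I → ZeroSum H (proj₁ ∘ S) I × ZeroSum G (proj₂ ∘ S) I
    zeroSum-⊕⁻ S I z = ≡.subst (HG._≈ HG.ε) (σ-⊕ S I) z

    module _ (_≈H?_ : Decidable H._≈_) (_≈G?_ : Decidable G._≈_) where

      _≈HG?_ : Decidable HG._≈_
      (x , y) ≈HG? (x′ , y′) = (x ≈H? x′) ×-dec (y ≈G? y′)
        where open import Relation.Nullary.Decidable using (_×-dec_)

      module CH = Combinatorics H
      module CG = Combinatorics G
      module CHG = Combinatorics (H ⊕ G)

      module _ {T₁ : IMultiset H a} {T₂ : IMultiset G b} (U₁ : UFIM H T₁) (U₂ : UFIM G T₂)
        (S : IMultiset (H ⊕ G) ℓ) (ι : (Fin a ⊎ Fin b) ↔ Fin ℓ)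
        (eq₁ : ∀ i → S (Inverse.to ι (inj₁ i)) HG.≈ (T₁ i , G.ε))
        (eq₂ : ∀ j → S (Inverse.to ι (inj₂ j)) HG.≈ (H.ε , T₂ j)) where
        open Reindex ι

        private
          σ₁ : ∀ I → σ H (proj₁ ∘ S) I H.≈ σ H T₁ (restrict₁ I)
          σ₁ I = H.trans (σ-restrict H (proj₁ ∘ S) I) (H.trans
            (H.∙-cong (σ-cong H (proj₁ ∘ eq₁) (restrict₁ I)) (σ-zero H (proj₁ ∘ eq₂) (restrict₂ I)))
            (H.identityʳ _))

          σ₂ : ∀ I → σ G (proj₂ ∘ S) I G.≈ σ G T₂ (restrict₂ I)
          σ₂ I = G.trans (σ-restrict G (proj₂ ∘ S) I) (G.trans
            (G.∙-cong (σ-zero G (proj₂ ∘ eq₁) (restrict₁ I)) (σ-cong G (proj₂ ∘ eq₂) (restrict₂ I)))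
            (G.identityˡ _))

          assemble : ∀ I → ZeroSum H T₁ (restrict₁ I) → ZeroSum G T₂ (restrict₂ I) → ZeroSum (H ⊕ G) S I
          assemble I z₁ z₂ = zeroSum-⊕⁺ S I (H.trans (σ₁ I) z₁) (G.trans (σ₂ I) z₂)

          restrict₁-⊤ : restrict₁ ⊤ ≡ ⊤
          restrict₁-⊤ = lookup-ext λ i → ≡.trans (lookup∘tabulate _ i)
            (≡.trans (lookup-replicate (to (inj₁ i)) true) (≡.sym (lookup-replicate i true)))

          restrict₂-⊤ : restrict₂ ⊤ ≡ ⊤
          restrict₂-⊤ = lookup-ext λ i → ≡.trans (lookup∘tabulate _ i)
            (≡.trans (lookup-replicate (to (inj₂ i)) true) (≡.sym (lookup-replicate i true)))

          nonzero : OverNonzero (H ⊕ G) S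
          nonzero x Sx≈0 = nz (from x) (HG.trans (HG.reflexive (cong S (Inverse.strictlyInverseˡ ι x))) Sx≈0)
            where
            nz : ∀ s → ¬ (S (to s) HG.≈ HG.ε)
            nz (inj₁ i) z = UFIM.overNonzero U₁ i (H.trans (H.sym (proj₁ (eq₁ i))) (proj₁ z))
            nz (inj₂ j) z = UFIM.overNonzero U₂ j (G.trans (G.sym (proj₂ (eq₂ j))) (proj₂ z))

        -- A submultiset is zero-sum exactly when its traces on the two parts are, so closure under
        -- intersection passes from the parts to the whole.
        UFIM-⊕ : UFIM (H ⊕ G) S
        UFIM-⊕ = CHG.intersectionClosed⇒UFIM _≈HG?_ nonzero
          (assemble ⊤ (≡.subst (ZeroSum H T₁) (≡.sym restrict₁-⊤) (UFIM.zeroSum U₁))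
                      (≡.subst (ZeroSum G T₂) (≡.sym restrict₂-⊤) (UFIM.zeroSum U₂)))
          λ I J zI zJ →
            let z₁I , z₂I = zeroSum-⊕⁻ S I zI ; z₁J , z₂J = zeroSum-⊕⁻ S J zJ in
            assemble (I ∩ J)
              (≡.subst (ZeroSum H T₁) (≡.sym (restrict₁-∩ I J)) (CH.UFIM⇒intersectionClosed _≈H?_ U₁ (restrict₁ I) (restrict₁ J)
                (H.trans (H.sym (σ₁ I)) z₁I) (H.trans (H.sym (σ₁ J)) z₁J)))
              (≡.subst (ZeroSum G T₂) (≡.sym (restrict₂-∩ I J)) (CG.UFIM⇒intersectionClosed _≈G?_ U₂ (restrict₂ I) (restrict₂ J)
                (G.trans (G.sym (σ₂ I)) z₂I) (G.trans (G.sym (σ₂ J)) z₂J)))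

      module _ {S : IMultiset (H ⊕ G) ℓ} (U : UFIM (H ⊕ G) S) (ι : (Fin a ⊎ Fin b) ↔ Fin ℓ)
        (S₁⊆H : ∀ i → proj₂ (S (Inverse.to ι (inj₁ i))) G.≈ G.ε) where
        open Reindex ι

        private
          T₁ = proj₁ ∘ S ∘ to ∘ inj₁
          T₂ = proj₂ ∘ S ∘ to ∘ inj₂
          rest = proj₁ ∘ S ∘ to ∘ inj₂

          inter : CHG.IntersectionClosed S
          inter = CHG.UFIM⇒intersectionClosed _≈HG?_ U

          glue-zeroSum : ∀ I J → σ H T₁ I H.∙ σ H rest J H.≈ H.ε → ZeroSum G T₂ J → ZeroSum (H ⊕ G) S (glue I J)
          glue-zeroSum I J z₁ z₂ = zeroSum-⊕⁺ S (glue I J) (H.trans (σ-glue H (proj₁ ∘ S) I J) z₁)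
            (G.trans (σ-glue G (proj₂ ∘ S) I J) (G.trans (G.∙-cong (σ-zero G S₁⊆H I) z₂) (G.identityˡ _)))

          glue-zeroSum⁻ : ∀ I J → ZeroSum (H ⊕ G) S (glue I J) → σ H T₁ I H.∙ σ H rest J H.≈ H.ε × ZeroSum G T₂ J
          glue-zeroSum⁻ I J z = let z₁ , z₂ = zeroSum-⊕⁻ S (glue I J) z in
            H.trans (H.sym (σ-glue H (proj₁ ∘ S) I J)) z₁ ,
            G.trans (G.sym (G.trans (G.∙-congʳ (σ-zero G S₁⊆H I)) (G.identityˡ _)))
              (G.trans (G.sym (σ-glue G (proj₂ ∘ S) I J)) z₂)

          σ-⊥ : ∀ (K : AbGroup) {ℓ} (T : IMultiset K ℓ) → ZeroSum K T ⊥
          σ-⊥ K T = Combinatorics.σ-Empty K T ⊥ λ (x , x∈) → ∉⊥ x∈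

          lift₁ : ∀ I → ZeroSum H T₁ I → ZeroSum (H ⊕ G) S (glue I ⊥)
          lift₁ I z = glue-zeroSum I ⊥ (H.trans (H.∙-cong z (σ-⊥ H rest)) (H.identityˡ _)) (σ-⊥ G T₂)

          lower₁ : ∀ I → ZeroSum (H ⊕ G) S (glue I ⊥) → ZeroSum H T₁ I
          lower₁ I z = H.trans (H.sym (H.trans (H.∙-congˡ (σ-⊥ H rest)) (H.identityʳ _)))
            (proj₁ (glue-zeroSum⁻ I ⊥ z))

        module _ (zS₁ : ZeroSum H T₁ ⊤) where

          -- The G-components vanish on this part, so its zero-sum submultisets are those of `S`
          -- that it contains, and these are closed under intersection.
          UFIM-summand₁ : UFIM H T₁
          UFIM-summand₁ = CH.intersectionClosed⇒UFIM _≈H?_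
            (λ i z → UFIM.overNonzero U (to (inj₁ i)) (z , S₁⊆H i)) zS₁
            λ I J zI zJ → lower₁ (I ∩ J) (≡.subst (ZeroSum (H ⊕ G) S)
              (≡.trans (glue-∩ I J ⊥ ⊥) (cong (glue (I ∩ J)) (∩-idem ⊥))) (inter (glue I ⊥) (glue J ⊥) (lift₁ I zI) (lift₁ J zJ)))

          module _ (reach : ∀ x → ∃ λ I → σ H T₁ I H.≈ x) where

            private
              lift₂ : ∀ J → ZeroSum G T₂ J → ZeroSum (H ⊕ G) S (glue ⊥ J)
              lift₂ J z = glue-zeroSum ⊥ J (H.trans (H.∙-cong (σ-⊥ H T₁) rest≈0) (H.identityˡ _)) z
                where
                x = σ H rest J
                I = proj₁ (reach (x H.⁻¹))
                σI = proj₂ (reach (x H.⁻¹))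
                zI : ZeroSum H T₁ I
                zI = lower₁ I (≡.subst (ZeroSum (H ⊕ G) S)
                  (≡.trans (glue-∩ I ⊤ J ⊥) (cong₂ glue (∩-identityʳ I) (∩-zeroʳ J)))
                  (inter (glue I J) (glue ⊤ ⊥) (glue-zeroSum I J (H.trans (H.∙-congʳ σI) (H.inverseˡ x)) z) (lift₁ ⊤ zS₁)))
                rest≈0 : x H.≈ H.ε
                rest≈0 = begin
                  x                ≈⟨ H.identityˡ x ⟨
                  H.ε H.∙ x        ≈⟨ H.∙-congʳ zI ⟨
                  σ H T₁ I H.∙ x   ≈⟨ H.∙-congʳ σI ⟩
                  x H.⁻¹ H.∙ x     ≈⟨ H.inverseˡ x ⟩
                  H.ε              ∎
                  where open import Relation.Binary.Reasoning.Setoid H.setoid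

              lower₂ : ∀ J → ZeroSum (H ⊕ G) S (glue ⊥ J) → ZeroSum G T₂ J
              lower₂ J z = proj₂ (glue-zeroSum⁻ ⊥ J z)

            -- A zero-sum submultiset of the image of S₂ in G lifts to one of S:
            -- its H-component is cancelled by some S₁(I), and S₁(I) is then
            -- zero-sum, being an intersection with the zero-sum S₁.
            UFIM-image₂ : UFIM G T₂
            UFIM-image₂ = CG.intersectionClosed⇒UFIM _≈G?_ nonzero zT₂
              λ I J zI zJ → lower₂ (I ∩ J) (≡.subst (ZeroSum (H ⊕ G) S)
                (≡.trans (glue-∩ ⊥ ⊥ I J) (cong (λ K → glue K (I ∩ J)) (∩-idem ⊥))) (inter (glue ⊥ I) (glue ⊥ J) (lift₂ I zI) (lift₂ J zJ)))
              where
              -- An element with vanishing image would be zero-sum by itself in the image; lifted to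
              -- `S`, it would be 0.
              nonzero : OverNonzero G T₂
              nonzero j z = UFIM.overNonzero U (to (inj₂ j)) (H.trans (H.sym (CH.σ-singleton rest j)) restj≈0 , z)
                where
                zj : ZeroSum (H ⊕ G) S (glue ⊥ ⁅ j ⁆)
                zj = lift₂ ⁅ j ⁆ (G.trans (CG.σ-singleton T₂ j) z)
                restj≈0 : σ H rest ⁅ j ⁆ H.≈ H.ε
                restj≈0 = H.trans (H.sym (H.trans (H.∙-congʳ (σ-⊥ H T₁)) (H.identityˡ _))) (proj₁ (glue-zeroSum⁻ ⊥ ⁅ j ⁆ zj))
              zT₂ : ZeroSum G T₂ ⊤
              zT₂ = proj₂ (glue-zeroSum⁻ ⊤ ⊤ (≡.subst (ZeroSum (H ⊕ G) S) (≡.sym glue-⊤) (UFIM.zeroSum U)))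
                where
                glue-⊤ : glue ⊤ ⊤ ≡ ⊤
                glue-⊤ = lookup-ext λ x → ≡.trans (lookup∘tabulate _ x)
                  (≡.trans (all (from x)) (≡.sym (lookup-replicate x true)))
                  where
                  all : ∀ s → [ lookup {n = a} ⊤ , lookup {n = b} ⊤ ]′ s ≡ true
                  all (inj₁ i) = lookup-replicate i true
                  all (inj₂ j) = lookup-replicate j true

open Splittings

-- Orders of elements and sizes of groups

module Orders where
  import Algebra.Construct.Terminal as Terminal
  import Algebra.Definitions.RawMonoid as RawMonoidDefs
  import Algebra.Properties.AbelianGroup as GroupProperties
  open import Data.Bool.Base using (Bool; true; false)
  open import Data.Bool.Properties using (T-≡)
  open import Data.Fin.Base using (toℕ; fromℕ<; combine)
  open import Data.Fin.Subset using (Subset; _∈_; ⊤; ⊥; _∩_; ∁; ⁅_⁆; ∣_∣)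
  open import Data.Fin.Subset.Properties
  open import Data.Integer.Base as ℤ using (ℤ; +_)
  import Data.Integer.DivMod as ℤDivMod
  import Data.Integer.Divisibility.Signed as ℤDiv
  import Data.Integer.Properties as ℤₚ
  open import Data.Integer.Tactic.RingSolver using (solve-∀)
  open import Data.List.Base as List using (List; []; _∷_)
  open import Data.List.Relation.Unary.All using ([]; _∷_)
  open import Data.Nat.Base using (NonZero)
  open import Data.Nat.Divisibility using (_∣_; divides; ∣⇒≤; *-cancelˡ-∣; 1∣_; ∣-trans; m∣m*n; >⇒∤)
  open import Data.Nat.Induction using (<-wellFounded)
  open import Data.Nat.Primality using (Prime; prime⇒nonZero; prime⇒nonTrivial; euclidsLemma)
  open import Data.Vec.Base using (tabulate; []; _∷_)
  open import Function.Bundles using (Equivalence)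
  open import Induction.WellFounded using (Acc; acc)
  open import Relation.Binary.Definitions using (Decidable; tri<; tri≈; tri>)
  open import Relation.Nullary.Decidable using (_×-dec_)

  private
    variable
      ℓ m n o N r : ℕ

  multiple : (G : AbGroup) → ℕ → AbelianGroup.Carrier G → AbelianGroup.Carrier G
  multiple G = RawMonoidDefs._×_ (AbelianGroup.rawMonoid G)

  module _ (G : AbGroup) where
    open AbelianGroup G renaming (ε to 0#; _∙_ to _+_; refl to ≈-refl; sym to ≈-sym; trans to ≈-trans)

    order-≤ : Decidable _≈_ → ∀ {g o} → 0 ℕ.< o → multiple G o g ≈ 0# → ∃ λ o′ → o′ ℕ.≤ o × IsOrder G g o′
    order-≤ _≈?_ {g} {o} = go o (<-wellFounded o)
      where
      go : ∀ o → Acc ℕ._<_ o → 0 ℕ.< o → multiple G o g ≈ 0# → ∃ λ o′ → o′ ℕ.≤ o × IsOrder G g o′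
      go o (acc rec) 0<o og≈0 with ℕₚ.anyUpTo? (λ m → (0 ℕₚ.<? m) ×-dec (multiple G m g ≈? 0#)) o
      ... | yes (m , m<o , 0<m , mg≈0) =
        let o′ , o′≤m , isOrder = go m (rec m<o) 0<m mg≈0 in o′ , ℕₚ.≤-trans o′≤m (ℕₚ.<⇒≤ m<o) , isOrder
      ... | no none = o , ℕₚ.≤-refl , 0<o , og≈0 , λ m 0<m mg≈0 → ℕₚ.≮⇒≥ λ m<o → none (m , m<o , 0<m , mg≈0)

    -- For G the bound is p₁: every nonzero element then has order at least p₁, and multiplication
    -- by r < p₁ is injective at 0.
    TorsionFreeBelow : ℕ → Set
    TorsionFreeBelow q = ∀ {o g} → 0 ℕ.< o → o ℕ.< q → multiple G o g ≈ 0# → g ≈ 0#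

    order-≥ : ∀ {q} → TorsionFreeBelow q → ∀ {g o} → ¬ (g ≈ 0#) → 0 ℕ.< o → multiple G o g ≈ 0# → q ℕ.≤ o
    order-≥ tf g≉0 0<o og≈0 = ℕₚ.≮⇒≥ λ o<q → g≉0 (tf 0<o o<q og≈0)

    -- What the argument asks of a finite group: equality can be decided, there are at most `N`
    -- classes, and nonzero elements have order at least `q`.
    record Finite (q N : ℕ) : Set where
      field
        _≈?_       : Decidable _≈_
        code       : Carrier → Fin N
        injective  : ∀ x y → code x ≡ code y → x ≈ y
        torsionFree : TorsionFreeBelow q

  multiple-⊕ : (H G : AbGroup) → ∀ n x y →
    multiple (H ⊕ G) n (x , y) ≡ (multiple H n x , multiple G n y)
  multiple-⊕ H G zero    x y = refl
  multiple-⊕ H G (suc n) x y = cong (AbelianGroup._∙_ (H ⊕ G) (x , y)) (multiple-⊕ H G n x y)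

  module _ (H G : AbGroup) where
    private
      module H = AbelianGroup H
      module G = AbelianGroup G
      module HG = AbelianGroup (H ⊕ G)

    multiple-⊕⁻ : ∀ n {x y} → multiple (H ⊕ G) n (x , y) HG.≈ HG.ε → multiple H n x H.≈ H.ε × multiple G n y G.≈ G.ε
    multiple-⊕⁻ n {x} {y} = ≡.subst (HG._≈ HG.ε) (multiple-⊕ H G n x y)

    multiple-⊕⁺ : ∀ n {x y} → multiple H n x H.≈ H.ε → multiple G n y G.≈ G.ε → multiple (H ⊕ G) n (x , y) HG.≈ HG.ε
    multiple-⊕⁺ n {x} {y} z₁ z₂ = ≡.subst (HG._≈ HG.ε) (≡.sym (multiple-⊕ H G n x y)) (z₁ , z₂)

    multiple-zeroˡ : ∀ n → multiple H n H.ε H.≈ H.ε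
    multiple-zeroˡ zero    = H.refl
    multiple-zeroˡ (suc n) = H.trans (H.identityˡ _) (multiple-zeroˡ n)

  module _ (H G : AbGroup) where
    private
      module H = AbelianGroup H
      module G = AbelianGroup G

    order-inj₁ : ∀ {x o} → IsOrder H x o → IsOrder (H ⊕ G) (x , G.ε) o
    order-inj₁ {x} {o} (0<o , ox≈0 , least) =
      0<o , multiple-⊕⁺ H G o ox≈0 (multiple-zeroˡ G H o) ,
      λ m 0<m z → least m 0<m (proj₁ (multiple-⊕⁻ H G m z))

    order-inj₂ : ∀ {y o} → IsOrder G y o → IsOrder (H ⊕ G) (H.ε , y) o
    order-inj₂ {y} {o} (0<o , oy≈0 , least) =
      0<o , multiple-⊕⁺ H G o (multiple-zeroˡ H G o) oy≈0 ,
      λ m 0<m z → least m 0<m (proj₂ (multiple-⊕⁻ H G m z))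

    finite-⊕ : ∀ {q M N} → Finite H q M → Finite G q N → Finite (H ⊕ G) q (M ℕ.* N)
    finite-⊕ FH FG = record
      { _≈?_ = λ (x , y) (x′ , y′) → (x FH.≈? x′) ×-dec (y FG.≈? y′)
      ; code = λ (x , y) → combine (FH.code x) (FG.code y)
      ; injective = λ (x , y) (x′ , y′) eq →
          let eq₁ , eq₂ = Finₚ.combine-injective (FH.code x) (FG.code y) (FH.code x′) (FG.code y′) eq in
          FH.injective x x′ eq₁ , FG.injective y y′ eq₂
      ; torsionFree = λ {o} 0<o o<q z → let z₁ , z₂ = multiple-⊕⁻ H G o z in
          FH.torsionFree 0<o o<q z₁ , FG.torsionFree 0<o o<q z₂
      }
      where
      module FH = Finite FH
      module FG = Finite FG

  finite-terminal : ∀ {q} → Finite Terminal.abelianGroup q 1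
  finite-terminal = record
    { _≈?_ = λ _ _ → yes _ ; code = λ _ → zero ; injective = λ _ _ _ → _ ; torsionFree = λ _ _ _ → _ }

  ≈0⇒∣ : ∀ x → AbelianGroup._≈_ (C n) x ℤ.0ℤ → + n ℤDiv.∣ x
  ≈0⇒∣ {n} x = ≡.subst (+ n ℤDiv.∣_) (ℤₚ.+-identityʳ x)

  ∣⇒≈0 : ∀ {x} → + n ℤDiv.∣ x → AbelianGroup._≈_ (C n) x ℤ.0ℤ
  ∣⇒≈0 {n} {x} = ≡.subst (+ n ℤDiv.∣_) (≡.sym (ℤₚ.+-identityʳ x))

  multiple-C : ∀ n m x → multiple (C n) m x ≡ + m ℤ.* x
  multiple-C n zero    x = refl
  multiple-C n (suc m) x = ≡.trans (cong (λ y → x ℤ.+ y) (multiple-C n m x)) (≡.sym (ℤₚ.suc-* (+ m) x))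

  multiple-C⁻ : ∀ m {x} → AbelianGroup._≈_ (C n) (multiple (C n) m x) ℤ.0ℤ → n ∣ m ℕ.* ℤ.∣ x ∣
  multiple-C⁻ {n} m {x} z = ≡.subst (n ∣_) (ℤₚ.abs-* (+ m) x)
    (ℤDiv.∣⇒∣ᵤ (≡.subst (+ n ℤDiv.∣_) (multiple-C n m x) (≈0⇒∣ {n} (multiple (C n) m x) z)))

  ∣abs⇒≈0 : ∀ {x} → n ∣ ℤ.∣ x ∣ → AbelianGroup._≈_ (C n) x ℤ.0ℤ
  ∣abs⇒≈0 {n} {x} n∣ = ∣⇒≈0 {n} {x} (ℤDiv.∣ᵤ⇒∣ n∣)

  ≈0⇒∣abs : ∀ x → AbelianGroup._≈_ (C n) x ℤ.0ℤ → n ∣ ℤ.∣ x ∣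
  ≈0⇒∣abs {n} x z = ℤDiv.∣⇒∣ᵤ {i = x} (≈0⇒∣ {n} x z)

  -- Euclid's lemma moves one factor `p` at a time into `x`, as `p` cannot divide a positive `o`
  -- below it.
  prime^∣⇒∣ : ∀ {p} → Prime p → ∀ k {o x} → 0 ℕ.< o → o ℕ.< p → p ℕ.^ k ∣ o ℕ.* x → p ℕ.^ k ∣ x
  prime^∣⇒∣ pp zero 0<o o<p _ = 1∣ _
  prime^∣⇒∣ {p} pp (suc k) {o} {x} 0<o o<p p^∣ with euclidsLemma o x pp (∣-trans (m∣m*n (p ℕ.^ k)) p^∣)
  ... | inj₁ p∣o = contradiction p∣o (>⇒∤ {{ℕ.>-nonZero 0<o}} o<p)
  ... | inj₂ (divides y refl) =
    ≡.subst (p ℕ.^ suc k ∣_) (ℕₚ.*-comm p y) (*-monoʳ-∣ p (prime^∣⇒∣ pp k 0<o o<p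
      (*-cancelˡ-∣ p (≡.subst (p ℕ.^ suc k ∣_) rearrange p^∣))))
    where
    open import Data.Nat.Divisibility using (*-monoʳ-∣)
    instance _ = prime⇒nonZero pp
    rearrange : o ℕ.* (y ℕ.* p) ≡ p ℕ.* (o ℕ.* y)
    rearrange = ≡.trans (≡.sym (ℕₚ.*-assoc o y p)) (ℕₚ.*-comm (o ℕ.* y) p)

  codeC : ∀ n .{{_ : NonZero n}} → ℤ → Fin n
  codeC n x = fromℕ< (ℤDivMod.n%ℕd<d x n)

  codeC-injective : ∀ n .{{_ : NonZero n}} x y → codeC n x ≡ codeC n y → AbelianGroup._≈_ (C n) x y
  codeC-injective n x y eq = ℤDiv.divides (x ℤDivMod./ℕ n ℤ.- y ℤDivMod./ℕ n) (begin
    x ℤ.- y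
      ≡⟨ cong₂ ℤ._-_ (ℤDivMod.a≡a%ℕn+[a/ℕn]*n x n) (ℤDivMod.a≡a%ℕn+[a/ℕn]*n y n) ⟩
    (+ (x ℤDivMod.%ℕ n) ℤ.+ x ℤDivMod./ℕ n ℤ.* + n) ℤ.- (+ (y ℤDivMod.%ℕ n) ℤ.+ y ℤDivMod./ℕ n ℤ.* + n)
      ≡⟨ cong (λ ρ → (+ ρ ℤ.+ x ℤDivMod./ℕ n ℤ.* + n) ℤ.- (+ (y ℤDivMod.%ℕ n) ℤ.+ y ℤDivMod./ℕ n ℤ.* + n))
           (Finₚ.fromℕ<-injective (x ℤDivMod.%ℕ n) (y ℤDivMod.%ℕ n) _ _ eq) ⟩
    (+ (y ℤDivMod.%ℕ n) ℤ.+ x ℤDivMod./ℕ n ℤ.* + n) ℤ.- (+ (y ℤDivMod.%ℕ n) ℤ.+ y ℤDivMod./ℕ n ℤ.* + n)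
      ≡⟨ cancel (+ (y ℤDivMod.%ℕ n)) (x ℤDivMod./ℕ n) (y ℤDivMod./ℕ n) (+ n) ⟩
    (x ℤDivMod./ℕ n ℤ.- y ℤDivMod./ℕ n) ℤ.* + n ∎)
    where
    open ≡.≡-Reasoning
    cancel : ∀ ρ a b m → (ρ ℤ.+ a ℤ.* m) ℤ.- (ρ ℤ.+ b ℤ.* m) ≡ (a ℤ.- b) ℤ.* m
    cancel = solve-∀

  finite-C : ∀ {q p} k → Prime p → q ℕ.≤ p → Finite (C (p ℕ.^ k)) q (p ℕ.^ k)
  finite-C {q} {p} k pp q≤p = record
    { _≈?_ = λ x y → + (p ℕ.^ k) ℤDiv.∣? (x ℤ.- y)
    ; code = codeC (p ℕ.^ k)
    ; injective = codeC-injective (p ℕ.^ k)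
    ; torsionFree = λ {o} {x} 0<o o<q z → ∣abs⇒≈0 {p ℕ.^ k} {x}
        (prime^∣⇒∣ pp k 0<o (ℕₚ.<-≤-trans o<q q≤p) (multiple-C⁻ o z))
    }
    where instance
      _ = prime⇒nonZero pp
      _ = ℕₚ.m^n≢0 p k

  finite-⨁C : ∀ {n} (p : Vector ℕ n) (e : Exponents n) → ∀ {q} → (∀ i → Prime (p i)) → (∀ i → q ℕ.≤ p i) →
    Finite (⨁C p e) q (fold₂ ℕ._*_ 1 (λ i k → p i ℕ.^ k) e)
  finite-⨁C {zero}  p e pp q≤p = finite-terminal
  finite-⨁C {suc n} p e pp q≤p = finite-⊕ _ _ (row (e zero)) (finite-⨁C (p ∘ suc) (e ∘ suc) (pp ∘ suc) (q≤p ∘ suc))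
    where
    row : ∀ ks → Finite (List.foldr _⊕_ Terminal.abelianGroup (List.map (λ k → C (p zero ℕ.^ k)) ks)) _
      (List.foldr ℕ._*_ 1 (List.map (λ k → p zero ℕ.^ k) ks))
    row []       = finite-terminal
    row (k ∷ ks) = finite-⊕ _ _ (finite-C k (pp zero) (q≤p zero)) (row ks)

  order-C-1 : 0 ℕ.< r → IsOrder (C r) ℤ.1ℤ r
  order-C-1 {r} 0<r = 0<r , ∣⇒≈0 {r} (≡.subst (+ r ℤDiv.∣_) (≡.sym (≡.trans (multiple-C r r ℤ.1ℤ) (ℤₚ.*-identityʳ (+ r)))) ℤDiv.∣-refl) ,
    λ m 0<m z → ∣⇒≤ {{ℕ.>-nonZero 0<m}} (≡.subst (r ∣_) (ℕₚ.*-identityʳ m) (multiple-C⁻ m z))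

  ones : ∀ r → IMultiset (C r) r
  ones r _ = ℤ.1ℤ

  -- A submultiset of r ones is zero-sum only if r divides its size, so only the empty and the full
  -- one are.
  UFIM-ones : Prime r → UFIM (C r) (ones r)
  UFIM-ones {r} pr = Combinatorics.intersectionClosed⇒UFIM (C r) (λ x y → + r ℤDiv.∣? (x ℤ.- y))
    (λ _ z → contradiction (≈0⇒∣abs {r} ℤ.1ℤ z) (>⇒∤ (ℕ.nonTrivial⇒n>1 r)))
    (∣∣⇒zeroSum ⊤ (≡.subst (r ∣_) (≡.sym (∣⊤∣≡n r)) (divides 1 (≡.sym (ℕₚ.*-identityˡ r)))))
    λ I J zI zJ → inter I J (zeroSum⇒∣∣ I zI) zJ
    where
    instance
      _ = prime⇒nonTrivial pr
      _ = prime⇒nonZero pr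
    σ-ones : ∀ {ℓ} (I : Subset ℓ) → σ (C r) (λ _ → ℤ.1ℤ) I ≡ + ∣ I ∣
    σ-ones []          = refl
    σ-ones (true ∷ I)  = cong (λ y → ℤ.1ℤ ℤ.+ y) (σ-ones I)
    σ-ones (false ∷ I) = ≡.trans (ℤₚ.+-identityˡ _) (σ-ones I)
    zeroSum⇒∣∣ : ∀ I → ZeroSum (C r) (ones r) I → r ∣ ∣ I ∣
    zeroSum⇒∣∣ I z = ≡.subst (λ x → r ∣ ℤ.∣ x ∣) (σ-ones I) (≈0⇒∣abs {r} (σ (C r) (ones r) I) z)
    ∣∣⇒zeroSum : ∀ I → r ∣ ∣ I ∣ → ZeroSum (C r) (ones r) I
    ∣∣⇒zeroSum I r∣ = ≡.subst (λ x → AbelianGroup._≈_ (C r) x ℤ.0ℤ) (≡.sym (σ-ones I)) (∣abs⇒≈0 {r} {+ ∣ I ∣} r∣)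
    inter : ∀ I J → r ∣ ∣ I ∣ → ZeroSum (C r) (ones r) J → ZeroSum (C r) (ones r) (I ∩ J)
    inter I J r∣ zJ with nonempty? I
    ... | no empty = Combinatorics.σ-Empty (C r) (ones r) (I ∩ J) λ (x , x∈) → empty (x , p∩q⊆p I J x∈)
    ... | yes (x , x∈I) = ≡.subst (ZeroSum (C r) (ones r)) (≡.sym (≡.trans (cong (_∩ J) I≡⊤) (∩-identityˡ J))) zJ
      where
      0<∣I∣ : 0 ℕ.< ∣ I ∣
      0<∣I∣ = ℕₚ.<-≤-trans (≡.subst (0 ℕ.<_) (≡.sym (∣⁅x⁆∣≡1 x)) (s≤s z≤n))
        (p⊆q⇒∣p∣≤∣q∣ λ y∈ → ≡.subst (_∈ I) (≡.sym (x∈⁅y⁆⇒x≡y x y∈)) x∈I)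
      I≡⊤ : I ≡ ⊤
      I≡⊤ = ∣p∣≡n⇒p≡⊤ (ℕₚ.≤-antisym (∣p∣≤n I) (∣⇒≤ {{ℕ.>-nonZero 0<∣I∣}} r∣))

  -- The prefixes of a minimal zero-sum multiset have distinct sums.
  davenport : (G : AbGroup) (S : IMultiset G ℓ) → MinimalZeroSum G S ⊤ →
    ∀ {N} (code : AbelianGroup.Carrier G → Fin N) → (∀ x y → code x ≡ code y → AbelianGroup._≈_ G x y) → ℓ ℕ.≤ N
  davenport {ℓ} G S (_ , minimal) code injective = Finₚ.injective⇒≤ {f = code ∘ σ G S ∘ prefix} inj
    where
    open AbelianGroup G renaming (ε to 0#; _∙_ to _+_; refl to ≈-refl; sym to ≈-sym; trans to ≈-trans)
    open GroupProperties G using (∙-cancelˡ)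
    open Combinatorics G
    -- `prefix j` stops short of `j`, so the prefixes have sizes 0 to ℓ - 1; the full multiset would
    -- repeat the sum 0 of the empty one.
    before : Fin ℓ → Fin ℓ → Bool
    before j i = toℕ i ℕ.<ᵇ toℕ j
    prefix : Fin ℓ → Subset ℓ
    prefix j = tabulate (before j)
    ∈-prefix⁺ : ∀ {i j} → toℕ i ℕ.< toℕ j → i ∈ prefix j
    ∈-prefix⁺ {i} {j} i<j = ∈-tabulate⁺ (before j) (Equivalence.to T-≡ (ℕₚ.<⇒<ᵇ i<j))
    ∈-prefix⁻ : ∀ {i j} → i ∈ prefix j → toℕ i ℕ.< toℕ j
    ∈-prefix⁻ {i} {j} i∈ = ℕₚ.<ᵇ⇒< _ _ (Equivalence.from T-≡ (∈-tabulate⁻ (before j) i∈))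
    distinct : ∀ {i j} → toℕ i ℕ.< toℕ j → ¬ (σ G S (prefix i) ≈ σ G S (prefix j))
    distinct {i} {j} i<j eq = minimal segment
      (i , x∈p∩∁q⁺ (prefix j) (prefix i) (∈-prefix⁺ i<j) (ℕₚ.<-irrefl refl ∘ ∈-prefix⁻))
      -- The segment between two prefixes misses `j`, so it is a proper part.
      (⊆⊤ , j , ∈⊤ , λ j∈ → ℕₚ.<-irrefl refl (∈-prefix⁻ {j} {j} (proj₁ (x∈p∩∁q⁻ (prefix j) (prefix i) j∈))))
      (∙-cancelˡ (σ G S (prefix i)) _ _ (≈-trans (≈-sym (≈-trans (σ-split S (prefix j) (prefix i))
        (∙-congʳ (reflexive (cong (σ G S) ∩≡))))) (≈-trans (≈-sym eq) (≈-sym (identityʳ _)))))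
      where
      segment = prefix j ∩ ∁ (prefix i)
      ∩≡ : prefix j ∩ prefix i ≡ prefix i
      ∩≡ = ⊆-antisym (p∩q⊆q (prefix j) (prefix i))
        λ x∈ → x∈p∩q⁺ (∈-prefix⁺ (ℕₚ.<-trans (∈-prefix⁻ x∈) i<j) , x∈)
    inj : ∀ {i j} → code (σ G S (prefix i)) ≡ code (σ G S (prefix j)) → i ≡ j
    inj {i} {j} eq with Finₚ.<-cmp i j
    ... | tri< i<j _ _ = contradiction (injective (σ G S (prefix i)) (σ G S (prefix j)) eq) (distinct i<j)
    ... | tri≈ _ i≡j _ = i≡j
    ... | tri> _ _ j<i = contradiction (injective (σ G S (prefix j)) (σ G S (prefix i)) (≡.sym eq)) (distinct j<i)

  module _ (G : AbGroup) where
    open AbelianGroup G renaming (ε to 0#; _∙_ to _+_; refl to ≈-refl; sym to ≈-sym; trans to ≈-trans)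
    open GroupProperties G using (inverseʳ-unique)
    open Combinatorics G
    open import Relation.Binary.Reasoning.Setoid setoid

    σ-∁singleton : (S : IMultiset G ℓ) → ZeroSum G S ⊤ → ∀ i → σ G S (⊤ ∩ ∁ ⁅ i ⁆) ≈ S i ⁻¹
    σ-∁singleton S z i = inverseʳ-unique (S i) _ (begin
      S i + σ G S (⊤ ∩ ∁ ⁅ i ⁆)                ≈⟨ ∙-congʳ (σ-singleton S i) ⟨
      σ G S ⁅ i ⁆ + σ G S (⊤ ∩ ∁ ⁅ i ⁆)        ≡⟨ cong (λ I → σ G S I + σ G S (⊤ ∩ ∁ ⁅ i ⁆)) (∩-identityˡ ⁅ i ⁆) ⟨
      σ G S (⊤ ∩ ⁅ i ⁆) + σ G S (⊤ ∩ ∁ ⁅ i ⁆)  ≈⟨ σ-split S ⊤ ⁅ i ⁆ ⟨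
      σ G S ⊤                                  ≈⟨ z ⟩
      0#                                       ∎)

    -- One index suffices: the empty set, the set of `i` alone and its complement have the sums 0,
    -- `S i` and the inverse of `S i`.
    all-reached : Decidable _≈_ → (∀ x y → ¬ (x ≈ 0#) → ¬ (y ≈ 0#) → x ≈ y ⊎ x ≈ y ⁻¹) →
      (S : IMultiset G ℓ) → Fin ℓ → OverNonzero G S → ZeroSum G S ⊤ → ∀ x → ∃ λ I → σ G S I ≈ x
    all-reached _≈?_ ± S i nz z x with x ≈? 0#
    ... | yes x≈0 = ⊥ , ≈-trans (σ-Empty S ⊥ λ (_ , y∈) → ∉⊥ y∈) (≈-sym x≈0)
    ... | no  x≉0 with ± x (S i) x≉0 (nz i)
    ...   | inj₁ x≈  = ⁅ i ⁆ , ≈-trans (σ-singleton S i) (≈-sym x≈)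
    ...   | inj₂ x≈- = ⊤ ∩ ∁ ⁅ i ⁆ , ≈-trans (σ-∁singleton S z i) (≈-sym x≈-)

  module Small (r : ℕ) (r≡ : r ≡ 2 ⊎ r ≡ 3) where
    open AbelianGroup (C r) using (_≈_)

    ±1 : ∀ x → ¬ (x ≈ ℤ.0ℤ) → + r ℤDiv.∣ x ℤ.- ℤ.1ℤ ⊎ + r ℤDiv.∣ x ℤ.+ ℤ.1ℤ
    ±1 x x≉0 = go r≡
      where
      up : ∀ a b → (+ 1 ℤ.+ a ℤ.* b) ℤ.- + 1 ≡ a ℤ.* b
      up = solve-∀
      -- The remainder 2 is -1 modulo 3.
      down : ∀ a → (+ 2 ℤ.+ a ℤ.* + 3) ℤ.+ + 1 ≡ (a ℤ.+ + 1) ℤ.* + 3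
      down = solve-∀
      go : r ≡ 2 ⊎ r ≡ 3 → + r ℤDiv.∣ x ℤ.- ℤ.1ℤ ⊎ + r ℤDiv.∣ x ℤ.+ ℤ.1ℤ
      go (inj₁ refl) with x ℤDivMod.%ℕ 2 | ℤDivMod.n%ℕd<d x 2 | ℤDivMod.a≡a%ℕn+[a/ℕn]*n x 2
      ... | 0 | _ | eq = contradiction (∣⇒≈0 {2} (ℤDiv.divides (x ℤDivMod./ℕ 2) (≡.trans eq (ℤₚ.+-identityˡ _)))) x≉0
      ... | 1 | _ | eq = inj₁ (ℤDiv.divides (x ℤDivMod./ℕ 2) (≡.trans (cong (λ z → z ℤ.- ℤ.1ℤ) eq) (up (x ℤDivMod./ℕ 2) (+ 2))))
      ... | suc (suc _) | s≤s (s≤s ()) | _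
      go (inj₂ refl) with x ℤDivMod.%ℕ 3 | ℤDivMod.n%ℕd<d x 3 | ℤDivMod.a≡a%ℕn+[a/ℕn]*n x 3
      ... | 0 | _ | eq = contradiction (∣⇒≈0 {3} (ℤDiv.divides (x ℤDivMod./ℕ 3) (≡.trans eq (ℤₚ.+-identityˡ _)))) x≉0
      ... | 1 | _ | eq = inj₁ (ℤDiv.divides (x ℤDivMod./ℕ 3) (≡.trans (cong (λ z → z ℤ.- ℤ.1ℤ) eq) (up (x ℤDivMod./ℕ 3) (+ 3))))
      ... | 2 | _ | eq = inj₂ (ℤDiv.divides (x ℤDivMod./ℕ 3 ℤ.+ + 1) (≡.trans (cong (λ z → z ℤ.+ ℤ.1ℤ) eq) (down (x ℤDivMod./ℕ 3))))
      ... | suc (suc (suc _)) | s≤s (s≤s (s≤s ())) | _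

    -- Both elements are 1 or -1. This fails for every prime above 3, where 2 is none of 0, 1 and
    -- -1.
    ≈± : ∀ x y → ¬ (x ≈ ℤ.0ℤ) → ¬ (y ≈ ℤ.0ℤ) → x ≈ y ⊎ x ≈ ℤ.- y
    ≈± x y x≉0 y≉0 with ±1 x x≉0 | ±1 y y≉0
    ... | inj₁ a | inj₁ b = inj₁ (≡.subst (+ r ℤDiv.∣_) (e x y) (ℤDiv.∣m∣n⇒∣m-n a b))
      where e : ∀ x y → (x ℤ.- + 1) ℤ.- (y ℤ.- + 1) ≡ x ℤ.- y
            e = solve-∀
    ... | inj₁ a | inj₂ b = inj₂ (≡.subst (+ r ℤDiv.∣_) (e x y) (ℤDiv.∣m∣n⇒∣m+n a b))
      where e : ∀ x y → (x ℤ.- + 1) ℤ.+ (y ℤ.+ + 1) ≡ x ℤ.- ℤ.- y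
            e = solve-∀
    ... | inj₂ a | inj₁ b = inj₂ (≡.subst (+ r ℤDiv.∣_) (e x y) (ℤDiv.∣m∣n⇒∣m+n a b))
      where e : ∀ x y → (x ℤ.+ + 1) ℤ.+ (y ℤ.- + 1) ≡ x ℤ.- ℤ.- y
            e = solve-∀
    ... | inj₂ a | inj₂ b = inj₁ (≡.subst (+ r ℤDiv.∣_) (e x y) (ℤDiv.∣m∣n⇒∣m-n a b))
      where e : ∀ x y → (x ℤ.+ + 1) ℤ.- (y ℤ.+ + 1) ≡ x ℤ.- y
            e = solve-∀

open Orders

-- Rational arithmetic and the closed forms of K₁* and k*

module Fractions where
  open import Data.Integer.Base as ℤ using (ℤ; +_)
  import Data.Integer.Properties as ℤₚ
  open import Data.List.Base as List using (List; []; _∷_)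
  open import Data.List.Relation.Unary.All using (All; []; _∷_)
  import Data.Nat.Coprimality as Coprimality
  open import Data.Rational.Base as ℚ using (ℚ; mkℚ; 0ℚ; 1ℚ; _/_; _+_; _*_; _-_; -_; _≤_; _<_; toℚᵘ; *≤*; *<*)
  import Data.Rational.Properties as ℚₚ
  open import Data.Rational.Unnormalised.Base as ℚᵘ using (mkℚᵘ; *≡*)
  import Data.Rational.Unnormalised.Properties as ℚᵘₚ
  open import Relation.Binary.Definitions using (tri<; tri≈; tri>)
  open import Relation.Nullary.Decidable using (dec⇒maybe)
  open import Tactic.RingSolver using (solve-∀)
  import Tactic.RingSolver.Core.AlmostCommutativeRing as ACR
  open import Level using (0ℓ)

  ringℚ : ACR.AlmostCommutativeRing 0ℓ 0ℓ
  ringℚ = ACR.fromCommutativeRing ℚₚ.+-*-commutativeRing λ x → dec⇒maybe (0ℚ ℚₚ.≟ x)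

  private
    variable
      w x y z : ℚ

  *-monoʳ-≤ : ∀ z → 0ℚ ≤ z → x ≤ y → x * z ≤ y * z
  *-monoʳ-≤ z 0≤z = ℚₚ.*-monoʳ-≤-nonNeg z {{ℚ.nonNegative 0≤z}}

  *-monoˡ-≤ : ∀ z → 0ℚ ≤ z → x ≤ y → z * x ≤ z * y
  *-monoˡ-≤ z 0≤z = ℚₚ.*-monoˡ-≤-nonNeg z {{ℚ.nonNegative 0≤z}}

  *-monoʳ-< : ∀ z → 0ℚ < z → x < y → x * z < y * z
  *-monoʳ-< z 0<z = ℚₚ.*-monoˡ-<-pos z {{ℚ.positive 0<z}}

  *-monoˡ-< : ∀ z → 0ℚ < z → x < y → z * x < z * y
  *-monoˡ-< z 0<z = ℚₚ.*-monoʳ-<-pos z {{ℚ.positive 0<z}}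

  *-mono-≤ : 0ℚ ≤ w → w ≤ x → 0ℚ ≤ y → y ≤ z → w * y ≤ x * z
  *-mono-≤ {w} {x} {y} {z} 0≤w w≤x 0≤y y≤z =
    ℚₚ.≤-trans (*-monoʳ-≤ y 0≤y w≤x) (*-monoˡ-≤ x (ℚₚ.≤-trans 0≤w w≤x) y≤z)

  0≤* : 0ℚ ≤ x → 0ℚ ≤ y → 0ℚ ≤ x * y
  0≤* {x} {y} 0≤x 0≤y = ≡.subst (_≤ x * y) (ℚₚ.*-zeroʳ x) (*-monoˡ-≤ x 0≤x 0≤y)

  0<* : 0ℚ < x → 0ℚ < y → 0ℚ < x * y
  0<* {x} {y} 0<x 0<y = ≡.subst (_< x * y) (ℚₚ.*-zeroʳ x) (*-monoˡ-< x 0<x 0<y)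

  *-cancelʳ-≡ : ∀ z → 0ℚ < z → x * z ≡ y * z → x ≡ y
  *-cancelʳ-≡ z 0<z eq = ℚₚ.≤-antisym
    (ℚₚ.*-cancelʳ-≤-pos z (ℚₚ.≤-reflexive eq)) (ℚₚ.*-cancelʳ-≤-pos z (ℚₚ.≤-reflexive (≡.sym eq)))
    where instance _ = ℚ.positive 0<z

  0<1 : 0ℚ < 1ℚ
  0<1 = ℚₚ.positive⁻¹ 1ℚ

  x<y⇒0<y-x : ∀ x y → x < y → 0ℚ < y - x
  x<y⇒0<y-x x y x<y = ≡.subst (_< y - x) (ℚₚ.+-inverseʳ x) (ℚₚ.+-monoˡ-< (- x) x<y)

  0≤inverse : ∀ w x → w * x ≡ 1ℚ → 0ℚ < x → 0ℚ ≤ w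
  0≤inverse w x wx≡1 0<x = ℚₚ.*-cancelʳ-≤-pos x {{ℚ.positive 0<x}}
    (≡.subst₂ _≤_ (≡.sym (ℚₚ.*-zeroˡ x)) (≡.sym wx≡1) (ℚₚ.<⇒≤ 0<1))

  -- Inverses are given by equations so that `1 ⁄ m` and `inv x` can be compared with one another.
  inverse-anti : ∀ w x y z → w * x ≡ 1ℚ → y * z ≡ 1ℚ → 0ℚ < x → x ≤ z → y ≤ w
  inverse-anti w x y z wx yz 0<x x≤z = begin
    y            ≡⟨ ℚₚ.*-identityʳ y ⟨
    y * 1ℚ       ≡⟨ cong (y *_) wx ⟨
    y * (w * x)  ≤⟨ *-monoˡ-≤ y (0≤inverse y z yz (ℚₚ.<-≤-trans 0<x x≤z)) (*-monoˡ-≤ w (0≤inverse w x wx 0<x) x≤z) ⟩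
    y * (w * z)  ≡⟨ e y w z ⟩
    (y * z) * w  ≡⟨ cong (_* w) yz ⟩
    1ℚ * w       ≡⟨ ℚₚ.*-identityˡ w ⟩
    w            ∎
    where
    open ℚₚ.≤-Reasoning
    e : ∀ y w z → y * (w * z) ≡ (y * z) * w
    e = solve-∀ ringℚ

  -- Total, with the value 0 at 0, so that the summands of (*) can be written as functions of a
  -- rational variable in place of c.
  inv : ℚ → ℚ
  inv x with x ℚₚ.≟ 0ℚ
  ... | yes _  = 0ℚ
  ... | no x≢0 = ℚ.1/_ x {{ℚ.≢-nonZero x≢0}}

  inv-* : 0ℚ < x → inv x * x ≡ 1ℚ
  inv-* {x} 0<x with x ℚₚ.≟ 0ℚ
  ... | yes x≡0 = contradiction (≡.sym x≡0) (ℚₚ.<⇒≢ 0<x)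
  ... | no x≢0  = ℚₚ.*-inverseˡ x {{ℚ.≢-nonZero x≢0}}

  pow : ℚ → ℕ → ℚ
  pow x zero    = 1ℚ
  pow x (suc n) = x * pow x n

  0<pow : 0ℚ < x → ∀ n → 0ℚ < pow x n
  0<pow 0<x zero    = 0<1
  0<pow 0<x (suc n) = 0<* 0<x (0<pow 0<x n)

  pow-+ : ∀ x m n → pow x (m ℕ.+ n) ≡ pow x m * pow x n
  pow-+ x zero    n = ≡.sym (ℚₚ.*-identityˡ _)
  pow-+ x (suc m) n = ≡.trans (cong (x *_) (pow-+ x m n)) (≡.sym (ℚₚ.*-assoc x _ _))

  ι : ℕ → ℚ
  ι n = + n / 1

  -- The operator `/` normalizes by a gcd and is stuck on a variable `n`; this form exposes
  -- numerator and denominator.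
  ι≡mkℚ : ∀ n → ι n ≡ mkℚ (+ n) 0 (Coprimality.sym (Coprimality.1-coprimeTo n))
  ι≡mkℚ n = ℚₚ.↥p/↧p≡p (mkℚ (+ n) 0 (Coprimality.sym (Coprimality.1-coprimeTo n)))

  ι-* : ∀ m n → ι (m ℕ.* n) ≡ ι m * ι n
  ι-* m n = ≡.trans (cong (_/ 1) (ℤₚ.pos-* m n)) (≡.sym (cong₂ _*_ (ι≡mkℚ m) (ι≡mkℚ n)))

  ι-+ : ∀ m n → ι (m ℕ.+ n) ≡ ι m + ι n
  ι-+ m n = ≡.trans
    (cong (_/ 1) (≡.trans (ℤₚ.pos-+ m n) (≡.sym (cong₂ ℤ._+_ (ℤₚ.*-identityʳ (+ m)) (ℤₚ.*-identityʳ (+ n))))))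
    (≡.sym (cong₂ _+_ (ι≡mkℚ m) (ι≡mkℚ n)))

  ι-mono-≤ : ∀ {m n} → m ℕ.≤ n → ι m ≤ ι n
  ι-mono-≤ {m} {n} m≤n = ≡.subst₂ _≤_ (≡.sym (ι≡mkℚ m)) (≡.sym (ι≡mkℚ n))
    (*≤* (ℤₚ.*-monoʳ-≤-nonNeg (+ 1) (ℤ.+≤+ m≤n)))

  ι-mono-< : ∀ {m n} → m ℕ.< n → ι m < ι n
  ι-mono-< {m} {n} m<n = ≡.subst₂ _<_ (≡.sym (ι≡mkℚ m)) (≡.sym (ι≡mkℚ n))
    (*<* (ℤₚ.*-monoʳ-<-pos (+ 1) (ℤ.+<+ m<n)))

  0<ι : ∀ {n} → 0 ℕ.< n → 0ℚ < ι n
  0<ι 0<n = ι-mono-< 0<n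

  ι-^ : ∀ m n → ι (m ℕ.^ n) ≡ pow (ι m) n
  ι-^ m zero    = refl
  ι-^ m (suc n) = ≡.trans (ι-* m (m ℕ.^ n)) (cong (ι m *_) (ι-^ m n))

  ι-∸ : ∀ {m n} → n ℕ.≤ m → ι (m ℕ.∸ n) ≡ ι m - ι n
  ι-∸ {m} {n} n≤m = begin
    ι (m ℕ.∸ n)                  ≡⟨ e (ι (m ℕ.∸ n)) (ι n) ⟩
    (ι (m ℕ.∸ n) + ι n) - ι n    ≡⟨ cong (_- ι n) (ι-+ (m ℕ.∸ n) n) ⟨
    ι (m ℕ.∸ n ℕ.+ n) - ι n      ≡⟨ cong (λ k → ι k - ι n) (ℕₚ.m∸n+n≡m n≤m) ⟩
    ι m - ι n                    ∎
    where
    open ≡.≡-Reasoning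
    e : ∀ x y → x ≡ (x + y) - y
    e = solve-∀ ringℚ

  ⁄-* : ∀ m {d} → 0 ℕ.< d → (m ⁄ d) * ι d ≡ ι m
  ⁄-* m {suc d} _ = ℚₚ.toℚᵘ-injective (begin
    toℚᵘ ((+ m / suc d) * ι (suc d))             ≈⟨ ℚₚ.toℚᵘ-homo-* (+ m / suc d) (ι (suc d)) ⟩
    toℚᵘ (+ m / suc d) ℚᵘ.* toℚᵘ (ι (suc d))
      ≈⟨ ℚᵘₚ.*-cong (ℚₚ.toℚᵘ-fromℚᵘ (mkℚᵘ (+ m) d)) (ℚₚ.toℚᵘ-fromℚᵘ (mkℚᵘ (+ suc d) 0)) ⟩
    mkℚᵘ (+ m) d ℚᵘ.* mkℚᵘ (+ suc d) 0           ≈⟨ *≡* cross ⟩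
    mkℚᵘ (+ m) 0                                 ≈⟨ ℚₚ.toℚᵘ-fromℚᵘ (mkℚᵘ (+ m) 0) ⟨
    toℚᵘ (ι m)                                   ∎)
    where
    open ℚᵘₚ.≃-Reasoning
    cross : (+ m ℤ.* + suc d) ℤ.* + 1 ≡ + m ℤ.* + (suc d ℕ.* 1)
    cross = ≡.trans (ℤₚ.*-assoc (+ m) (+ suc d) (+ 1)) (cong (+ m ℤ.*_) (≡.sym (ℤₚ.pos-* (suc d) 1)))

  ⁄-unique : ∀ x m {d} → 0 ℕ.< d → x * ι d ≡ ι m → m ⁄ d ≡ x
  ⁄-unique x m {d} 0<d eq = *-cancelʳ-≡ (ι d) (0<ι 0<d) (≡.trans (⁄-* m 0<d) (≡.sym eq))

  0≤⁄ : ∀ m d → 0ℚ ≤ m ⁄ d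
  0≤⁄ m zero    = ℚₚ.≤-refl
  0≤⁄ m (suc d) = ℚₚ.*-cancelʳ-≤-pos (ι (suc d)) {{ℚ.positive (0<ι {suc d} (s≤s z≤n))}}
    (≡.subst₂ _≤_ (≡.sym (ℚₚ.*-zeroˡ (ι (suc d)))) (≡.sym (⁄-* m {suc d} (s≤s z≤n))) (ι-mono-≤ {0} {m} z≤n))

  1⁄-anti : ∀ {m n} → 0 ℕ.< m → m ℕ.≤ n → 1 ⁄ n ≤ 1 ⁄ m
  1⁄-anti {m} {n} 0<m m≤n = inverse-anti (1 ⁄ m) (ι m) (1 ⁄ n) (ι n) (⁄-* 1 0<m) (⁄-* 1 (ℕₚ.<-≤-trans 0<m m≤n)) (0<ι 0<m) (ι-mono-≤ m≤n)

  ι-injective : ∀ m n → ι m ≡ ι n → m ≡ n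
  ι-injective m n eq with ℕₚ.<-cmp m n
  ... | tri< m<n _ _ = contradiction eq (ℚₚ.<⇒≢ (ι-mono-< m<n))
  ... | tri≈ _ m≡n _ = m≡n
  ... | tri> _ _ n<m = contradiction (≡.sym eq) (ℚₚ.<⇒≢ (ι-mono-< n<m))

  1⁄-injective : ∀ {m n} → 0 ℕ.< m → 0 ℕ.< n → 1 ⁄ m ≡ 1 ⁄ n → m ≡ n
  1⁄-injective {m} {n} 0<m 0<n eq = ι-injective m n (≡.sym (begin
    ι n                    ≡⟨ ℚₚ.*-identityʳ (ι n) ⟨
    ι n * 1ℚ               ≡⟨ cong (ι n *_) (⁄-* 1 0<m) ⟨
    ι n * ((1 ⁄ m) * ι m)  ≡⟨ cong (λ q → ι n * (q * ι m)) eq ⟩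
    ι n * ((1 ⁄ n) * ι m)  ≡⟨ e (ι n) (1 ⁄ n) (ι m) ⟩
    ((1 ⁄ n) * ι n) * ι m  ≡⟨ cong (_* ι m) (⁄-* 1 0<n) ⟩
    1ℚ * ι m               ≡⟨ ℚₚ.*-identityˡ (ι m) ⟩
    ι m                    ∎))
    where
    open ≡.≡-Reasoning
    e : ∀ a b c → a * (b * c) ≡ (b * a) * c
    e = solve-∀ ringℚ

  -- Horner form of w + w^2 + ... + w^k.
  geometric : ℚ → ℕ → ℚ
  geometric w zero    = 0ℚ
  geometric w (suc k) = w * (1ℚ + geometric w k)

  0≤geometric : 0ℚ ≤ w → ∀ k → 0ℚ ≤ geometric w k
  0≤geometric 0≤w zero    = ℚₚ.≤-refl
  0≤geometric 0≤w (suc k) = 0≤* 0≤w (ℚₚ.+-mono-≤ (ℚₚ.<⇒≤ 0<1) (0≤geometric 0≤w k))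

  geometric-mono : 0ℚ ≤ w → w ≤ x → ∀ k → geometric w k ≤ geometric x k
  geometric-mono 0≤w w≤x zero    = ℚₚ.≤-refl
  geometric-mono 0≤w w≤x (suc k) = *-mono-≤ 0≤w w≤x
    (ℚₚ.+-mono-≤ (ℚₚ.<⇒≤ 0<1) (0≤geometric 0≤w k)) (ℚₚ.+-monoʳ-≤ 1ℚ (geometric-mono 0≤w w≤x k))

  geometric-suc : ∀ w k → geometric w (suc k) ≡ geometric w k + pow w (suc k)
  geometric-suc w zero    = e w
    where
    e : ∀ w → w * (1ℚ + 0ℚ) ≡ 0ℚ + w * 1ℚ
    e = solve-∀ ringℚ
  geometric-suc w (suc k) = ≡.trans (cong (λ t → w * (1ℚ + t)) (geometric-suc w k)) (e w (geometric w k) (pow w (suc k)))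
    where
    e : ∀ w a b → w * (1ℚ + (a + b)) ≡ w * (1ℚ + a) + w * b
    e = solve-∀ ringℚ

  -- Cleared of its denominator, this is the value (x^k - 1) / (x^(k+1) - x^k) of 1/x + ... + 1/x^k,
  -- the shape of the summands in (*).
  geometric-* : ∀ w x → w * x ≡ 1ℚ → ∀ k → geometric w k * (pow x (suc k) - pow x k) ≡ pow x k - 1ℚ
  geometric-* w x wx zero    = ℚₚ.*-zeroˡ (pow x 1 - 1ℚ)
  geometric-* w x wx (suc k) = begin
    (w * (1ℚ + g)) * (x * (x * P) - x * P)   ≡⟨ e₁ w x g P ⟩
    (w * x) * ((x * P - P) + g * (x * P - P)) ≡⟨ cong₂ (λ a b → a * ((x * P - P) + b)) wx (geometric-* w x wx k) ⟩
    1ℚ * ((x * P - P) + (P - 1ℚ))            ≡⟨ e₂ x P ⟩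
    x * P - 1ℚ                               ∎
    where
    open ≡.≡-Reasoning
    g = geometric w k
    P = pow x k
    e₁ : ∀ w x g P → (w * (1ℚ + g)) * (x * (x * P) - x * P) ≡ (w * x) * ((x * P - P) + g * (x * P - P))
    e₁ = solve-∀ ringℚ
    e₂ : ∀ x P → 1ℚ * ((x * P - P) + (P - 1ℚ)) ≡ x * P - 1ℚ
    e₂ = solve-∀ ringℚ

  pow-inverse : ∀ w x → w * x ≡ 1ℚ → ∀ k → pow w k * pow x k ≡ 1ℚ
  pow-inverse w x wx zero    = refl
  pow-inverse w x wx (suc k) = ≡.trans (e w (pow w k) x (pow x k)) (cong₂ _*_ wx (pow-inverse w x wx k))
    where
    e : ∀ a b c d → (a * b) * (c * d) ≡ (a * c) * (b * d)
    e = solve-∀ ringℚ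

  0<pow-suc∸pow : 1ℚ < x → ∀ k → 0ℚ < pow x (suc k) - pow x k
  0<pow-suc∸pow {x} 1<x k = ≡.subst (0ℚ <_) (e x (pow x k))
    (0<* (x<y⇒0<y-x 1ℚ x 1<x) (0<pow (ℚₚ.<-trans 0<1 1<x) k))
    where
    e : ∀ x P → (x - 1ℚ) * P ≡ x * P - P
    e = solve-∀ ringℚ

  module _ {p : ℕ} (1<p : 1 ℕ.< p) where
    private
      0<p : 0 ℕ.< p
      0<p = ℕₚ.<-trans (s≤s z≤n) 1<p
      p⁻¹ = 1 ⁄ p
      p⁻¹p : p⁻¹ * ι p ≡ 1ℚ
      p⁻¹p = ⁄-* 1 0<p
      1≤^ : ∀ k → 1 ℕ.≤ p ℕ.^ k
      1≤^ k = ℕₚ.m^n>0 p {{ℕ.>-nonZero 0<p}} k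

    -- The denominator is the same as in `geometric-*`, and the numerator exceeds p^k - 1 by exactly
    -- this denominator.
    K₁-term : ∀ k → (p ℕ.^ suc k ℕ.∸ 1) ⁄ (p ℕ.^ suc k ℕ.∸ p ℕ.^ k) ≡ 1ℚ + geometric p⁻¹ k
    K₁-term k = ⁄-unique (1ℚ + geometric p⁻¹ k) (p ℕ.^ suc k ℕ.∸ 1) (ℕₚ.m<n⇒0<n∸m p^k<) (begin
      (1ℚ + geometric p⁻¹ k) * ι (p ℕ.^ suc k ℕ.∸ p ℕ.^ k)         ≡⟨ cong ((1ℚ + geometric p⁻¹ k) *_) difference ⟩
      (1ℚ + geometric p⁻¹ k) * (ι p * P - P)                       ≡⟨ e₁ (geometric p⁻¹ k) (ι p) P ⟩
      (ι p * P - P) + geometric p⁻¹ k * (ι p * P - P)              ≡⟨ cong (λ z → (ι p * P - P) + z) (geometric-* p⁻¹ (ι p) p⁻¹p k) ⟩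
      (ι p * P - P) + (P - 1ℚ)                                   ≡⟨ e₂ (ι p) P ⟩
      ι p * P - 1ℚ                                               ≡⟨ cong (_- 1ℚ) (ι-^ p (suc k)) ⟨
      ι (p ℕ.^ suc k) - 1ℚ                                       ≡⟨ ι-∸ (1≤^ (suc k)) ⟨
      ι (p ℕ.^ suc k ℕ.∸ 1)                                      ∎)
      where
      open ≡.≡-Reasoning
      P = pow (ι p) k
      p^k< : p ℕ.^ k ℕ.< p ℕ.^ suc k
      p^k< = ℕₚ.^-monoʳ-< p 1<p (ℕₚ.n<1+n k)
      difference : ι (p ℕ.^ suc k ℕ.∸ p ℕ.^ k) ≡ ι p * P - P
      difference = ≡.trans (ι-∸ (ℕₚ.<⇒≤ p^k<)) (cong₂ _-_ (ι-^ p (suc k)) (ι-^ p k))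
      e₁ : ∀ g x P → (1ℚ + g) * (x * P - P) ≡ (x * P - P) + g * (x * P - P)
      e₁ = solve-∀ ringℚ
      e₂ : ∀ x P → (x * P - P) + (P - 1ℚ) ≡ x * P - 1ℚ
      e₂ = solve-∀ ringℚ

    k-term : ∀ k → (p ℕ.^ k ℕ.∸ 1) ⁄ (p ℕ.^ k) ≡ 1ℚ - pow p⁻¹ k
    k-term k = ⁄-unique (1ℚ - pow p⁻¹ k) (p ℕ.^ k ℕ.∸ 1) (1≤^ k) (begin
      (1ℚ - pow p⁻¹ k) * ι (p ℕ.^ k)          ≡⟨ cong ((1ℚ - pow p⁻¹ k) *_) (ι-^ p k) ⟩
      (1ℚ - pow p⁻¹ k) * pow (ι p) k          ≡⟨ e (pow p⁻¹ k) (pow (ι p) k) ⟩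
      pow (ι p) k - pow p⁻¹ k * pow (ι p) k   ≡⟨ cong₂ _-_ (≡.sym (ι-^ p k)) (pow-inverse p⁻¹ (ι p) p⁻¹p k) ⟩
      ι (p ℕ.^ k) - 1ℚ                      ≡⟨ ι-∸ (1≤^ k) ⟨
      ι (p ℕ.^ k ℕ.∸ 1)                     ∎)
      where
      open ≡.≡-Reasoning
      e : ∀ a b → (1ℚ - a) * b ≡ b - a * b
      e = solve-∀ ringℚ

    -- The summand 1 + 1/p + ... + 1/p^(k-1) of K₁* exceeds the summand 1 - 1/p^k of k* by 1/p + ...
    -- + 1/p^k.
    K₁-term≡ : ∀ {k} → 1 ℕ.≤ k → (p ℕ.^ k ℕ.∸ 1) ⁄ (p ℕ.^ k ℕ.∸ p ℕ.^ (k ℕ.∸ 1)) ≡ (p ℕ.^ k ℕ.∸ 1) ⁄ (p ℕ.^ k) + geometric p⁻¹ k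
    K₁-term≡ {suc k} _ = ≡.trans (K₁-term k) (≡.trans (e (geometric p⁻¹ k) (pow p⁻¹ (suc k)))
      (≡.sym (cong₂ _+_ (k-term (suc k)) (geometric-suc p⁻¹ k))))
      where
      e : ∀ g q → 1ℚ + g ≡ (1ℚ - q) + (g + q)
      e = solve-∀ ringℚ

    K₁-term* : ∀ {k} → 1 ℕ.≤ k → p⁻¹ * ((p ℕ.^ k ℕ.∸ 1) ⁄ (p ℕ.^ k ℕ.∸ p ℕ.^ (k ℕ.∸ 1))) ≡ geometric p⁻¹ k
    K₁-term* {suc k} _ = cong (p⁻¹ *_) (K₁-term k)

  -- The difference of K₁* and k*, by `K₁*≡k*+Γ`.
  Γ : ∀ {n} → Vector ℕ n → Exponents n → ℚ
  Γ p = fold₂ _+_ 0ℚ (λ i k → geometric (1 ⁄ p i) k)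

  K₁*≡k*+Γ : ∀ {n} (p : Vector ℕ n) (e : Exponents n) → (∀ i → 1 ℕ.< p i) → (∀ i → All (1 ℕ.≤_) (e i)) →
    K₁* p e ≡ k* p e + Γ p e
  K₁*≡k*+Γ {zero}  p e 1<p 1≤e = refl
  K₁*≡k*+Γ {suc n} p e 1<p 1≤e = ≡.trans
    (cong₂ _+_ (row (1≤e zero)) (K₁*≡k*+Γ (p ∘ suc) (e ∘ suc) (1<p ∘ suc) (1≤e ∘ suc)))
    (swap (k₀ (e zero)) (Γ₀ (e zero)) (k* (p ∘ suc) (e ∘ suc)) (Γ (p ∘ suc) (e ∘ suc)))
    where
    swap : ∀ a b c d → (a + b) + (c + d) ≡ (a + c) + (b + d)
    swap = solve-∀ ringℚ
    p₀ = p zero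
    K = λ k → (p₀ ℕ.^ k ℕ.∸ 1) ⁄ (p₀ ℕ.^ k ℕ.∸ p₀ ℕ.^ (k ℕ.∸ 1))
    k′ = λ k → (p₀ ℕ.^ k ℕ.∸ 1) ⁄ (p₀ ℕ.^ k)
    k₀ Γ₀ : List ℕ → ℚ
    k₀ ks = List.foldr _+_ 0ℚ (List.map k′ ks)
    Γ₀ ks = List.foldr _+_ 0ℚ (List.map (geometric (1 ⁄ p₀)) ks)
    row : ∀ {ks} → All (1 ℕ.≤_) ks → List.foldr _+_ 0ℚ (List.map K ks) ≡ k₀ ks + Γ₀ ks
    row [] = refl
    row {k ∷ ks} (1≤k ∷ 1≤ks) = ≡.trans (cong₂ _+_ (K₁-term≡ (1<p zero) 1≤k) (row 1≤ks)) (swap (k′ k) (geometric (1 ⁄ p₀) k) (k₀ ks) (Γ₀ ks))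

  -- So the term of (*) for p₁ has the same shape as the later ones, with p₁ instead of c p₁.
  1⁄p*K₁* : ∀ {p} → 1 ℕ.< p → ∀ {ks} → All (1 ℕ.≤_) ks →
    1 ⁄ p * K₁* {1} (λ _ → p) (λ _ → ks) ≡ List.foldr _+_ 0ℚ (List.map (geometric (1 ⁄ p)) ks)
  1⁄p*K₁* {p} 1<p all = ≡.trans (cong (1 ⁄ p *_) (ℚₚ.+-identityʳ _)) (row all)
    where
    K = λ k → (p ℕ.^ k ℕ.∸ 1) ⁄ (p ℕ.^ k ℕ.∸ p ℕ.^ (k ℕ.∸ 1))
    row : ∀ {ks} → All (1 ℕ.≤_) ks →
      1 ⁄ p * List.foldr _+_ 0ℚ (List.map K ks) ≡ List.foldr _+_ 0ℚ (List.map (geometric (1 ⁄ p)) ks)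
    row [] = ℚₚ.*-zeroʳ (1 ⁄ p)
    row {k ∷ ks} (1≤k ∷ 1≤ks) = ≡.trans (ℚₚ.*-distribˡ-+ (1 ⁄ p) (K k) _) (cong₂ _+_ (K₁-term* 1<p 1≤k) (row 1≤ks))

open Fractions

-- Estimates for cuts

module Cuts where
  open import Data.Integer.Base as ℤ using (ℤ; +_; -[1+_])
  import Data.Integer.Properties as ℤₚ
  open import Data.List.Base as List using (List; []; _∷_)
  open import Data.List.Relation.Unary.All using (All; []; _∷_)
  open import Data.Nat.Coprimality using (1-coprimeTo) renaming (sym to coprime-sym)
  open import Data.Rational.Base as ℚ using (ℚ; mkℚ; 0ℚ; 1ℚ; _+_; _*_; _-_; -_; _≤_; _<_; *≤*)
  import Data.Rational.Properties as ℚₚ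
  open import Data.Vec.Functional using (tail)
  open import Function.Bundles using (Equivalence)
  open import Tactic.RingSolver using (solve-∀)

  private
    variable
      X Y : Cut

  x<x+1 : ∀ x → x < x + 1ℚ
  x<x+1 x = ≡.subst (_< x + 1ℚ) (ℚₚ.+-identityʳ x) (ℚₚ.+-monoʳ-< x 0<1)

  inv-cancel : ∀ x a → 0ℚ < a → (x * inv a) * a ≡ x
  inv-cancel x a 0<a = ≡.trans (ℚₚ.*-assoc x (inv a) a) (≡.trans (cong (x *_) (inv-* 0<a)) (ℚₚ.*-identityʳ x))

  <*⇒/< : ∀ x y a → 0ℚ < a → x < y * a → x * inv a < y
  <*⇒/< x y a 0<a x<ya = ℚₚ.*-cancelʳ-<-nonNeg a {{ℚ.nonNegative (ℚₚ.<⇒≤ 0<a)}}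
    (≡.subst (_< y * a) (≡.sym (inv-cancel x a 0<a)) x<ya)

  /<⇒<* : ∀ x y a → 0ℚ < a → x * inv a < y → x < y * a
  /<⇒<* x y a 0<a x/a<y = ≡.subst (_< y * a) (inv-cancel x a 0<a) (*-monoʳ-< a 0<a x/a<y)

  0<inv : ∀ {a} → 0ℚ < a → 0ℚ < inv a
  0<inv {a} 0<a = ℚₚ.*-cancelʳ-<-nonNeg a {{ℚ.nonNegative (ℚₚ.<⇒≤ 0<a)}}
    (≡.subst₂ _<_ (≡.sym (ℚₚ.*-zeroˡ a)) (≡.sym (inv-* 0<a)) 0<1)

  -- For q ≥ 0, `u` is chosen between q / a and b, and then `s` between q / u and a.
  below-product : ∀ a b q → 0ℚ < a → 0ℚ < b → q < a * b →
    ∃ λ s → ∃ λ u → 0ℚ < s × s < a × 0ℚ < u × u < b × q < s * u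
  below-product a b q 0<a 0<b q<ab with ℚₚ.≤-total q 0ℚ
  ... | inj₁ q≤0 = let s , 0<s , s<a = ℚₚ.<-dense 0<a ; u , 0<u , u<b = ℚₚ.<-dense 0<b in
    s , u , 0<s , s<a , 0<u , u<b , ℚₚ.≤-<-trans q≤0 (0<* 0<s 0<u)
  ... | inj₂ 0≤q =
    let u , q/a<u , u<b = ℚₚ.<-dense (<*⇒/< q b a 0<a (≡.subst (q <_) (ℚₚ.*-comm a b) q<ab))
        0<u = ℚₚ.≤-<-trans (0≤* 0≤q (ℚₚ.<⇒≤ (0<inv 0<a))) q/a<u
        q<au = ≡.subst (q <_) (ℚₚ.*-comm u a) (/<⇒<* q u a 0<a q/a<u)
        s , q/u<s , s<a = ℚₚ.<-dense (<*⇒/< q a u 0<u q<au)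
    in s , u , ℚₚ.≤-<-trans (0≤* 0≤q (ℚₚ.<⇒≤ (0<inv 0<u))) q/u<s , s<a , 0<u , u<b , /<⇒<* q s u 0<u q/u<s

  -- The field `below` alone says a ≤ X; `above` is carried along because interval multiplication
  -- asks for upper ends of both factors.
  record AtLeast (X : Cut) (a : ℚ) : Set where
    field
      below : ∀ {q} → q < a → L X q
      above : ∃ λ t → a < t × U X t

  open AtLeast

  atLeast-fromℚ : ∀ a → AtLeast (fromℚ a) a
  atLeast-fromℚ a = record { below = id ; above = a + 1ℚ , x<x+1 a , x<x+1 a }

  atLeast-mono : ∀ {a b} → a ≤ b → AtLeast X b → AtLeast X a
  atLeast-mono a≤b A = record
    { below = λ q<a → below A (ℚₚ.<-≤-trans q<a a≤b)
    ; above = let t , b<t , Ut = above A in t , ℚₚ.≤-<-trans a≤b b<t , Ut }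

  -- With positive ends, `s * u` is the least of the four corner products and `t * v` the greatest.
  atLeast-* : ∀ {a b} → 0ℚ < a → 0ℚ < b → AtLeast X a → AtLeast Y b → AtLeast (X *ᴿ Y) (a * b)
  atLeast-* {a = a} {b} 0<a 0<b A B =
    let t , a<t , Ut = above A ; v , b<v , Uv = above B
        0<t = ℚₚ.<-trans 0<a a<t ; 0<v = ℚₚ.<-trans 0<b b<v
    in record
    { below = λ {q} q<ab →
        let s , u , 0<s , s<a , 0<u , u<b , q<su = below-product a b q 0<a 0<b q<ab
            s≤t = ℚₚ.<⇒≤ (ℚₚ.<-trans s<a a<t) ; u≤v = ℚₚ.<⇒≤ (ℚₚ.<-trans u<b b<v)
            0≤s = ℚₚ.<⇒≤ 0<s ; 0≤u = ℚₚ.<⇒≤ 0<u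
        in s , t , u , v , below A s<a , Ut , below B u<b , Uv , q<su ,
           ℚₚ.<-≤-trans q<su (*-mono-≤ 0≤s ℚₚ.≤-refl 0≤u u≤v) ,
           ℚₚ.<-≤-trans q<su (*-mono-≤ 0≤s s≤t 0≤u ℚₚ.≤-refl) ,
           ℚₚ.<-≤-trans q<su (*-mono-≤ 0≤s s≤t 0≤u u≤v)
    ; above =
        let s , u , 0<s , s<a , 0<u , u<b , _ = below-product a b 0ℚ 0<a 0<b (0<* 0<a 0<b)
            s≤t = ℚₚ.<⇒≤ (ℚₚ.<-trans s<a a<t) ; u≤v = ℚₚ.<⇒≤ (ℚₚ.<-trans u<b b<v)
            0≤s = ℚₚ.<⇒≤ 0<s ; 0≤u = ℚₚ.<⇒≤ 0<u ; 0≤v = ℚₚ.<⇒≤ 0<v ; 0≤t = ℚₚ.<⇒≤ 0<t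
            tv< = x<x+1 (t * v)
        in t * v + 1ℚ ,
           ℚₚ.≤-<-trans (*-mono-≤ (ℚₚ.<⇒≤ 0<a) (ℚₚ.<⇒≤ a<t) (ℚₚ.<⇒≤ 0<b) (ℚₚ.<⇒≤ b<v)) tv< ,
           s , t , u , v , below A s<a , Ut , below B u<b , Uv ,
           ℚₚ.≤-<-trans (*-mono-≤ 0≤s s≤t 0≤u u≤v) tv< ,
           ℚₚ.≤-<-trans (*-mono-≤ 0≤s s≤t 0≤v ℚₚ.≤-refl) tv< ,
           ℚₚ.≤-<-trans (*-mono-≤ 0≤t ℚₚ.≤-refl 0≤u u≤v) tv< , tv<
    }

  atLeast-^ : ∀ {a} → 0ℚ < a → AtLeast X a → ∀ n → AtLeast (X ^ᴿ n) (pow a n)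
  atLeast-^ 0<a A zero    = atLeast-fromℚ 1ℚ
  atLeast-^ 0<a A (suc n) = atLeast-* 0<a (0<pow 0<a n) A (atLeast-^ 0<a A n)

  atLeast-recip : ∀ {a} → 0ℚ < a → AtLeast (recip (fromℚ a)) (inv a)
  atLeast-recip {a} 0<a = record { below = below′ _ ; above = above′ }
    where
    below′ : ∀ q → q < inv a → L (recip (fromℚ a)) q
    below′ q q<1/a with ℚₚ.≤-total q 0ℚ | q ℚₚ.≟ 0ℚ
    ... | inj₁ q≤0 | _ = a + 1ℚ , x<x+1 a , ℚₚ.≤-<-trans
      (≡.subst (q * (a + 1ℚ) ≤_) (ℚₚ.*-zeroˡ (a + 1ℚ)) (*-monoʳ-≤ (a + 1ℚ) (ℚₚ.<⇒≤ (ℚₚ.<-trans 0<a (x<x+1 a))) q≤0)) 0<1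
    ... | inj₂ 0≤q | yes refl = a + 1ℚ , x<x+1 a , ≡.subst (_< 1ℚ) (≡.sym (ℚₚ.*-zeroˡ (a + 1ℚ))) 0<1
    ... | inj₂ 0≤q | no q≢0 =
      let 0<q = ℚₚ.≰⇒> (λ q≤0 → q≢0 (ℚₚ.≤-antisym q≤0 0≤q))
          qa<1 = ≡.subst (q * a <_) (inv-* 0<a) (*-monoʳ-< {q} {inv a} a 0<a q<1/a)
          a<1/q = ℚₚ.*-cancelʳ-<-nonNeg q {{ℚ.nonNegative 0≤q}}
                    (≡.subst₂ _<_ (ℚₚ.*-comm q a) (≡.sym (inv-* {q} 0<q)) qa<1)
          s , a<s , s<1/q = ℚₚ.<-dense a<1/q
      in s , a<s , ≡.subst₂ _<_ (ℚₚ.*-comm s q) (inv-* {q} 0<q) (*-monoʳ-< {s} {inv q} q 0<q s<1/q)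
    above′ : ∃ λ t → inv a < t × U (recip (fromℚ a)) t
    above′ =
      let t = inv a + 1ℚ
          1<ta = ≡.subst (_< t * a) (inv-* 0<a) (*-monoʳ-< a 0<a (x<x+1 (inv a)))
          s , u , 0<s , s<t , 0<u , u<a , 1<su = below-product t a 1ℚ (ℚₚ.<-trans (0<inv 0<a) (x<x+1 (inv a))) 0<a 1<ta
      in t , x<x+1 (inv a) , u , 0<u , u<a , ℚₚ.<-trans 1<su (*-monoʳ-< u 0<u s<t)

  archimedean : ∀ q → ∃ λ n → q < ι n
  archimedean q@(mkℚ n d _) = suc ℤ.∣ n ∣ , ℚₚ.≤-<-trans q≤ (ι-mono-< (ℕₚ.n<1+n ℤ.∣ n ∣))
    where
    q≤ : q ≤ ι ℤ.∣ n ∣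
    q≤ = ≡.subst (q ≤_) (≡.sym (ι≡mkℚ ℤ.∣ n ∣)) (*≤* (ℤₚ.≤-trans (ℤₚ.≤-reflexive (ℤₚ.*-identityʳ n))
      (ℤₚ.≤-trans (n≤∣n∣ n) (≡.subst (+ ℤ.∣ n ∣ ℤ.≤_) (ℤₚ.pos-* ℤ.∣ n ∣ (suc d)) (ℤ.+≤+ (ℕₚ.m≤m*n ℤ.∣ n ∣ (suc d)))))))
      where
      n≤∣n∣ : ∀ n → n ℤ.≤ + ℤ.∣ n ∣
      n≤∣n∣ (+ _)    = ℤₚ.≤-refl
      n≤∣n∣ -[1+ _ ] = ℤ.-≤+

  n<2^n : ∀ n → n ℕ.< 2 ℕ.^ n
  n<2^n zero    = s≤s z≤n
  n<2^n (suc n) = ℕₚ.≤-trans (ℕₚ.+-mono-≤ (ℕₚ.m^n>0 2 n) (n<2^n n))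
    (ℕₚ.≤-reflexive (cong (2 ℕ.^ n ℕ.+_) (≡.sym (ℕₚ.+-identityʳ (2 ℕ.^ n)))))

  large-power : ∀ M u → ∃ λ T → M ℕ.< T × u < ι (2 ℕ.^ T)
  large-power M u = let K , u<K = archimedean u in
    suc M ℕ.+ K , ℕₚ.m≤m+n (suc M) K ,
    ℚₚ.<-trans u<K (ι-mono-< {K} (ℕₚ.≤-<-trans (ℕₚ.m≤n+m K (suc M)) (n<2^n (suc M ℕ.+ K))))

  -- If q = n / d lies below M then n < M d, so 2^n < 2^(M d) ≤ X^d.
  atLeast-log₂ : ∀ {M} → 1 ℕ.≤ M → AtLeast X (ι (2 ℕ.^ M)) → AtLeast (log₂ X) (ι M)
  atLeast-log₂ {X} {M} 1≤M A = record { below = below′ _ ; above = above′ }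
    where
    0<2^M : 0ℚ < ι (2 ℕ.^ M)
    0<2^M = 0<ι (ℕₚ.m^n>0 2 M)
    A^ : ∀ d → AtLeast (X ^ᴿ d) (ι (2 ℕ.^ (M ℕ.* d)))
    A^ d = ≡.subst (AtLeast (X ^ᴿ d)) (≡.trans (≡.sym (ι-^ (2 ℕ.^ M) d)) (cong ι (ℕₚ.^-*-assoc 2 M d))) (atLeast-^ 0<2^M A d)
    below′ : ∀ q → q < ι M → L (log₂ X) q
    below′ q@(mkℚ n d-1 _) q<M = below (A^ (suc d-1)) (2^n< n n<Md)
      where
      n<Md : n ℤ.< + (M ℕ.* suc d-1)
      n<Md = ≡.subst₂ ℤ._<_ (ℤₚ.*-identityʳ n) (≡.sym (ℤₚ.pos-* M (suc d-1)))
        (ℚₚ.drop-*<* (≡.subst (q <_) (ι≡mkℚ M) q<M))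
      2^n< : ∀ n → n ℤ.< + (M ℕ.* suc d-1) → 2^ n < ι (2 ℕ.^ (M ℕ.* suc d-1))
      2^n< (+ n)    n< = ι-mono-< (ℕₚ.^-monoʳ-< 2 (s≤s (s≤s z≤n)) (ℤₚ.drop‿+<+ n<))
      -- A negative power of 2 is at most 1, and 1 < 2^(M d) because `1 ≤ M`.
      2^n< -[1+ n ] _  = ℚₚ.≤-<-trans (1⁄-anti {1} {2 ℕ.^ suc n} (s≤s z≤n) (ℕₚ.m^n>0 2 (suc n)))
        (ι-mono-< {1} (ℕₚ.^-monoʳ-< 2 (s≤s (s≤s z≤n)) {0} {M ℕ.* suc d-1} (ℕₚ.*-mono-≤ 1≤M (s≤s (z≤n {d-1})))))
    above′ : ∃ λ t → ι M < t × U (log₂ X) t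
    above′ =
      let u , _ , s , t , u′ , v , Ls , Ut , Lu , Uv , b₁ , b₂ , b₃ , b₄ = above (atLeast-^ 0<2^M A 1)
          T , M<T , u< = large-power M u
      -- An integer `T` with 2^T above an upper bound of X; the constructor form makes the numerator
      -- and denominator in `log₂` compute.
      in mkℚ (+ T) 0 (coprime-sym (1-coprimeTo T)) , ≡.subst (ι M <_) (ι≡mkℚ T) (ι-mono-< M<T) ,
         s , t , u′ , v , Ls , Ut , Lu , Uv , ℚₚ.<-trans b₁ u< , ℚₚ.<-trans b₂ u< , ℚₚ.<-trans b₃ u< , ℚₚ.<-trans b₄ u<

  pow-mono-≤ : ∀ {x y} → 0ℚ ≤ x → x ≤ y → ∀ n → pow x n ≤ pow y n
  pow-mono-≤ 0≤x x≤y zero    = ℚₚ.≤-refl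
  pow-mono-≤ {x} 0≤x x≤y (suc n) = *-mono-≤ 0≤x x≤y (0≤pow n) (pow-mono-≤ 0≤x x≤y n)
    where
    0≤pow : ∀ n → 0ℚ ≤ pow x n
    0≤pow zero    = ℚₚ.<⇒≤ 0<1
    0≤pow (suc n) = 0≤* 0≤x (0≤pow n)

  pow-* : ∀ x y n → pow (x * y) n ≡ pow x n * pow y n
  pow-* x y zero    = refl
  pow-* x y (suc n) = ≡.trans (cong ((x * y) *_) (pow-* x y n)) (e x y (pow x n) (pow y n))
    where
    e : ∀ a b c d → (a * b) * (c * d) ≡ (a * c) * (b * d)
    e = solve-∀ ringℚ

  0≤ι : ∀ n → 0ℚ ≤ ι n
  0≤ι n = ι-mono-≤ {0} {n} z≤n

  row-≤-pow : ∀ {p x} → ι p ≤ x → ∀ ks →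
    ι (List.foldr ℕ._*_ 1 (List.map (p ℕ.^_) ks)) ≤ pow x (List.foldr ℕ._+_ 0 (List.map (λ k → k) ks))
  row-≤-pow p≤x []       = ℚₚ.≤-refl
  row-≤-pow {p} {x} p≤x (k ∷ ks) = begin
    ι (p ℕ.^ k ℕ.* R)        ≡⟨ ι-* (p ℕ.^ k) R ⟩
    ι (p ℕ.^ k) * ι R
      ≤⟨ *-mono-≤ (0≤ι (p ℕ.^ k)) (≡.subst (_≤ pow x k) (≡.sym (ι-^ p k)) (pow-mono-≤ (0≤ι p) p≤x k)) (0≤ι R) (row-≤-pow p≤x ks) ⟩
    pow x k * pow x E        ≡⟨ pow-+ x k E ⟨
    pow x (k ℕ.+ E)          ∎
    where
    open ℚₚ.≤-Reasoning
    R = List.foldr ℕ._*_ 1 (List.map (p ℕ.^_) ks)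
    E = List.foldr ℕ._+_ 0 (List.map (λ k → k) ks)

  ∏-≤-pow : ∀ {n} (p : Vector ℕ n) (e : Exponents n) {x} → (∀ i → ι (p i) ≤ x) →
    ι (fold₂ ℕ._*_ 1 (λ i k → p i ℕ.^ k) e) ≤ pow x (fold₂ ℕ._+_ 0 (λ _ k → k) e)
  ∏-≤-pow {zero}  p e p≤x = ℚₚ.≤-refl
  ∏-≤-pow {suc n} p e {x} p≤x = begin
    ι (R ℕ.* R′)          ≡⟨ ι-* R R′ ⟩
    ι R * ι R′            ≤⟨ *-mono-≤ (0≤ι R) (row-≤-pow (p≤x zero) (e zero)) (0≤ι R′) (∏-≤-pow (p ∘ suc) (e ∘ suc) (p≤x ∘ suc)) ⟩
    pow x E * pow x E′    ≡⟨ pow-+ x E E′ ⟨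
    pow x (E ℕ.+ E′)      ∎
    where
    open ℚₚ.≤-Reasoning
    R = List.foldr ℕ._*_ 1 (List.map (p zero ℕ.^_) (e zero))
    R′ = fold₂ ℕ._*_ 1 (λ i k → p (suc i) ℕ.^ k) (e ∘ suc)
    E = List.foldr ℕ._+_ 0 (List.map (λ k → k) (e zero))
    E′ = fold₂ ℕ._+_ 0 (λ _ k → k) (e ∘ suc)

  -- A product is monotone in `f`, in a direction set by the sign of `y`, so one of the two ends
  -- bounds it.
  linear-below : ∀ {q s f t} y → s < f → f < t → q < s * y → q < t * y → q < f * y
  linear-below y s<f f<t q<sy q<ty with ℚₚ.≤-total 0ℚ y
  ... | inj₁ 0≤y = ℚₚ.<-≤-trans q<sy (*-monoʳ-≤ y 0≤y (ℚₚ.<⇒≤ s<f))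
  ... | inj₂ y≤0 = ℚₚ.<-≤-trans q<ty (ℚₚ.*-monoʳ-≤-nonPos y {{ℚ.nonPositive y≤0}} (ℚₚ.<⇒≤ f<t))

  linear-above : ∀ {q s f t} y → s < f → f < t → s * y < q → t * y < q → f * y < q
  linear-above y s<f f<t sy<q ty<q with ℚₚ.≤-total 0ℚ y
  ... | inj₁ 0≤y = ℚₚ.≤-<-trans (*-monoʳ-≤ y 0≤y (ℚₚ.<⇒≤ f<t)) ty<q
  ... | inj₂ y≤0 = ℚₚ.≤-<-trans (ℚₚ.*-monoʳ-≤-nonPos y {{ℚ.nonPositive y≤0}} (ℚₚ.<⇒≤ s<f)) sy<q

  -- The two sides of (*)

  module Bounds (c : Cut) (real : IsReal c) (c₀ : ℚ) (0<c₀ : 0ℚ < c₀) (Lc₀ : L c c₀)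
    (r : ℕ) (0<r : 0 ℕ.< r) {n} (p : Vector ℕ (suc n)) (e : Exponents (suc n))
    (1<p : ∀ i → 1 ℕ.< p i) (1≤e : ∀ i → All (1 ℕ.≤_) (e i))
    (1<c₀p₁ : 1ℚ < c₀ * ι (p zero)) (p≤c₀p₁ : ∀ i → ι (p (suc i)) ≤ c₀ * ι (p zero)) where

    open IsReal real

    private
      p₁ = p zero
      P = ι p₁
      0<p₁ : 0 ℕ.< p₁
      0<p₁ = ℕₚ.<-trans (s≤s z≤n) (1<p zero)
      0<P : 0ℚ < P
      0<P = 0<ι 0<p₁

    L-downward : ∀ {q s} → q < s → L c s → L c q
    L-downward q<s Ls = Equivalence.from (roundedᴸ _) (_ , q<s , Ls)

    U-upward : ∀ {q s} → q < s → U c q → U c s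
    U-upward q<s Uq = Equivalence.from (roundedᵁ _) (_ , q<s , Uq)

    L<U : ∀ {l u} → L c l → U c u → l < u
    L<U {l} {u} Ll Uu = ℚₚ.≰⇒> λ u≤l → disjoint l (Ll , U-≤ u≤l)
      where
      U-≤ : u ≤ l → U c l
      U-≤ u≤l with u ℚₚ.≟ l
      ... | yes refl = Uu
      ... | no  u≢l  = U-upward (ℚₚ.≰⇒> (λ l≤u → u≢l (ℚₚ.≤-antisym u≤l l≤u))) Uu

    -- As p_i ≤ c₀ p₁ for i ≥ 2, the order of C_r ⊕ G is at most the radicand with c₀ in place of c;
    -- so the radicand is at least 2^M.
    rhs-atLeast : ∀ {M} → 1 ℕ.≤ M →
      2 ℕ.^ M ℕ.≤ r ℕ.* fold₂ ℕ._*_ 1 (λ i k → p i ℕ.^ k) e →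
      ∀ {q} → q < ι M * inv P → L (rhs c r p e) q
    rhs-atLeast {M} 1≤M 2^M≤ = below (atLeast-* (0<ι 1≤M) (0<inv 0<P)
      (atLeast-log₂ 1≤M (atLeast-mono ι2^M≤ radicand)) (atLeast-recip 0<P))
      where
      E₁ = List.foldr ℕ._+_ 0 (List.map (λ k → k) (e zero))
      E = fold₂ ℕ._+_ 0 (λ _ k → k) (tail e)
      A = List.foldr ℕ._*_ 1 (List.map (p₁ ℕ.^_) (e zero))
      B = fold₂ ℕ._*_ 1 (λ i k → p (suc i) ℕ.^ k) (tail e)
      c≥c₀ : AtLeast c c₀
      c≥c₀ = record
        { below = λ q<c₀ → L-downward q<c₀ Lc₀
        ; above = let t , Ut = inhabitedᵁ in t , L<U Lc₀ Ut , Ut }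
      radicand : AtLeast (fromℕ r *ᴿ c ^ᴿ E *ᴿ fromℕ p₁ ^ᴿ (E₁ ℕ.+ E)) (ι r * pow c₀ E * pow P (E₁ ℕ.+ E))
      radicand = atLeast-* (0<* (0<ι 0<r) (0<pow 0<c₀ E)) (0<pow 0<P (E₁ ℕ.+ E))
        (atLeast-* (0<ι 0<r) (0<pow 0<c₀ E) (atLeast-fromℚ (ι r)) (atLeast-^ 0<c₀ c≥c₀ E))
        (atLeast-^ 0<P (atLeast-fromℚ P) (E₁ ℕ.+ E))
      ι2^M≤ : ι (2 ℕ.^ M) ≤ ι r * pow c₀ E * pow P (E₁ ℕ.+ E)
      ι2^M≤ = begin
        ι (2 ℕ.^ M)                                    ≤⟨ ι-mono-≤ 2^M≤ ⟩
        ι (r ℕ.* (A ℕ.* B))                            ≡⟨ ≡.trans (ι-* r (A ℕ.* B)) (cong (ι r *_) (ι-* A B)) ⟩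
        ι r * (ι A * ι B)
          ≤⟨ *-monoˡ-≤ (ι r) (0≤ι r) (*-mono-≤ (0≤ι A) (row-≤-pow ℚₚ.≤-refl (e zero)) (0≤ι B) (∏-≤-pow (p ∘ suc) (tail e) p≤c₀p₁)) ⟩
        ι r * (pow P E₁ * pow (c₀ * P) E)              ≡⟨ cong (λ z → ι r * (pow P E₁ * z)) (pow-* c₀ P E) ⟩
        ι r * (pow P E₁ * (pow c₀ E * pow P E))        ≡⟨ rearrange (ι r) (pow P E₁) (pow c₀ E) (pow P E) ⟩
        ι r * pow c₀ E * (pow P E₁ * pow P E)          ≡⟨ cong (ι r * pow c₀ E *_) (pow-+ P E₁ E) ⟨
        ι r * pow c₀ E * pow P (E₁ ℕ.+ E)              ∎
        where
        open ℚₚ.≤-Reasoning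
        rearrange : ∀ a b c d → a * (b * (c * d)) ≡ a * c * (b * d)
        rearrange = solve-∀ ringℚ

    -- `P` holds at all rationals of some interval around c. Such properties form a filter, and
    -- `near⇒∃` makes it proper.
    Near : (ℚ → Set) → Set
    Near P = ∃ λ l → ∃ λ u → L c l × U c u × (∀ z → l < z → z < u → P z)

    near-map : {P Q : ℚ → Set} → (∀ z → P z → Q z) → Near P → Near Q
    near-map f (l , u , Ll , Uu , near) = l , u , Ll , Uu , λ z l<z z<u → f z (near z l<z z<u)

    near-× : {P Q : ℚ → Set} → Near P → Near Q → Near (λ z → P z × Q z)
    near-× {P} {Q} (l , u , Ll , Uu , nearP) (l′ , u′ , Ll′ , Uu′ , nearQ) with ℚₚ.≤-total l l′ | ℚₚ.≤-total u u′
    ... | inj₁ l≤l′ | inj₁ u≤u′ = l′ , u , Ll′ , Uu , λ z a b → nearP z (ℚₚ.≤-<-trans l≤l′ a) b , nearQ z a (ℚₚ.<-≤-trans b u≤u′)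
    ... | inj₁ l≤l′ | inj₂ u′≤u = l′ , u′ , Ll′ , Uu′ , λ z a b → nearP z (ℚₚ.≤-<-trans l≤l′ a) (ℚₚ.<-≤-trans b u′≤u) , nearQ z a b
    ... | inj₂ l′≤l | inj₁ u≤u′ = l , u , Ll , Uu , λ z a b → nearP z a b , nearQ z (ℚₚ.≤-<-trans l′≤l a) (ℚₚ.<-≤-trans b u≤u′)
    ... | inj₂ l′≤l | inj₂ u′≤u = l , u′ , Ll , Uu′ , λ z a b → nearP z a (ℚₚ.<-≤-trans b u′≤u) , nearQ z (ℚₚ.≤-<-trans l′≤l a) b

    near⇒∃ : {P : ℚ → Set} → Near P → ∃ P
    near⇒∃ (l , u , Ll , Uu , near) = let z , l<z , z<u = ℚₚ.<-dense (L<U Ll Uu) in z , near z l<z z<u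

    near-pure : {P : ℚ → Set} → (∀ z → P z) → Near P
    near-pure f = let l , Ll = inhabitedᴸ ; u , Uu = inhabitedᵁ in l , u , Ll , Uu , λ z _ _ → f z

    near-> : Near (c₀ <_)
    near-> = let u , Uu = inhabitedᵁ in c₀ , u , Lc₀ , Uu , λ _ c₀<z _ → c₀<z

    -- F describes the cut X as a function of c.  No continuity of F is needed:
    -- the witnesses in the definitions of the operations on cuts already say
    -- how close to c the argument of F has to be.
    Below Above : Cut → (ℚ → ℚ) → Set
    Below X F = ∀ {q} → L X q → Near (λ z → q < F z)
    Above X F = ∀ {q} → U X q → Near (λ z → F z < q)

    Sound : Cut → (ℚ → ℚ) → Set
    Sound X F = Below X F × Above X F

    sound-c : Sound c id
    sound-c = (λ {q} Lq → q , proj₁ inhabitedᵁ , Lq , proj₂ inhabitedᵁ , λ _ q<z _ → q<z)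
            , (λ {q} Uq → proj₁ inhabitedᴸ , q , proj₂ inhabitedᴸ , Uq , λ _ _ z<q → z<q)

    sound-fromℚ : ∀ a → Sound (fromℚ a) (λ _ → a)
    sound-fromℚ a = (λ q<a → near-pure λ _ → q<a) , (λ a<q → near-pure λ _ → a<q)

    below-+ : ∀ X Y {F G} → Below X F → Below Y G → Below (X +ᴿ Y) (λ z → F z + G z)
    below-+ X Y BX BY (s , t , Ls , Lt , q<s+t) = near-map
      (λ z (s<F , t<G) → ℚₚ.<-trans q<s+t (ℚₚ.+-mono-< s<F t<G)) (near-× (BX Ls) (BY Lt))

    above-+ : ∀ X Y {F G} → Above X F → Above Y G → Above (X +ᴿ Y) (λ z → F z + G z)
    above-+ X Y AX AY (s , t , Us , Ut , s+t<q) = near-map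
      (λ z (F<s , G<t) → ℚₚ.<-trans (ℚₚ.+-mono-< F<s G<t) s+t<q) (near-× (AX Us) (AY Ut))

    sound-neg : ∀ {F} → Sound X F → Sound (-ᴿ X) (λ z → - F z)
    sound-neg {F = F} (BX , AX) =
      (λ {q} Uq → near-map (λ z F<-q → ≡.subst (_< - F z) (neg-neg q) (ℚₚ.neg-antimono-< F<-q)) (AX Uq)) ,
      (λ {q} Lq → near-map (λ z -q<F → ≡.subst (- F z <_) (neg-neg q) (ℚₚ.neg-antimono-< -q<F)) (BX Lq))
      where
      neg-neg : ∀ q → - (- q) ≡ q
      neg-neg = solve-∀ ringℚ

    sound-- : ∀ {F G} → Sound X F → Sound Y G → Sound (X -ᴿ Y) (λ z → F z - G z)
    sound-- {X = X} {Y} {F} {G} SX SY = let SY′ = sound-neg SY in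
      below-+ X (-ᴿ Y) {F = F} {G = λ z → - G z} (proj₁ SX) (proj₁ SY′) , above-+ X (-ᴿ Y) {F = F} {G = λ z → - G z} (proj₂ SX) (proj₂ SY′)

    -- The product is linear in each factor: the corners bound `F z * u` and `F z * v`, and these
    -- bound `F z * G z`.
    sound-* : ∀ {F G} → Sound X F → Sound Y G → Sound (X *ᴿ Y) (λ z → F z * G z)
    sound-* {F = F} {G} (BX , AX) (BY , AY) =
      (λ {q} (s , t , u , v , Ls , Ut , Lu , Uv , q<su , q<sv , q<tu , q<tv) →
        near-map (λ z ((s<F , F<t) , (u<G , G<v)) →
          ≡.subst (q <_) (ℚₚ.*-comm (G z) (F z)) (linear-below (F z) u<G G<v
            (≡.subst (q <_) (ℚₚ.*-comm (F z) u) (linear-below u s<F F<t q<su q<tu))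
            (≡.subst (q <_) (ℚₚ.*-comm (F z) v) (linear-below v s<F F<t q<sv q<tv))))
          (near-× (near-× (BX Ls) (AX Ut)) (near-× (BY Lu) (AY Uv)))) ,
      (λ {q} (s , t , u , v , Ls , Ut , Lu , Uv , su<q , sv<q , tu<q , tv<q) →
        near-map (λ z ((s<F , F<t) , (u<G , G<v)) →
          ≡.subst (_< q) (ℚₚ.*-comm (G z) (F z)) (linear-above (F z) u<G G<v
            (≡.subst (_< q) (ℚₚ.*-comm (F z) u) (linear-above u s<F F<t su<q tu<q))
            (≡.subst (_< q) (ℚₚ.*-comm (F z) v) (linear-above v s<F F<t sv<q tv<q))))
          (near-× (near-× (BX Ls) (AX Ut)) (near-× (BY Lu) (AY Uv))))

    sound-^ : ∀ {F} → Sound X F → ∀ n → Sound (X ^ᴿ n) (λ z → pow (F z) n)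
    sound-^ SX zero    = sound-fromℚ 1ℚ
    sound-^ {F = F} SX (suc n) = sound-* {F = F} {G = λ z → pow (F z) n} SX (sound-^ {F = F} SX n)

    -- The cut `recip X` describes a reciprocal only for positive values, hence the first
    -- hypothesis.
    sound-recip : ∀ {F} → Near (λ z → 0ℚ < F z) → Sound X F → Sound (recip X) (λ z → inv (F z))
    sound-recip {F = F} pos (BX , AX) =
      (λ {q} (s , Us , qs<1) → near-map (λ z (0<F , F<s) → below′ q (F z) s 0<F F<s qs<1) (near-× pos (AX Us))) ,
      (λ {q} (s , 0<s , Ls , 1<qs) → near-map (λ z (0<F , s<F) → above′ q (F z) s 0<F 0<s s<F 1<qs) (near-× pos (BX Ls)))
      where
      below′ : ∀ q f s → 0ℚ < f → f < s → q * s < 1ℚ → q < inv f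
      below′ q f s 0<f f<s qs<1 with ℚₚ.≤-total q 0ℚ
      ... | inj₁ q≤0 = ℚₚ.≤-<-trans q≤0 (0<inv 0<f)
      ... | inj₂ 0≤q = ℚₚ.*-cancelʳ-<-nonNeg f {{ℚ.nonNegative (ℚₚ.<⇒≤ 0<f)}} (≡.subst (q * f <_) (≡.sym (inv-* 0<f))
        (ℚₚ.≤-<-trans (*-monoˡ-≤ q 0≤q (ℚₚ.<⇒≤ f<s)) qs<1))
      above′ : ∀ q f s → 0ℚ < f → 0ℚ < s → s < f → 1ℚ < q * s → inv f < q
      above′ q f s 0<f 0<s s<f 1<qs = ℚₚ.*-cancelʳ-<-nonNeg f {{ℚ.nonNegative (ℚₚ.<⇒≤ 0<f)}}
        (≡.subst (_< q * f) (≡.sym (inv-* 0<f)) (ℚₚ.<-≤-trans 1<qs (*-monoˡ-≤ q (ℚₚ.<⇒≤ 0<q) (ℚₚ.<⇒≤ s<f))))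
        where
        0<q : 0ℚ < q
        0<q = ℚₚ.*-cancelʳ-<-nonNeg s {{ℚ.nonNegative (ℚₚ.<⇒≤ 0<s)}}
          (≡.subst (_< q * s) (≡.sym (ℚₚ.*-zeroˡ s)) (ℚₚ.<-trans 0<1 1<qs))

    private
      cp₁ : Cut
      cp₁ = c *ᴿ fromℕ p₁

      termᴿ : ℕ → Cut
      termᴿ k = (cp₁ ^ᴿ k -ᴿ fromℕ 1) /ᴿ (cp₁ ^ᴿ (k ℕ.+ 1) -ᴿ cp₁ ^ᴿ k)

      rowᴿ : List ℕ → Cut
      rowᴿ ks = List.foldr _+ᴿ_ (fromℕ 0) (List.map termᴿ ks)

      sumᴿ : ∀ {m} → Exponents m → Cut
      sumᴿ = fold₂ _+ᴿ_ (fromℕ 0) (λ _ k → termᴿ k)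

      term : ℕ → ℚ → ℚ
      term k z = (pow (z * P) k - 1ℚ) * inv (pow (z * P) (k ℕ.+ 1) - pow (z * P) k)

      c₀P<zP : ∀ {z} → c₀ < z → c₀ * P < z * P
      c₀P<zP = *-monoʳ-< P 0<P

      1<zP : ∀ {z} → c₀ < z → 1ℚ < z * P
      1<zP c₀<z = ℚₚ.<-trans 1<c₀p₁ (c₀P<zP c₀<z)

      0<denominator : ∀ k x → 1ℚ < x → 0ℚ < pow x (k ℕ.+ 1) - pow x k
      0<denominator k x 1<x = ≡.subst (λ j → 0ℚ < pow x j - pow x k) (ℕₚ.+-comm 1 k) (0<pow-suc∸pow 1<x k)

      sound-term : ∀ k → Sound (termᴿ k) (term k)
      sound-term k = sound-*
        {F = λ z → pow (z * P) k - 1ℚ} {G = λ z → inv (pow (z * P) (k ℕ.+ 1) - pow (z * P) k)}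
        (sound-- {F = x^ k} {G = λ _ → 1ℚ} (power k) (sound-fromℚ 1ℚ))
        (sound-recip {F = λ z → pow (z * P) (k ℕ.+ 1) - pow (z * P) k}
          (near-map (λ z c₀<z → 0<denominator k (z * P) (1<zP c₀<z)) near->)
          (sound-- {F = x^ (k ℕ.+ 1)} {G = x^ k} (power (k ℕ.+ 1)) (power k)))
        where
        x^ : ℕ → ℚ → ℚ
        x^ k z = pow (z * P) k
        power : ∀ k → Sound (cp₁ ^ᴿ k) (x^ k)
        power = sound-^ {F = λ z → z * P} (sound-* {F = id} {G = λ _ → P} sound-c (sound-fromℚ P))

      -- The left side is 1/x + ... + 1/x^k for x = z p₁, and x exceeds c₀ p₁ ≥ m.
      term-≤ : ∀ k {z m} → c₀ < z → 1 ℕ.< m → ι m ≤ c₀ * P → term k z ≤ geometric (1 ⁄ m) k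
      term-≤ k {z} {m} c₀<z 1<m m≤ = begin
        (pow x k - 1ℚ) * inv d            ≡⟨ cong (_* inv d) numerator ⟨
        (geometric (inv x) k * d) * inv d ≡⟨ ℚₚ.*-assoc (geometric (inv x) k) d (inv d) ⟩
        geometric (inv x) k * (d * inv d) ≡⟨ cong (geometric (inv x) k *_) (≡.trans (ℚₚ.*-comm d (inv d)) (inv-* 0<d)) ⟩
        geometric (inv x) k * 1ℚ          ≡⟨ ℚₚ.*-identityʳ _ ⟩
        geometric (inv x) k               ≤⟨ geometric-mono (ℚₚ.<⇒≤ (0<inv 0<x)) inv≤ k ⟩
        geometric (1 ⁄ m) k               ∎
        where
        open ℚₚ.≤-Reasoning
        x = z * P
        d = pow x (k ℕ.+ 1) - pow x k
        0<x = ℚₚ.<-trans 0<1 (1<zP c₀<z)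
        0<d = 0<denominator k x (1<zP c₀<z)
        numerator : geometric (inv x) k * d ≡ pow x k - 1ℚ
        numerator = ≡.trans (cong (λ j → geometric (inv x) k * (pow x j - pow x k)) (ℕₚ.+-comm k 1))
          (geometric-* (inv x) x (inv-* 0<x) k)
        0<m = ℕₚ.<-trans (s≤s z≤n) 1<m
        inv≤ : inv x ≤ 1 ⁄ m
        inv≤ = inverse-anti (1 ⁄ m) (ι m) (inv x) x (⁄-* 1 0<m) (inv-* 0<x) (0<ι 0<m) (ℚₚ.≤-trans m≤ (ℚₚ.<⇒≤ (c₀P<zP c₀<z)))

      -- The summands vary with c, but at every argument above `c₀` they are at most those of the
      -- p_i, so a constant function bounds the sum.
      below-fold : ∀ {m} (p′ : Vector ℕ m) (e′ : Exponents m) → (∀ i → 1 ℕ.< p′ i) → (∀ i → ι (p′ i) ≤ c₀ * P) →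
        Below (sumᴿ e′) (λ _ → Γ p′ e′)
      below-fold {zero}  p′ e′ 1<p′ p′≤ = proj₁ (sound-fromℚ 0ℚ)
      below-fold {suc m} p′ e′ 1<p′ p′≤ = below-+ (rowᴿ (e′ zero)) (sumᴿ (e′ ∘ suc)) {F = λ _ → row (e′ zero)} {G = λ _ → Γ (p′ ∘ suc) (e′ ∘ suc)}
        (below-row (e′ zero)) (below-fold (p′ ∘ suc) (e′ ∘ suc) (1<p′ ∘ suc) (p′≤ ∘ suc))
        where
        row : List ℕ → ℚ
        row ks = List.foldr _+_ 0ℚ (List.map (geometric (1 ⁄ p′ zero)) ks)
        below-row : ∀ ks → Below (rowᴿ ks) (λ _ → row ks)
        below-row []       = proj₁ (sound-fromℚ 0ℚ)
        below-row (k ∷ ks) = below-+ (termᴿ k) (rowᴿ ks) {F = λ _ → geometric (1 ⁄ p′ zero) k} {G = λ _ → row ks}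
          (λ Lq → near-map (λ z (q<t , c₀<z) → ℚₚ.<-≤-trans q<t (term-≤ k c₀<z (1<p′ zero) (p′≤ zero)))
                           (near-× (proj₁ (sound-term k) Lq) near->))
          (below-row ks)

    -- The resulting inequality is independent of the argument near c, so evaluating it at one such
    -- rational is enough.
    lhs-below : ∀ {q} → L (lhs c r p e) q → q < 1 ⁄ r + Γ p e
    lhs-below {q} Lq = ≡.subst (q <_)
      (≡.trans (cong (λ z → 1 ⁄ r + z + Γ (tail p) (tail e)) (1⁄p*K₁* (1<p zero) (1≤e zero))) (ℚₚ.+-assoc (1 ⁄ r) _ _))
      (proj₂ (near⇒∃ (below-+ (fromℚ (1 ⁄ r) +ᴿ fromℚ K) (sumᴿ (tail e)) {F = λ _ → 1 ⁄ r + K} {G = λ _ → Γ (tail p) (tail e)}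
        (below-+ (fromℚ (1 ⁄ r)) (fromℚ K) {F = λ _ → 1 ⁄ r} {G = λ _ → K} (proj₁ (sound-fromℚ (1 ⁄ r))) (proj₁ (sound-fromℚ K)))
        (below-fold (tail p) (tail e) (1<p ∘ suc) p≤c₀p₁) Lq)))
      where
      K = 1 ⁄ p₁ * K₁* {1} (λ _ → p₁) (λ _ → e zero)

open Cuts

-- Cross numbers: every block leaves C_r, or some block lies in C_r

module Blocks where
  import Algebra.Properties.CommutativeMonoid.Sum as Sum
  open import Data.Bool.Base using (Bool; false)
  open import Data.Fin.Base using (splitAt)
  open import Data.Fin.Subset using (_∈_; ⊤; ⊥; ∣_∣)
  open import Data.Fin.Subset.Properties
  open import Data.Integer.Base as ℤ using (ℤ)
  open import Data.Nat.Divisibility using (_∣_; divides)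
  open import Data.Nat.Primality using (Prime; prime⇒nonZero; prime⇒nonTrivial; euclidsLemma)
  open import Data.Rational.Base as ℚ using (ℚ; 1ℚ; _+_; _*_; _≤_; _<_)
  import Data.Rational.Properties as ℚₚ
  import Data.Sum.Properties as Sum⊎
  open import Data.Vec.Base using (lookup; tabulate)
  open import Data.Vec.Properties using (lookup-replicate; []=⇒lookup; lookup⇒[]=)
  open import Function.Base using (const)
  open import Function.Bundles using (_↔_; Inverse)
  import Function.Construct.Symmetry as Symmetry
  open import Relation.Nullary using (does)
  open import Relation.Nullary.Decidable using (_→-dec_; dec-true)
  open import Tactic.RingSolver using (solve-∀)

  open Sum ℚₚ.+-0-commutativeMonoid using (sum)

  private
    variable
      ℓ r : ℕ

  sum-mono : {f g : Vector ℚ ℓ} → (∀ i → f i ≤ g i) → sum f ≤ sum g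
  sum-mono {zero}  f≤g = ℚₚ.≤-refl
  sum-mono {suc ℓ} f≤g = ℚₚ.+-mono-≤ (f≤g zero) (sum-mono (f≤g ∘ suc))

  sum-const : ∀ ℓ x → sum {ℓ} (const x) ≡ ι ℓ * x
  sum-const zero    x = ≡.sym (ℚₚ.*-zeroˡ x)
  sum-const (suc ℓ) x = ≡.trans (cong (x +_) (sum-const ℓ x)) (≡.sym (≡.trans (cong (_* x) (ι-+ 1 ℓ)) (e x (ι ℓ))))
    where
    e : ∀ x y → (1ℚ + y) * x ≡ x + y * x
    e = solve-∀ ringℚ

  sum-≤-const : {f : Vector ℚ ℓ} → ∀ x → (∀ i → f i ≤ x) → sum f ≤ ι ℓ * x
  sum-≤-const {ℓ} x f≤x = ≡.subst (_ ≤_) (sum-const ℓ x) (sum-mono f≤x)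

  sum-≥⇒≡ : {f g : Vector ℚ ℓ} → (∀ i → f i ≤ g i) → sum g ≤ sum f → ∀ i → f i ≡ g i
  sum-≥⇒≡ {suc ℓ} {f} {g} f≤g Σg≤Σf = λ { zero → ℚₚ.≤-antisym (f≤g zero) g₀≤f₀ ; (suc i) → sum-≥⇒≡ (f≤g ∘ suc) tail≤ i }
    where
    g₀≤f₀ : g zero ≤ f zero
    g₀≤f₀ = ℚₚ.≮⇒≥ λ f₀<g₀ → ℚₚ.<-irrefl refl
      (ℚₚ.<-≤-trans (ℚₚ.+-mono-<-≤ f₀<g₀ (sum-mono (f≤g ∘ suc))) Σg≤Σf)
    tail≤ : sum (g ∘ suc) ≤ sum (f ∘ suc)
    tail≤ = ℚₚ.≮⇒≥ λ f<g → ℚₚ.<-irrefl refl (ℚₚ.<-≤-trans (ℚₚ.+-mono-≤-< (f≤g zero) f<g) Σg≤Σf)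

  -- If (x , y) and y have the same order then this order is prime to r, by
  -- r-torsion-freeness of G, and it kills x.
  same-order⇒≈0 : Prime r → ∀ (G : AbGroup) {q} → TorsionFreeBelow G q → r ℕ.< q →
    ∀ {x y o} → IsOrder (C r ⊕ G) (x , y) o → IsOrder G y o → AbelianGroup._≈_ (C r) x ℤ.0ℤ
  same-order⇒≈0 {r} pr G tf r<q {x} {y} {o} (_ , oxy≈0 , _) (0<o , oy≈0 , least)
    with euclidsLemma o ℤ.∣ x ∣ pr (multiple-C⁻ o (proj₁ (multiple-⊕⁻ (C r) G o {x} {y} oxy≈0)))
  ... | inj₂ r∣x = ∣abs⇒≈0 {r} {x} r∣x
  ... | inj₁ (divides zero refl) = contradiction 0<o λ ()
  -- Here the order is m r, and r kills the multiple of `y` by m; that multiple is 0, against the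
  -- minimality of the order.
  ... | inj₁ (divides m@(suc _) refl) = contradiction (least m (s≤s z≤n) my≈0) (ℕₚ.<⇒≱ m<o)
    where
    instance _ = prime⇒nonTrivial pr
    module G = AbelianGroup G
    open import Algebra.Properties.Monoid.Mult G.monoid using (×-assocˡ)
    my≈0 : multiple G m y G.≈ G.ε
    my≈0 = tf (ℕₚ.<-trans (s≤s z≤n) (ℕ.nonTrivial⇒n>1 r)) r<q
      (G.trans (×-assocˡ y r m) (G.trans (G.reflexive (cong (λ k → multiple G k y) (ℕₚ.*-comm r m))) oy≈0))
    m<o : m ℕ.< m ℕ.* r
    m<o = ℕₚ.m<m*n m r (ℕ.nonTrivial⇒n>1 r)

  finite-Cr : ∀ r → Prime r → Finite (C r) r r
  finite-Cr r pr = ≡.subst (λ n → Finite (C n) r n) (ℕₚ.^-identityʳ r) (finite-C 1 pr ℕₚ.≤-refl)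

  module Dichotomy (r : ℕ) (pr : Prime r) (±r : r ≡ 2 ⊎ r ≡ 3) (G : AbGroup) {q N : ℕ} (r<q : r ℕ.< q) (FG : Finite G q N)
    {ℓ} {S : IMultiset (C r ⊕ G) ℓ} (U : UFIM (C r ⊕ G) S) where

    private
      H = C r
      HG = C r ⊕ G
      module H = AbelianGroup H
      module G = AbelianGroup G
      module HG = AbelianGroup HG
      module FG = Finite FG
      instance
        _ = prime⇒nonTrivial pr
        _ = prime⇒nonZero pr
      1<r = ℕ.nonTrivial⇒n>1 r
      0<r = ℕₚ.<-trans (s≤s z≤n) 1<r
      0<q = ℕₚ.<-trans 0<r r<q

    module FH = Finite (finite-Cr r pr)

    private
      -- The bound on orders is lowered from q to r, the one that both summands share.
      FG′ : Finite G r N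
      FG′ = record { FG ; torsionFree = λ 0<o o<r → FG.torsionFree 0<o (ℕₚ.<-trans o<r r<q) }
      module FHG = Finite (finite-⊕ H G (finite-Cr r pr) FG′)

      open Combinatorics HG
      inter : IntersectionClosed S
      inter = UFIM⇒intersectionClosed FHG._≈?_ U
      open UFIM U
      open Factorization factorization
      blk = blockOf S factorization

    InH : Fin size → Set
    InH i = ∀ x → x ∈ block i → proj₂ (S x) G.≈ G.ε

    Outside : Fin size → Set
    Outside i = ∃ λ x → x ∈ block i × ¬ (proj₂ (S x) G.≈ G.ε)

    module Spread (notInH : ∀ i → Outside i) where

      private
        rep : Fin size → Fin ℓ
        rep i = proj₁ (notInH i)
        isRep : Fin ℓ → Bool
        isRep x = does (x Finₚ.≟ rep (blk x))
        isRep⁻ : ∀ {x} → x ∈ tabulate isRep → x ≡ rep (blk x)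
        isRep⁻ {x} x∈ with x Finₚ.≟ rep (blk x) | ∈-tabulate⁻ isRep x∈
        ... | yes eq | _ = eq
        ... | no _   | ()
        isRep⁺ : ∀ i → rep i ∈ tabulate isRep
        isRep⁺ i = ∈-tabulate⁺ isRep (dec-true (rep i Finₚ.≟ rep (blk (rep i)))
          (cong rep (≡.sym (∈⇒blockOf S factorization (proj₁ (proj₂ (notInH i)))))))

      bound : ∀ {v K} → CrossNumber HG S v →
        (∀ {v} → (∃ λ ℓ → Σ (IMultiset HG ℓ) λ S → OverNonzero HG S × ZeroSumFree HG S × CrossNumber HG S v) → v ≤ K) →
        ∃ λ M → 1 ℕ.≤ M × 2 ℕ.^ M ℕ.≤ r ℕ.* N × v ≤ K + ι M * (1 ⁄ q)
      bound {v} {K} (o , isOrder , refl) k≤K with separate (tabulate isRep)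
      ... | a , b , iso , in₁ , in₂ = M , ℕₚ.m≤n⊔m size 1 , 2^M≤ , (begin
        sum (1⁄ o)                                    ≡⟨ sum-reindex ℚₚ.+-0-commutativeMonoid iso (1⁄ o) ⟩
        sum (1⁄ o₁) + sum (1⁄ o₂)                     ≤⟨ ℚₚ.+-mono-≤ Σ₁≤ Σ₂≤ ⟩
        ι M * (1 ⁄ q) + K                             ≡⟨ ℚₚ.+-comm (ι M * (1 ⁄ q)) K ⟩
        K + ι M * (1 ⁄ q)                             ∎)
        where
        open ℚₚ.≤-Reasoning
        open Reindex iso
        1⁄ : ∀ {ℓ} → Vector ℕ ℓ → Vector ℚ ℓ
        1⁄ o i = 1 ⁄ o i
        o₁ = o ∘ to ∘ inj₁
        o₂ = o ∘ to ∘ inj₂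
        -- The empty multiset has no blocks, while the estimate of the logarithm asks for `1 ≤ M`;
        -- the value 1 is allowed since 2 ≤ r ≤ r N.
        M = size ℕ.⊔ 1
        2^M≤ : 2 ℕ.^ M ℕ.≤ r ℕ.* N
        2^M≤ with ℕₚ.⊔-sel size 1
        ... | inj₁ eq = ≡.subst (λ m → 2 ℕ.^ m ℕ.≤ r ℕ.* N) (≡.sym eq) (2^size≤ FHG._≈?_ U FHG.code FHG.injective)
        ... | inj₂ eq = ≡.subst (λ m → 2 ℕ.^ m ℕ.≤ r ℕ.* N) (≡.sym eq)
          (ℕₚ.≤-trans 1<r (ℕₚ.m≤m*n r N {{Finₚ.nonZeroIndex (FG.code G.ε)}}))
        rep-in₁ : ∀ i → to (inj₁ i) ≡ rep (blk (to (inj₁ i)))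
        rep-in₁ i = isRep⁻ (in₁ i)
        a≤size : a ℕ.≤ size
        a≤size = Finₚ.injective⇒≤ {f = blk ∘ to ∘ inj₁} λ {i} {j} eq → Sum⊎.inj₁-injective (same i j eq)
          where
          same : ∀ i j → blk (to (inj₁ i)) ≡ blk (to (inj₁ j)) → inj₁ i ≡ inj₁ j
          same i j eq = ≡.trans (≡.sym (Inverse.strictlyInverseʳ iso (inj₁ i)))
            (≡.trans (cong from (≡.trans (rep-in₁ i) (≡.trans (cong rep eq) (≡.sym (rep-in₁ j)))))
              (Inverse.strictlyInverseʳ iso (inj₁ j)))
        -- The order in `C r ⊕ G` kills the component in `G`, which is nonzero for a removed
        -- element.
        q≤o₁ : ∀ i → q ℕ.≤ o₁ i
        q≤o₁ i = let 0<o , os≈0 , _ = isOrder (to (inj₁ i)) in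
          order-≥ G FG.torsionFree
            (≡.subst (λ x → ¬ (proj₂ (S x) G.≈ G.ε)) (≡.sym (rep-in₁ i)) (proj₂ (proj₂ (notInH (blk (to (inj₁ i)))))))
            0<o (proj₂ (multiple-⊕⁻ H G (o₁ i) os≈0))
        Σ₁≤ : sum (1⁄ o₁) ≤ ι M * (1 ⁄ q)
        Σ₁≤ = ℚₚ.≤-trans (sum-≤-const (1 ⁄ q) λ i → 1⁄-anti 0<q (q≤o₁ i))
          (*-monoʳ-≤ (1 ⁄ q) (0≤⁄ 1 q) (ι-mono-≤ (ℕₚ.≤-trans a≤size (ℕₚ.m≤m⊔n size 1))))
        -- A zero-sum part is a union of blocks, so it would contain a removed element.
        zeroSumFree : ZeroSumFree HG (S ∘ to ∘ inj₂)
        zeroSumFree J (j , j∈J) zJ = in₂-rep (zeroSum⇒blockClosed S factorization inter zGlue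
          (∈-blockOf S factorization y) (proj₁ (proj₂ (notInH (blk y)))) y∈)
          where
          y = to (inj₂ j)
          zGlue : ZeroSum HG S (glue ⊥ J)
          zGlue = zeroSum-⊥glue⁺ HG S J zJ
          y∈ : y ∈ glue ⊥ J
          y∈ = lookup⇒[]= y _ (≡.trans (lookup-glue ⊥ J (inj₂ j)) ([]=⇒lookup j∈J))
          in₂-rep : ¬ (rep (blk y) ∈ glue ⊥ J)
          in₂-rep x∈ with from (rep (blk y)) in eq
          ... | inj₁ i = contradiction (≡.trans (≡.sym (lookup-replicate i false)) (≡.trans (≡.sym (lookup-glue ⊥ J (inj₁ i)))
            (≡.trans (cong (lookup (glue ⊥ J)) (Inverse.inverseˡ iso (≡.sym eq))) ([]=⇒lookup x∈)))) λ ()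
          ... | inj₂ k = in₂ k (≡.subst (_∈ tabulate isRep) (≡.sym (Inverse.inverseˡ iso (≡.sym eq))) (isRep⁺ (blk y)))
        Σ₂≤ : sum (1⁄ o₂) ≤ K
        Σ₂≤ = k≤K (b , S ∘ to ∘ inj₂ , (λ j → overNonzero (to (inj₂ j))) , zeroSumFree , o₂ , (λ j → isOrder (to (inj₂ j))) , refl)

    module Inside (i : Fin size) (inH : InH i) where

      private
        parts = separate (block i)
        a = proj₁ parts
        b = proj₁ (proj₂ parts)
        iso : (Fin a ⊎ Fin b) ↔ Fin ℓ
        iso = proj₁ (proj₂ (proj₂ parts))
        in₁ = proj₁ (proj₂ (proj₂ (proj₂ parts)))
        in₂ = proj₂ (proj₂ (proj₂ (proj₂ parts)))
        open Reindex iso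
        T₁ : IMultiset H a
        T₁ = proj₁ ∘ S ∘ to ∘ inj₁
        T₂ : IMultiset G b
        T₂ = proj₂ ∘ S ∘ to ∘ inj₂

        S₁⊆H : ∀ j → proj₂ (S (to (inj₁ j))) G.≈ G.ε
        S₁⊆H j = inH (to (inj₁ j)) (in₁ j)

        ∈-glue⊥ : ∀ J {x} → x ∈ glue J ⊥ → ∃ λ j → to (inj₁ j) ≡ x × j ∈ J
        ∈-glue⊥ J {x} x∈ with from x in eq
        ... | inj₁ j = j , to≡ , lookup⇒[]= j J (≡.trans (≡.sym (lookup-glue J ⊥ (inj₁ j)))
            (≡.trans (cong (lookup (glue J ⊥)) to≡) ([]=⇒lookup x∈)))
          where to≡ = Inverse.inverseˡ iso (≡.sym eq)
        ... | inj₂ k = contradiction (≡.trans (≡.sym (lookup-replicate k false)) (≡.trans (≡.sym (lookup-glue J ⊥ (inj₂ k)))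
            (≡.trans (cong (lookup (glue J ⊥)) (Inverse.inverseˡ iso (≡.sym eq))) ([]=⇒lookup x∈)))) λ ()

        glue⊥-∈ : ∀ J {j} → j ∈ J → to (inj₁ j) ∈ glue J ⊥
        glue⊥-∈ J {j} j∈ = lookup⇒[]= _ _ (≡.trans (lookup-glue J ⊥ (inj₁ j)) ([]=⇒lookup j∈))

        block-inj₁ : ∀ {x} → x ∈ block i → ∃ λ j → to (inj₁ j) ≡ x
        block-inj₁ {x} x∈ with from x in eq
        ... | inj₁ j = j , Inverse.inverseˡ iso (≡.sym eq)
        ... | inj₂ k = contradiction (≡.subst (_∈ block i) (≡.sym (Inverse.inverseˡ iso (≡.sym eq))) x∈) (in₂ k)

        glue-⊤⊥ : glue ⊤ ⊥ ≡ block i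
        glue-⊤⊥ = ⊆-antisym
          (λ x∈ → let j , to≡ , _ = ∈-glue⊥ ⊤ x∈ in ≡.subst (_∈ block i) to≡ (in₁ j))
          (λ x∈ → let j , to≡ = block-inj₁ x∈ in ≡.subst (_∈ glue ⊤ ⊥) to≡ (glue⊥-∈ ⊤ ∈⊤))

        zS₁ : ZeroSum H T₁ ⊤
        zS₁ = proj₁ (DirectSum.zeroSum-⊕⁻ H G (S ∘ to ∘ inj₁) ⊤ (zeroSum-glue⊥⁻ HG S ⊤
          (≡.subst (ZeroSum HG S) (≡.sym glue-⊤⊥) (proj₁ (minimal i)))))

        -- The G-components of the block vanish, so zero sums in `H` and in `H ⊕ G` agree on it.
        -- Minimality is what `davenport` needs to bound the block by r elements.
        minimal₁ : MinimalZeroSum H T₁ ⊤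
        minimal₁ = zS₁ , λ J (j , j∈J) (_ , k , _ , k∉J) zJ → proj₂ (minimal i) (glue J ⊥)
          (to (inj₁ j) , glue⊥-∈ J j∈J)
          ((λ x∈ → let j , to≡ , _ = ∈-glue⊥ J x∈ in ≡.subst (_∈ block i) to≡ (in₁ j)) ,
           to (inj₁ k) , in₁ k , λ k∈ → let j , to≡ , j∈J = ∈-glue⊥ J k∈ in k∉J (≡.subst (_∈ J) (same j k to≡) j∈J))
          (zeroSum-glue⊥⁺ HG S J (DirectSum.zeroSum-⊕⁺ H G (S ∘ to ∘ inj₁) J zJ (σ-zero G S₁⊆H J)))
          where
          same : ∀ j k → to (inj₁ j) ≡ to (inj₁ k) → j ≡ k
          same j k eq with ≡.trans (≡.sym (Inverse.strictlyInverseʳ iso (inj₁ j)))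
            (≡.trans (cong from eq) (Inverse.strictlyInverseʳ iso (inj₁ k)))
          ... | refl = refl

        ufim₁ : UFIM H T₁
        ufim₁ = DirectSum.UFIM-summand₁ H G FH._≈?_ FG._≈?_ U iso S₁⊆H zS₁

        ufim₂ : UFIM G T₂
        ufim₂ = DirectSum.UFIM-image₂ H G FH._≈?_ FG._≈?_ U iso S₁⊆H zS₁
          (all-reached H FH._≈?_ (Small.≈± r ±r) T₁ (proj₁ (block-inj₁ (proj₂ (nonempty i)))) (UFIM.overNonzero ufim₁) zS₁)

      -- Passing to the image in `G` can only lower orders, so every reciprocal grows; the block
      -- contributes at most r terms of at most 1 / r each.
      bound : ∀ {v K} → CrossNumber HG S v →
        (∀ {v} → (∃ λ ℓ → Σ (IMultiset G ℓ) λ S → UFIM G S × CrossNumber G S v) → v ≤ K) →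
        v ≤ 1ℚ + K × (v ≡ 1ℚ + K → Decomposition H G S)
      bound {v} {K} (o , isOrder , refl) K₁≤K =
        ≡.subst (_≤ 1ℚ + K) (≡.sym split) (ℚₚ.+-mono-≤ Σ₁≤1 (ℚₚ.≤-trans (sum-mono o₂≤) Σ′≤K)) ,
        λ v≡ → record
          { S₁ = T₁ ; S₂ = T₂ ; ufim₁ = ufim₁ ; ufim₂ = ufim₂ ; index = iso
          ; eq₁ = λ j → H.refl {proj₁ (S (to (inj₁ j)))} , S₁⊆H j
          ; eq₂ = λ j → same-order⇒≈0 pr G FG.torsionFree r<q (isOrder (to (inj₂ j)))
              (≡.subst (IsOrder G (T₂ j)) (≡.sym (o₂≡ v≡ j)) (proj₂ (proj₂ (order₂ j)))) , G.refl
          }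
        where
        1⁄ : ∀ {ℓ} → Vector ℕ ℓ → Vector ℚ ℓ
        1⁄ o i = 1 ⁄ o i
        o₁ = o ∘ to ∘ inj₁
        o₂ = o ∘ to ∘ inj₂
        split : sum (1⁄ o) ≡ sum (1⁄ o₁) + sum (1⁄ o₂)
        split = sum-reindex ℚₚ.+-0-commutativeMonoid iso (1⁄ o)
        order₂ : ∀ j → ∃ λ o′ → o′ ℕ.≤ o₂ j × IsOrder G (T₂ j) o′
        order₂ j = let 0<o , os≈0 , _ = isOrder (to (inj₂ j)) in
          order-≤ G FG._≈?_ 0<o (proj₂ (multiple-⊕⁻ H G (o₂ j) os≈0))
        o₂′ : Vector ℕ b
        o₂′ j = proj₁ (order₂ j)
        0<o₂′ : ∀ j → 0 ℕ.< o₂′ j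
        0<o₂′ j = proj₁ (proj₂ (proj₂ (order₂ j)))
        o₂≤ : ∀ j → 1 ⁄ o₂ j ≤ 1 ⁄ o₂′ j
        o₂≤ j = 1⁄-anti (0<o₂′ j) (proj₁ (proj₂ (order₂ j)))
        Σ′≤K : sum (1⁄ o₂′) ≤ K
        Σ′≤K = K₁≤K (b , T₂ , ufim₂ , o₂′ , (λ j → proj₂ (proj₂ (order₂ j))) , refl)
        r≤o₁ : ∀ j → r ℕ.≤ o₁ j
        r≤o₁ j = let 0<o , os≈0 , _ = isOrder (to (inj₁ j)) in
          order-≥ H FH.torsionFree (UFIM.overNonzero ufim₁ j) 0<o (proj₁ (multiple-⊕⁻ H G (o₁ j) os≈0))
        Σ₁≤1 : sum (1⁄ o₁) ≤ 1ℚ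
        Σ₁≤1 = begin
          sum (1⁄ o₁)       ≤⟨ sum-≤-const (1 ⁄ r) (λ j → 1⁄-anti 0<r (r≤o₁ j)) ⟩
          ι a * (1 ⁄ r)     ≤⟨ *-monoʳ-≤ (1 ⁄ r) (0≤⁄ 1 r) (ι-mono-≤ (davenport H T₁ minimal₁ FH.code FH.injective)) ⟩
          ι r * (1 ⁄ r)     ≡⟨ ℚₚ.*-comm (ι r) (1 ⁄ r) ⟩
          (1 ⁄ r) * ι r     ≡⟨ ⁄-* 1 0<r ⟩
          1ℚ                ∎
          where open ℚₚ.≤-Reasoning
        o₂≡ : sum (1⁄ o) ≡ 1ℚ + K → ∀ j → o₂ j ≡ o₂′ j
        o₂≡ v≡ j = 1⁄-injective (proj₁ (isOrder (to (inj₂ j)))) (0<o₂′ j) (sum-≥⇒≡ o₂≤ Σ′≤ j)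
          where
          Σ′≤ : sum (1⁄ o₂′) ≤ sum (1⁄ o₂)
          -- If the part outside the block fell short of K, the total would fall short of 1 + K; so
          -- the termwise inequalities are equalities.
          Σ′≤ = ℚₚ.≤-trans Σ′≤K (ℚₚ.≮⇒≥ λ Σ₂<K → ℚₚ.<-irrefl (≡.trans (≡.sym split) v≡) (ℚₚ.+-mono-≤-< Σ₁≤1 Σ₂<K))

    dichotomy : (∃ λ i → InH i) ⊎ (∀ i → Outside i)
    dichotomy with Finₚ.any? (λ i → Finₚ.all? λ x → (x ∈? block i) →-dec (proj₂ (S x) FG.≈? G.ε))
    ... | yes found = inj₁ found
    ... | no  none  = inj₂ λ i → outside i
      where
      outside : ∀ i → Outside i
      outside i with Finₚ.¬∀⟶∃¬ ℓ _ (λ x → (x ∈? block i) →-dec (proj₂ (S x) FG.≈? G.ε)) (λ all → none (i , all))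
      ... | x , ¬imp with x ∈? block i
      ...   | yes x∈ = x , x∈ , λ z → ¬imp λ _ → z
      ...   | no  x∉ = contradiction (λ x∈ → contradiction x∈ x∉) ¬imp

  module Attained (r : ℕ) (pr : Prime r) (G : AbGroup) {q N : ℕ} (FG : Finite G q N) where
    private
      H = C r
      HG = C r ⊕ G
      module H = AbelianGroup H
      module G = AbelianGroup G
      module HG = AbelianGroup HG
      instance
        _ = prime⇒nonZero pr
      0<r : 0 ℕ.< r
      0<r = ℕ.>-nonZero⁻¹ r

    -- The lower bound for K₁: r copies of 1 in C_r contribute r times 1 / r.
    extend : ∀ {v} → (∃ λ ℓ → Σ (IMultiset G ℓ) λ S → UFIM G S × CrossNumber G S v) →
      ∃ λ ℓ → Σ (IMultiset HG ℓ) λ S → UFIM HG S × CrossNumber HG S (1ℚ + v)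
    extend {v} (ℓ , T , U , o , isOrder , refl) = r ℕ.+ ℓ , S ∘ splitAt r ,
      DirectSum.UFIM-⊕ H G (Finite._≈?_ (finite-Cr r pr)) (Finite._≈?_ FG) (UFIM-ones pr) U (S ∘ splitAt r) (Symmetry.inverse Finₚ.+↔⊎)
        (λ i → HG.reflexive (cong S (Finₚ.splitAt-join r ℓ (inj₁ i))))
        (λ j → HG.reflexive (cong S (Finₚ.splitAt-join r ℓ (inj₂ j)))) ,
      order ∘ splitAt r , (λ i → isOrder′ (splitAt r i)) , (begin
        1ℚ + sum (λ j → 1 ⁄ o j)                  ≡⟨ cong (_+ sum (λ j → 1 ⁄ o j)) (⁄-* 1 0<r) ⟨
        (1 ⁄ r) * ι r + sum (λ j → 1 ⁄ o j)
          ≡⟨ cong (_+ sum (λ j → 1 ⁄ o j)) (≡.trans (ℚₚ.*-comm (1 ⁄ r) (ι r)) (≡.sym (sum-const r (1 ⁄ r)))) ⟩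
        sum {r} (const (1 ⁄ r)) + sum (λ j → 1 ⁄ o j) ≡⟨ sum-++ ℚₚ.+-0-commutativeMonoid r (λ s → 1 ⁄ order s) ⟨
        sum (λ i → 1 ⁄ order (splitAt r i))       ∎)
      where
      open ≡.≡-Reasoning
      S : Fin r ⊎ Fin ℓ → HG.Carrier
      S = [ (λ _ → ℤ.1ℤ , G.ε) , (λ j → ℤ.0ℤ , T j) ]′
      order : Fin r ⊎ Fin ℓ → ℕ
      order = [ const r , o ]′
      isOrder′ : ∀ s → IsOrder HG (S s) (order s)
      isOrder′ (inj₁ _) = order-inj₁ H G (order-C-1 0<r)
      isOrder′ (inj₂ j) = order-inj₂ H G (isOrder j)

open Blocks

-- Rational approximation of c and the conclusion

open import Data.Fin.Base using () renaming (_<_ to _<ᶠ_; fromℕ to lastFin)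
open import Data.List.Base using ([]; [_])
open import Data.List.Relation.Unary.All as All using (All)
open import Data.Nat.Base using (_≤_; _<_)
open import Data.Nat.Primality using (Prime; prime[2]; prime?; prime⇒nonTrivial)
open import Data.Rational.Base as ℚ using (ℚ; 0ℚ; 1ℚ; ½; _+_; _*_)
import Data.Rational.Properties as ℚₚ
open import Data.Vec.Functional using (_∷_)
open import Relation.Binary.Definitions using (tri<; tri≈; tri>)
open import Relation.Nullary.Decidable using (from-yes)
open import Tactic.RingSolver using (solve-∀)

module _ {n} {p : Vector ℕ (suc n)} (increasing : ∀ i j → i <ᶠ j → p i < p j) where

  first-≤ : ∀ i → p zero ≤ p i
  first-≤ zero    = ℕₚ.≤-refl
  first-≤ (suc i) = ℕₚ.<⇒≤ (increasing zero (suc i) (s≤s z≤n))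

  ≤-last : ∀ i → p i ≤ p (lastFin n)
  ≤-last i with Finₚ.<-cmp i (lastFin n)
  ... | tri< i<l _ _ = ℕₚ.<⇒≤ (increasing i (lastFin n) i<l)
  ... | tri≈ _ i≡l _ = ℕₚ.≤-reflexive (cong p i≡l)
  ... | tri> _ _ l<i = contradiction (Finₚ.≤fromℕ i) (ℕₚ.<⇒≱ l<i)

-- As p_n < c p₁ is strict, it survives replacing c by a slightly smaller rational. The condition 1
-- < c₀ p₁ keeps the denominators in (*) positive near c.
record LowerApproximation (c : Cut) {n} (p : Vector ℕ (suc n)) : Set where
  field
    c₀     : ℚ
    0<c₀   : 0ℚ ℚ.< c₀
    L-c₀   : L c c₀
    1<c₀p₁ : 1ℚ ℚ.< c₀ * ι (p zero)
    p≤c₀p₁ : ∀ i → ι (p (suc i)) ℚ.≤ c₀ * ι (p zero)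

-- The lower end of the interval around c serves: both corners with `s` exceed `q`, hence so does
-- `s * P` between them.
below-*ᴿ : ∀ {c P q} → 0ℚ ℚ.< P → L (c *ᴿ fromℚ P) q → 0ℚ ℚ.< q →
  ∃ λ s → L c s × 0ℚ ℚ.< s × q ℚ.< s * P
below-*ᴿ {P = P} {q} 0<P (s , t , u , v , Ls , Ut , u<P , P<v , q<su , q<sv , _) 0<q = s , Ls , 0<s , q<sP
  where
  q<sP : q ℚ.< s * P
  q<sP = ≡.subst (q ℚ.<_) (ℚₚ.*-comm P s) (linear-below s u<P P<v
    (≡.subst (q ℚ.<_) (ℚₚ.*-comm s u) q<su) (≡.subst (q ℚ.<_) (ℚₚ.*-comm s v) q<sv))
  0<s : 0ℚ ℚ.< s
  0<s = ℚₚ.*-cancelʳ-<-nonNeg P {{ℚ.nonNegative (ℚₚ.<⇒≤ 0<P)}}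
    (≡.subst (ℚ._< s * P) (≡.sym (ℚₚ.*-zeroˡ P)) (ℚₚ.<-trans 0<q q<sP))

approximate : ∀ c → fromℕ 1 ≤ᴿ c → ∀ n (p : Vector ℕ (suc n)) → (∀ i → 2 < p i) →
  (∀ i j → i <ᶠ j → p i < p j) → (1 < suc n → fromℕ (p (lastFin n)) <ᴿ c *ᴿ fromℕ (p zero)) → LowerApproximation c p
approximate c 1≤c zero p 2<p _ _ = record
  -- With a single prime only 1 < c₀ p₁ remains, and p₁ > 2 allows one half.
  { c₀ = ½ ; 0<c₀ = ℚₚ.positive⁻¹ ½ ; L-c₀ = 1≤c (from-yes (½ ℚₚ.<? 1ℚ))
  ; 1<c₀p₁ = *-monoˡ-< ½ (ℚₚ.positive⁻¹ ½) (ι-mono-< (2<p zero)) ; p≤c₀p₁ = λ () }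
approximate c 1≤c (suc n) p 2<p increasing p<cp₁ =
  let q , pₙ<q , Lq = p<cp₁ (s≤s (s≤s z≤n))
      0<pₙ = 0<ι (ℕₚ.<-trans (s≤s z≤n) (2<p (lastFin (suc n))))
      s , Ls , 0<s , q<sP = below-*ᴿ {c} {ι (p zero)} {q} (0<ι (ℕₚ.<-trans (s≤s z≤n) (2<p zero))) Lq (ℚₚ.<-trans 0<pₙ pₙ<q)
      pₙ<sP = ℚₚ.<-trans pₙ<q q<sP
  in record
  { c₀ = s ; 0<c₀ = 0<s ; L-c₀ = Ls
  ; 1<c₀p₁ = ℚₚ.<-trans (ι-mono-< (ℕₚ.<-trans (s≤s (s≤s z≤n)) (2<p (lastFin (suc n))))) pₙ<sP
  ; p≤c₀p₁ = λ i → ℚₚ.≤-trans (ι-mono-≤ (≤-last increasing (suc i))) (ℚₚ.<⇒≤ pₙ<sP) }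

prime-2-3 : ∀ {r} → r ≡ 2 ⊎ r ≡ 3 → Prime r
prime-2-3 (inj₁ refl) = prime[2]
prime-2-3 (inj₂ refl) = from-yes (prime? 3)

module Assembly (c : Cut) (real : IsReal c) (1≤c : fromℕ 1 ≤ᴿ c) (r : ℕ) (r≡ : r ≡ 2 ⊎ r ≡ 3)
  (n : ℕ) (p : Vector ℕ (suc n)) (e : Exponents (suc n))
  (primes : ∀ i → Prime (p i)) (r<p : ∀ i → r < p i) (1≤e : ∀ i → All (1 ≤_) (e i))
  (increasing : ∀ i j → i <ᶠ j → p i < p j)
  (p<cp₁ : 1 < suc n → fromℕ (p (lastFin n)) <ᴿ c *ᴿ fromℕ (p zero)) where

  G = ⨁C p e
  p₁ = p zero

  prime-r : Prime r
  prime-r = prime-2-3 r≡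
  2≤r : 2 ≤ r
  2≤r = ℕ.nonTrivial⇒n>1 r {{prime⇒nonTrivial prime-r}}
  0<r : 0 < r
  0<r = ℕₚ.<-trans (s≤s z≤n) 2≤r
  2<p : ∀ i → 2 < p i
  2<p i = ℕₚ.≤-<-trans 2≤r (r<p i)
  1<p : ∀ i → 1 < p i
  1<p i = ℕₚ.<-trans (s≤s (s≤s z≤n)) (2<p i)
  0<p₁ : 0 < p₁
  0<p₁ = ℕₚ.<-trans (s≤s z≤n) (1<p zero)

  N : ℕ
  N = fold₂ ℕ._*_ 1 (λ i k → p i ℕ.^ k) e
  finite-G : Finite G p₁ N
  finite-G = finite-⨁C p e primes (first-≤ increasing)

  open LowerApproximation (approximate c 1≤c n p 2<p increasing p<cp₁)
  open Bounds c real c₀ 0<c₀ L-c₀ r 0<r p e 1<p 1≤e 1<c₀p₁ p≤c₀p₁ using (rhs-atLeast; lhs-below)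

  Kᵀ = K₁* (r ∷ p) ([ 1 ] ∷ e)
  kᵀ = k* (r ∷ p) ([ 1 ] ∷ e)
  bound = 1 ⁄ r + Γ p e

  1+K₁*≡ : 1ℚ + K₁* p e ≡ Kᵀ
  1+K₁*≡ = cong (_+ K₁* p e) (≡.sym (≡.trans (ℚₚ.+-identityʳ _) (≡.trans (K₁-term 2≤r 0) (ℚₚ.+-identityʳ 1ℚ))))

  Kᵀ≡ : Kᵀ ≡ kᵀ + bound
  Kᵀ≡ = ≡.trans (K₁*≡k*+Γ (r ∷ p) ([ 1 ] ∷ e) (λ { zero → 2≤r ; (suc i) → 1<p i }) (λ { zero → s≤s z≤n All.∷ All.[] ; (suc i) → 1≤e i }))
    (simplify kᵀ (1 ⁄ r) (Γ p e))
    where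
    simplify : ∀ k x g → k + ((x * (1ℚ + 0ℚ) + 0ℚ) + g) ≡ k + (x + g)
    simplify = solve-∀ ringℚ

  -- Cross numbers produce `1 ⁄ p₁`, the estimate of `rhs` produces `inv`.
  M/p₁≤ : ∀ M → ι M * (1 ⁄ p₁) ℚ.≤ ι M * inv (ι p₁)
  M/p₁≤ M = ℚₚ.≤-reflexive (cong (ι M *_) (*-cancelʳ-≡ (ι p₁) (0<ι 0<p₁)
    (≡.trans (⁄-* 1 0<p₁) (≡.sym (inv-* (0<ι 0<p₁))))))

  module Conclusion (K₁≡K₁* : K₁≡ G (K₁* p e)) (k≡k* : k≡ (C r ⊕ G) kᵀ) (rhs≤lhs : rhs c r p e ≤ᴿ lhs c r p e) where
    private
      K₁-attained = proj₁ K₁≡K₁*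
      K₁-max : ∀ {v} → (∃ λ ℓ → Σ (IMultiset G ℓ) λ S → UFIM G S × CrossNumber G S v) → v ℚ.≤ K₁* p e
      K₁-max = proj₂ K₁≡K₁*
      k-max : ∀ {v} → (∃ λ ℓ → Σ (IMultiset (C r ⊕ G) ℓ) λ S → OverNonzero (C r ⊕ G) S × ZeroSumFree (C r ⊕ G) S × CrossNumber (C r ⊕ G) S v) → v ℚ.≤ kᵀ
      k-max = proj₂ k≡k*
    -- Otherwise `bound` lies in the lower cut of `rhs`, by (*) in that of `lhs`, and so below
    -- itself.
    M/p₁≤bound : ∀ {M} → 1 ≤ M → 2 ℕ.^ M ≤ r ℕ.* N → ι M * inv (ι p₁) ℚ.≤ bound
    M/p₁≤bound {M} 1≤M 2^M≤ = ℚₚ.≮⇒≥ λ bound< → ℚₚ.<-irrefl {bound} refl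
      (lhs-below {bound} (rhs≤lhs {bound} (rhs-atLeast {M} 1≤M 2^M≤ {bound} bound<)))

    -- The converse of (*) from the chain lhs ≤ bound ≤ M / p₁ ≤ rhs; this is how an extremal
    -- multiset forces equality.
    bound≤M/p₁ : ∀ {M} → 1 ≤ M → 2 ℕ.^ M ≤ r ℕ.* N → bound ℚ.≤ ι M * inv (ι p₁) → lhs c r p e ≤ᴿ rhs c r p e
    bound≤M/p₁ {M} 1≤M 2^M≤ bound≤ {q} Lq = rhs-atLeast {M} 1≤M 2^M≤ {q} (ℚₚ.<-≤-trans (lhs-below {q} Lq) bound≤)

    module _ {ℓ} {S : IMultiset (C r ⊕ G) ℓ} (U : UFIM (C r ⊕ G) S) where
      open Dichotomy r prime-r r≡ G (r<p zero) finite-G U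

      -- The two outcomes for an extremal `S`: a decomposition, or the inequality opposite to (*).
      Decomposes Tight : ℚ → Set
      Decomposes v = v ℚ.≤ Kᵀ × (v ≡ Kᵀ → Decomposition (C r) G S)
      Tight v = v ℚ.≤ Kᵀ × (v ≡ Kᵀ → lhs c r p e ≤ᴿ rhs c r p e)

      inside : ∀ {v} → CrossNumber (C r ⊕ G) S v → (∃ λ i → InH i) → Decomposes v
      inside {v} cross (i , inH) = ≡.subst (λ K → v ℚ.≤ K × (v ≡ K → Decomposition (C r) G S)) 1+K₁*≡
        (Inside.bound i inH cross K₁-max)

      outside : ∀ {v} → CrossNumber (C r ⊕ G) S v → (∀ i → Outside i) → Tight v
      outside {v} cross out =
        let M , 1≤M , 2^M≤ , v≤ = Spread.bound out cross k-max in step M 1≤M 2^M≤ v≤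
        where
        step : ∀ M → 1 ≤ M → 2 ℕ.^ M ≤ r ℕ.* N → v ℚ.≤ kᵀ + ι M * (1 ⁄ p₁) → Tight v
        step M 1≤M 2^M≤ v≤ =
          ≡.subst (v ℚ.≤_) (≡.sym Kᵀ≡) (ℚₚ.≤-trans v≤k+x (ℚₚ.+-monoʳ-≤ kᵀ (M/p₁≤bound 1≤M 2^M≤))) ,
          λ v≡Kᵀ {q} → bound≤M/p₁ 1≤M 2^M≤ (ℚₚ.≮⇒≥ λ x<bound →
            ℚₚ.<-irrefl (≡.trans v≡Kᵀ Kᵀ≡) (ℚₚ.≤-<-trans v≤k+x (ℚₚ.+-monoʳ-< kᵀ x<bound))) {q}
          where
          v≤k+x : v ℚ.≤ kᵀ + ι M * inv (ι p₁)
          v≤k+x = ℚₚ.≤-trans v≤ (ℚₚ.+-monoʳ-≤ kᵀ (M/p₁≤ M))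

      cases : ∀ {v} → CrossNumber (C r ⊕ G) S v → Decomposes v ⊎ Tight v
      cases cross = [ inj₁ ∘ inside cross , inj₂ ∘ outside cross ]′ dichotomy

    K₁-⊕ : K₁≡ (C r ⊕ G) Kᵀ
    K₁-⊕ = ≡.subst (λ K → ∃ λ ℓ → Σ (IMultiset (C r ⊕ G) ℓ) λ S → UFIM (C r ⊕ G) S × CrossNumber (C r ⊕ G) S K)
        1+K₁*≡ (Attained.extend r prime-r G finite-G K₁-attained) ,
      λ (_ , S , U , cross) → upper U cross
      where
      upper : ∀ {ℓ v} {S : IMultiset (C r ⊕ G) ℓ} → UFIM (C r ⊕ G) S → CrossNumber (C r ⊕ G) S v → v ℚ.≤ Kᵀ
      upper U cross = [ proj₁ , proj₁ ]′ (cases U cross)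

    decompose : ¬ (lhs c r p e ≃ᴿ rhs c r p e) →
      ∀ {ℓ} (S : IMultiset (C r ⊕ G) ℓ) (v : ℚ) → UFIM (C r ⊕ G) S → CrossNumber (C r ⊕ G) S v →
      K₁≡ (C r ⊕ G) v → Decomposition (C r) G S
    decompose strict S v U cross (attained , max) =
      [ (λ (v≤ , decomposition) → decomposition (v≡Kᵀ v≤))
      , (λ (v≤ , lhs≤rhs) → contradiction ((λ {q} → lhs≤rhs (v≡Kᵀ v≤) {q}) , (λ {q} → rhs≤lhs {q})) strict)
      ]′ (cases U cross)
      where
      v≡Kᵀ : v ℚ.≤ Kᵀ → v ≡ Kᵀ
      v≡Kᵀ v≤ = ℚₚ.≤-antisym v≤ (max (proj₁ K₁-⊕))

theorem8 :
    (c : Cut) → IsReal c → fromℕ 1 ≤ᴿ c →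
    (r : ℕ) → r ≡ 2 ⊎ r ≡ 3 →
    (n : ℕ) (p : Vector ℕ (suc n)) (e : Exponents (suc n)) →
    (∀ i → Prime (p i)) →
    (∀ i → r < p i) →
    (∀ i → e i ≢ []) →
    (∀ i → All (1 ≤_) (e i)) →
    (∀ i j → i <ᶠ j → p i < p j) →
    (1 < suc n → fromℕ (p (lastFin n)) <ᴿ c *ᴿ fromℕ (p zero)) →
    K₁≡ (⨁C p e) (K₁* p e) →
    k≡ (C r ⊕ ⨁C p e) (k* (r ∷ p) ([ 1 ] ∷ e)) →
    rhs c r p e ≤ᴿ lhs c r p e →
    K₁≡ (C r ⊕ ⨁C p e) (K₁* (r ∷ p) ([ 1 ] ∷ e)) ×
    (¬ (lhs c r p e ≃ᴿ rhs c r p e) →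
      ∀ {ℓ} (S : IMultiset (C r ⊕ ⨁C p e) ℓ) (v : ℚ) →
      UFIM (C r ⊕ ⨁C p e) S →
      CrossNumber (C r ⊕ ⨁C p e) S v →
      K₁≡ (C r ⊕ ⨁C p e) v →
      Decomposition (C r) (⨁C p e) S)
theorem8 c real 1≤c r r≡ n p e primes r<p _ 1≤e increasing p<cp₁ K₁≡K₁* k≡k* rhs≤lhs = K₁-⊕ , decompose
  where
  open Assembly c real 1≤c r r≡ n p e primes r<p 1≤e increasing p<cp₁
  open Conclusion K₁≡K₁* k≡k* (λ {q} → rhs≤lhs {q})
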